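{- Let $p$ be a prime, let $s\ge1$ and $m\ge 1$ be integers, and let $n_1,\ldots,n_{s}$ be nonnegative integers with $n_s\ge 1$. Let $H$ be an $m\times(n_1+2n_2+\cdots+sn_s)$ matrix of rank $m$ over $\mathbb{F}_p$, and let $C$ be the null-space of $H$, so that $C$ is an additive code in $(\mathbb{F}_p^1)^{n_1}\times\cdots\times(\mathbb{F}_p^s)^{n_s}$. Denote $$k=\sum_{i=1}^s n_i(p^s-p^{s-i})=p^s\sum_{i=1}^s n_i(1-p^{ -i}),\qquad \mu=\frac{k}{p^m-1},\qquad q_i=p^i .$$ The following assertions are equivalent: (i) $C$ is an $\mathrm{OA}(|C|,q_1^{n_1}q_2^{n_2}\ldots q_s^{n_s},t)$, for some $t$, attaining the generalized Bierbrauer--Friedman bound, i.e. with $$|C|=q_1^{n_1}q_2^{n_2}\cdots q_s^{n_s}\Big(1-\big(1-\tfrac1q\big)\tfrac{n}{t+1}\Big),$$ where $n=n_1+\cdots+n_s$ and $\frac1q=\frac1n\sum_{i=1}^s\frac{n_i}{q_i}$; (i') $C$ is an $\mathrm{OA}(|C|,q_1^{n_1}q_2^{n_2}\ldots q_s^{n_s},t)$ with $t=\frac{\mu+k}{p^s}-1$; (ii) $C$ is a $\{k;\mu\}$-CR code in the graph $H(q_1^{n_1}q_2^{n_2}\ldots q_s^{n_s})$; (iii) the code $C^\perp$ generated by the rows of $H$ is an alphabet-effective one-weight code of weight $\mu p^{m-s}$; (iv) the multiset $M$ of subspaces of $\mathbb{F}_p^m$ in which, for each $i\in\{1,\ldots,s\}$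 and $j\in\{1,\ldots,n_i\}$, the subspace $H_{i,j}$ is included $p^{s-i}$ times, is a $\mu$-fold partition of $\mathbb{F}_p^m$; (v) the collection (multiset) $M^\perp=\{H_{i,j}^\perp: i=1,\ldots,s,\ j=1,\ldots,n_i\}$ of subspaces dual to the $H_{i,j}$ is a $\nu$-fold partition of $\mathbb{F}_p^m$, where $\nu=n_1+\cdots+n_s-p^{m-s}\mu$.
   Context: Blocks: the coordinates of $(\mathbb{F}_p^1)^{n_1}\times\cdots\times(\mathbb{F}_p^s)^{n_s}$, as well as the columns of $H$, are divided into $n_1+\cdots+n_s$ consecutive blocks: first $n_1$ blocks of size $1$, then $n_2$ blocks of size $2$, and so on. $H_{i,j}\subseteq\mathbb{F}_p^m$ is the subspace spanned by the columns of $H$ in the $j$th block of size $i$. For a subspace $U\subseteq\mathbb{F}_p^m$, $U^\perp$ is its dual (orthogonal complement with respect to the standard bilinear form). Additive code: a subset of $(\mathbb{F}_p^1)^{n_1}\times\cdots\times(\mathbb{F}_p^s)^{n_s}$ closed under coordinatewise addition, i.e. an $\mathbb{F}_p$-subspace. An additive code is one-weight of weight $w$ if every nonzero codeword has exactly $w$ nonzero blocks. It is alphabet-effective if in each block every element of the corresponding alphabet $\mathbb{F}_p^i$ occurs in some codeword. A multiset $D$ of subspaces of a vector space $S$ is a $\mu$-fold partition of $S$ if every nonzero vector of $S$ belongs to exactly $\mu$ subspaces from $D$, counted with multiplicity. (If $\mu$ is not a nonnegative integer, no such multiset exists.) The set $[p^i]=\{0,\ldots,p^i-1\}$ is identified with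 $\mathbb{F}_p^i$. Each block is regarded as one coordinate of a word, with alphabet $\mathbb F_p^i$ of size $q_i=p^i$ for a block of size $i$; the words thus have $n=n_1+\cdots+n_s$ coordinates. Orthogonal array: a nonempty multiset $C$ of words in a product $V$ of $n$ finite alphabets is an orthogonal array of strength $t$ ($t$ an integer, $0\le t\le n$) if for any $t$ distinct coordinates and any prescribed symbols in them, the number (with multiplicity) of words of $C$ having the prescribed symbols in those coordinates equals $|C|$ divided by the product of the sizes of the $t$ alphabets. It is denoted $\mathrm{OA}(|C|,q_1^{n_1}\ldots q_s^{n_s},t)$ when there are $n_i$ alphabets of size $q_i$ for each $i$. The multigraph $H(q_1^{n_1}\ldots q_s^{n_s})$ has as vertices all words of $(\mathbb{F}_p^1)^{n_1}\times\cdots\times(\mathbb{F}_p^s)^{n_s}$; two words are joined by an edge of multiplicity $p^{s-i}$ if they differ in exactly one block and that block has size $i$; all other pairs are non-adjacent. It is regular of degree $k$ (edges counted with multiplicity). $\{b;c\}$-CR code (completely regular code with covering radius $1$), where $b,c>0$: a set $C$ of vertices of a regular multigraph with vertex set $V$ such that every vertex in $C$ is connected with $V\setminus C$ by exactly $b$ edges and every vertex in $V\setminus C$ is connected with $C$ by exactly $c$ edges (with multiplicity). -}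

module Defs where

import Algebra.Properties.Monoid.Sum as MonoidSum
open import Data.Fin.Base using (Fin; zero; suc; toℕ; fromℕ; _↑ˡ_; _↑ʳ_; combine)
open import Data.Fin.Properties using (all?; any?; _≟_)
open import Data.Integer.Base using (+_)
open import Data.List.Base as List using (List; []; _∷_; length; filter; concat; concatMap; allFin; cartesianProductWith)
open import Data.List.Relation.Unary.All using (All)
open import Data.List.Relation.Unary.All.Properties using (tabulate⁺)
open import Data.Nat.Base as ℕ using (ℕ; zero; suc; _^_; _∸_; NonZero)
open import Data.Nat.DivMod using (_mod_)
import Data.Nat.ListAction as ListAction
open import Data.Nat.ListAction.Properties using (product≢0)
open import Data.Nat.Primality using (Prime; prime⇒nonZero; prime⇒nonTrivial)
import Data.Nat.Properties as ℕₚ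
open import Data.Product.Base using (Σ; ∃; _×_; _,_)
open import Data.Rational.Base as ℚ using (ℚ; 0ℚ; 1ℚ; _/_)
import Data.Rational.Properties as ℚₚ
open import Data.Vec.Base as Vec using (Vec; []; _∷_; lookup; tabulate; transpose)
open import Data.Vec.Properties using (≡-dec)
open import Function.Base using (_∘_)
open import Function.Bundles using (_⇔_)
open import Function.Definitions using (Injective)
open import Level using (0ℓ)
open import Relation.Binary.Definitions using (DecidableEquality)
open import Relation.Binary.PropositionalEquality using (_≡_; _≢_; sym)
open import Relation.Nullary.Decidable using (Dec; map′; ¬?; decidable-stable; _→-dec_)
open import Relation.Nullary.Negation using (¬_)
open import Relation.Unary using (Pred; Decidable)

open MonoidSum ℕₚ.+-0-monoid public using () renaming (sum to Σℕ)
open MonoidSum ℕₚ.*-1-monoid public using () renaming (sum to Πℕ)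
open MonoidSum ℚₚ.+-0-monoid public using () renaming (sum to Σℚ)

↑_ : ℕ → ℚ
↑ a = (+ a) / 1

record DecSet (A : Set) : Set₁ where
  field
    Mem  : Pred A 0ℓ
    mem? : Decidable Mem

open DecSet public

∁ : {A : Set} → DecSet A → DecSet A
∁ C = record { Mem = λ x → ¬ Mem C x ; mem? = λ x → ¬? (mem? C x) }

-- `vertices` is meant to list every vertex exactly once.
record Multigraph : Set₁ where
  field
    Vertex       : Set
    vertices     : List Vertex
    multiplicity : Vertex → Vertex → ℕ

  edges : Vertex → DecSet Vertex → ℕ
  edges x S = ListAction.sum (List.map (multiplicity x) (filter (mem? S) vertices))

  degree : Vertex → ℕ
  degree x = ListAction.sum (List.map (multiplicity x) vertices)

-- b and c are rational so that the notion makes sense for a parameter which is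
-- not known beforehand to be an integer.
record IsCRCode (G : Multigraph) (C : DecSet (Multigraph.Vertex G)) (b c : ℚ) : Set where
  open Multigraph G
  field
    regular : ∃ λ d → ∀ x → degree x ≡ d
    b>0     : 0ℚ ℚ.< b
    c>0     : 0ℚ ℚ.< c
    inside  : ∀ x → Mem C x → ↑ edges x (∁ C) ≡ b
    outside : ∀ x → ¬ Mem C x → ↑ edges x C ≡ c

module LinearAlgebra (p : ℕ) (p-prime : Prime p) where

  private instance
    p≢0 : NonZero p
    p≢0 = prime⇒nonZero p-prime

  -- The field ℤ/pℤ, by its representatives 0, …, p-1.
  F : Set
  F = Fin p

  0F : F
  0F = 0 mod p

  infixl 6 _+F_ _+V_
  infixl 7 _*F_ _*V_

  _+F_ _*F_ : F → F → F
  a +F b = (toℕ a ℕ.+ toℕ b) mod p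
  a *F b = (toℕ a ℕ.* toℕ b) mod p

  V : ℕ → Set
  V d = Vec F d

  _≟V_ : ∀ {d} → DecidableEquality (V d)
  _≟V_ = ≡-dec _≟_

  0V : ∀ {d} → V d
  0V = Vec.replicate _ 0F

  _+V_ : ∀ {d} → V d → V d → V d
  _+V_ = Vec.zipWith _+F_

  _*V_ : ∀ {d} → F → V d → V d
  a *V x = Vec.map (a *F_) x

  dot : ∀ {d} → V d → V d → F
  dot x y = Vec.foldr′ _+F_ 0F (Vec.zipWith _*F_ x y)

  allV : ∀ d → List (V d)
  allV zero    = [] ∷ []
  allV (suc d) = cartesianProductWith _∷_ (allFin p) (allV d)

  ∃V? : ∀ {d} {P : Pred (V d) 0ℓ} → Decidable P → Dec (∃ P)
  ∃V? {zero}  P? = map′ ([] ,_) (λ { ([] , q) → q }) (P? [])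
  ∃V? {suc d} P? = map′ (λ (a , x , q) → a ∷ x , q) (λ { (a ∷ x , q) → a , x , q })
                        (any? λ a → ∃V? λ x → P? (a ∷ x))

  ∀V? : ∀ {d} {P : Pred (V d) 0ℓ} → Decidable P → Dec (∀ x → P x)
  ∀V? P? = map′ (λ f x → decidable-stable (P? x) λ ¬q → f (x , ¬q)) (λ f (x , ¬q) → ¬q (f x))
                (¬? (∃V? λ x → ¬? (P? x)))

  record IsSubspace {d} (U : Pred (V d) 0ℓ) : Set where
    field
      0-mem    : U 0V
      +-closed : ∀ {x y} → U x → U y → U (x +V y)
      *-closed : ∀ a {x} → U x → U (a *V x)

  combination : ∀ {e d} → V e → Vec (V d) e → V d
  combination a vs = Vec.foldr′ _+V_ 0V (Vec.zipWith _*V_ a vs)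

  Span : ∀ {e d} → Vec (V d) e → Pred (V d) 0ℓ
  Span vs x = ∃ λ a → combination a vs ≡ x

  span : ∀ {e d} → Vec (V d) e → DecSet (V d)
  span vs = record { Mem = Span vs ; mem? = λ x → ∃V? λ a → combination a vs ≟V x }

  infix 9 _^⊥

  _^⊥ : ∀ {d} → DecSet (V d) → DecSet (V d)
  U ^⊥ = record
    { Mem  = λ y → ∀ x → Mem U x → dot x y ≡ 0F
    ; mem? = λ y → ∀V? λ x → mem? U x →-dec dot x y ≟ 0F
    }

  LinearlyIndependent : ∀ {e d} → Vec (V d) e → Set
  LinearlyIndependent vs = ∀ a → combination a vs ≡ 0V → a ≡ 0V

  HasDimension : ∀ {d} → Pred (V d) 0ℓ → ℕ → Set
  HasDimension {d} U e = Σ (Vec (V d) e) λ vs → LinearlyIndependent vs × (∀ x → U x ⇔ Span vs x)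

  -- The vector of rows.
  Matrix : ℕ → ℕ → Set
  Matrix m N = Vec (V N) m

  HasRank : ∀ {m N} → Matrix m N → ℕ → Set
  HasRank H = HasDimension (Span (transpose H))

  nullSpace : ∀ {m N} → Matrix m N → DecSet (V N)
  nullSpace H = record { Mem = λ x → H · x ≡ 0V ; mem? = λ x → (H · x) ≟V 0V }
    where
    _·_ : ∀ {m N} → Matrix m N → V N → V m
    H · x = Vec.map (λ row → dot row x) H

  count : ∀ {d} → V d → List (DecSet (V d)) → ℕ
  count v D = length (filter (λ U → mem? U v) D)

  -- Multisets are lists.
  record IsFoldPartition {d} (μ : ℚ) (D : List (DecSet (V d))) : Set₁ where
    field
      subspaces : All (IsSubspace ∘ Mem) D
      exactly   : ∀ v → v ≢ 0V → ↑ count v D ≡ μ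

-- The position in 0, …, Σ f - 1 of the l-th element of the i-th of consecutive
-- intervals of lengths f 0, f 1, ….
position : ∀ {s} (f : Fin s → ℕ) (i : Fin s) → Fin (f i) → Fin (Σℕ f)
position f zero    l = l ↑ˡ Σℕ (f ∘ suc)
position f (suc i) l = f zero ↑ʳ position (f ∘ suc) i l

-- Here s = r + 1 and the index i : Fin s stands for the block size toℕ i + 1, so
-- that n_{j} is n applied to the element j - 1 of Fin s, and n_s is n (fromℕ r).
module Blocks (p : ℕ) (p-prime : Prime p) (r : ℕ) (n : Fin (suc r) → ℕ) where

  open LinearAlgebra p p-prime public

  private instance
    p≢0 : NonZero p
    p≢0 = prime⇒nonZero p-prime

  s : ℕ
  s = suc r

  sizeOf : Fin s → ℕ
  sizeOf i = suc (toℕ i)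

  q : Fin s → ℕ
  q i = p ^ sizeOf i

  -- The number n₁ + 2n₂ + ⋯ + sn_s of coordinates over F.
  N : ℕ
  N = Σℕ λ i → n i ℕ.* sizeOf i

  -- n₁ + ⋯ + n_s
  #blocks : ℕ
  #blocks = Σℕ n

  Word : Set
  Word = V N

  Block : Set
  Block = Σ (Fin s) λ i → Fin (n i)

  size : Block → ℕ
  size (i , _) = sizeOf i

  blocks : List Block
  blocks = concat (List.tabulate λ i → List.map (i ,_) (allFin (n i)))

  coordinate : (β : Block) → Fin (size β) → Fin N
  coordinate (i , j) l = position (λ i′ → n i′ ℕ.* sizeOf i′) i (combine j l)

  block : Word → (β : Block) → V (size β)
  block x β = tabulate λ l → lookup x (coordinate β l)

  differences : Word → Word → List Block
  differences x y = filter (λ β → ¬? (block x β ≟V block y β)) blocks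

  weight : Word → ℕ
  weight x = length (differences x 0V)

  record IsOneWeight (C : Pred Word 0ℓ) (w : ℚ) : Set where
    field
      additive : IsSubspace C
      weights  : ∀ x → C x → x ≢ 0V → ↑ weight x ≡ w

  AlphabetEffective : Pred Word 0ℓ → Set
  AlphabetEffective C = ∀ β (a : V (size β)) → ∃ λ x → C x × block x β ≡ a

  alphabetProduct : ∀ {t} → (Fin t → Block) → ℕ
  alphabetProduct T = ListAction.product (List.tabulate λ j → p ^ size (T j))

  alphabetProduct≢0 : ∀ {t} (T : Fin t → Block) → NonZero (alphabetProduct T)
  alphabetProduct≢0 T = product≢0 (tabulate⁺ λ j → ℕₚ.m^n≢0 p (size (T j)))

  -- Multisets are lists.
  record IsOrthogonalArray (C : List Word) (t : ℕ) : Set where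
    field
      nonempty : C ≢ []
      t≤n      : t ℕ.≤ #blocks
      uniform  : (T : Fin t → Block) → Injective _≡_ _≡_ T → (a : ∀ j → V (size (T j))) →
                 ↑ length (filter (λ x → all? λ j → block x (T j) ≟V a j) C)
                   ≡ _/_ (+ length C) (alphabetProduct T) {{alphabetProduct≢0 T}}

  edgeMultiplicity : List Block → ℕ
  edgeMultiplicity (β ∷ []) = p ^ (s ∸ size β)
  edgeMultiplicity _        = 0

  graph : Multigraph
  graph = record
    { Vertex       = Word
    ; vertices     = allV N
    ; multiplicity = λ x y → edgeMultiplicity (differences x y)
    }

  elements : DecSet Word → List Word
  elements C = filter (mem? C) (allV N)

  k : ℕ
  k = Σℕ λ i → n i ℕ.* (p ^ s ∸ p ^ (s ∸ sizeOf i))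

  -- (n₁/q₁ + ⋯ + n_s/q_s)/n
  1/q : .{{NonZero (n (fromℕ r))}} → ℚ
  1/q = (_/_ (+ 1) #blocks {{Σℕ≢0 r n}}) ℚ.* (Σℚ λ i → _/_ (+ n i) (q i) {{ℕₚ.m^n≢0 p (sizeOf i)}})
    where
    Σℕ≢0 : ∀ r (f : Fin (suc r) → ℕ) → .{{NonZero (f (fromℕ r))}} → NonZero (Σℕ f)
    Σℕ≢0 zero    f = ℕ.>-nonZero (ℕₚ.m≤n⇒m≤n+o 0 (ℕ.>-nonZero⁻¹ (f zero)))
    Σℕ≢0 (suc r) f = ℕ.>-nonZero (ℕₚ.m≤n⇒m≤o+n (f zero) (ℕ.>-nonZero⁻¹ _ {{Σℕ≢0 r (f ∘ suc)}}))

  -- The right-hand side of the generalized Bierbrauer–Friedman bound for strength t.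
  bierbrauerFriedman : .{{NonZero (n (fromℕ r))}} → ℕ → ℚ
  bierbrauerFriedman t =
    ↑ Πℕ (λ i → q i ^ n i) ℚ.* (1ℚ ℚ.- (1ℚ ℚ.- 1/q) ℚ.* ((+ #blocks) / suc t))

  module Parameters (m : ℕ) .{{_ : NonZero m}} where

    p^m∸1≢0 : NonZero (p ^ m ∸ 1)
    p^m∸1≢0 = ℕ.≢-nonZero (ℕₚ.m>n⇒m∸n≢0 1<p^m)
      where
      1<p^m : 1 ℕ.< p ^ m
      1<p^m = ℕₚ.<-≤-trans (ℕ.nonTrivial⇒n>1 p {{prime⇒nonTrivial p-prime}})
                (ℕₚ.≤-trans (ℕₚ.≤-reflexive (sym (ℕₚ.^-identityʳ p)))
                            (ℕₚ.^-monoʳ-≤ p (ℕ.>-nonZero⁻¹ m)))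

    μ : ℚ
    μ = _/_ (+ k) (p ^ m ∸ 1) {{p^m∸1≢0}}

    -- p^{m-s}; the exponent may be negative.
    p^[m-s] : ℚ
    p^[m-s] = _/_ (+ (p ^ m)) (p ^ s) {{ℕₚ.m^n≢0 p s}}

    -- (μ + k)/p^s - 1
    τ : ℚ
    τ = (μ ℚ.+ ↑ k) ℚ.* (_/_ (+ 1) (p ^ s) {{ℕₚ.m^n≢0 p s}}) ℚ.- 1ℚ

    ν : ℚ
    ν = ↑ #blocks ℚ.- p^[m-s] ℚ.* μ

    -- H_{i,j}
    blockSpace : Matrix m N → Block → DecSet (V m)
    blockSpace H β = span (tabulate λ l → lookup (transpose H) (coordinate β l))

    multisetM : Matrix m N → List (DecSet (V m))
    multisetM H = concatMap (λ β → List.replicate (p ^ (s ∸ size β)) (blockSpace H β)) blocks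

    multisetM⊥ : Matrix m N → List (DecSet (V m))
    multisetM⊥ H = List.map (λ β → blockSpace H β ^⊥) blocks

{-# OPTIONS --safe #-}
module Submission where

-- Everything is counted over 𝔽ₚ without characters.  Let wt y be the weight of yᵀH and let φ(v) be the number of
-- pairs (block β, coefficient vector a) with H_β a = v, the block β being weighted by p^(s - size β).  Counting the
-- pairs (x, c) with c · L x = c · b in both orders relates the fibre of a linear map L over b to the kernel of its
-- adjoint; applied to the maps a ↦ H_β a it says that φ and y ↦ #blocks - wt y are discrete Radon transforms of each
-- other.  So "wt is constant off 0" (which is (iii) and (v)) and "φ is constant off 0" are equivalent.  As φ(0) is
-- at least Σ p^(s - size β), with equality iff all H_β have full rank, the latter condition forces full rank, and it
-- is then (iv), and (ii) through syndromes.  For (i′), C has strength t iff all nonzero words of C⊥ have weight > t,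
-- and the average weight of C⊥ is at most μ p^(m-s), so minimum weight t + 1 = μ p^(m-s) means constant weight.

open import Defs
import Algebra.Properties.AbelianGroup as AbelianGroupₚ
import Algebra.Properties.Monoid.Sum as MonoidSum
import Algebra.Properties.Ring as Ringₚ
import Data.Fin.Properties as Finₚ
import Data.Integer.Base as ℤ
import Data.Integer.Properties as ℤₚ
import Data.Integer.Tactic.RingSolver as ℤSolver
import Data.List.Properties as Listₚ
import Data.List.Relation.Unary.All as All
import Data.List.Relation.Unary.All.Properties as Allₚ
import Data.Nat.ListAction as ListAction
import Data.Nat.ListAction.Properties as ListActionₚ
import Data.Product.Properties as Productₚ
import Data.Rational.Properties as ℚₚ
import Data.Rational.Unnormalised.Base as ℚᵘ
import Data.Rational.Unnormalised.Properties as ℚᵘₚ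
import Data.Vec.Properties as Vecₚ
import Function.Properties.Equivalence as ⇔
open import Algebra.Bundles using (CommutativeRing; AbelianGroup)
open import Algebra.Structures using (IsAbelianGroup)
open import Data.Bool.Base using (true; false; if_then_else_)
open import Data.Fin.Base using (Fin; zero; suc; toℕ; splitAt; combine; fromℕ; fromℕ<; inject≤)
open import Data.List.Base as List using (List; []; _∷_; _++_; length; filter; allFin; cartesianProductWith; concatMap)
open import Data.List.Membership.Propositional using (_∈_)
open import Data.List.Membership.Propositional.Properties using (∈-filter⁺; ∈-filter⁻)
open import Data.List.Relation.Unary.Any using (here; there)
open import Data.Nat.Base as ℕ using (ℕ; zero; suc; _+_; _*_; _∸_; _^_; _≤_; _<_; z≤n; s≤s; NonZero)
open import Data.Nat.DivMod using (_mod_; _%_; %-distribˡ-+; %-distribˡ-*; m<n⇒m%n≡m; n%n≡0; m%n<n)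
open import Data.Nat.Divisibility using (m%n≡0⇒n∣m; n∣m⇒m%n≡0)
open import Data.Nat.Primality using (Prime; prime⇒nonZero; prime⇒nonTrivial; euclidsLemma)
open import Data.Nat.Properties as ℕₚ
open import Data.Nat.Tactic.RingSolver using (solve-∀)
open import Algebra.Properties.CommutativeSemigroup *-commutativeSemigroup using (x∙yz≈y∙xz)
open import Data.Product.Base using (∃; _×_; _,_; proj₁; proj₂)
open import Data.Product.Properties.WithK using (,-injectiveʳ)
open import Data.Rational.Base as ℚ using (ℚ; 1ℚ; _/_; toℚᵘ)
open import Data.Rational.Solver using (module +-*-Solver)
open import Data.Sum.Base using (_⊎_; inj₁; inj₂)
open import Data.Vec.Base as Vec using (Vec; []; _∷_; lookup; tabulate; transpose; _⊛_)
open import Function.Base using (_∘_; _$_)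
open import Function.Bundles using (_⇔_; mk⇔; Equivalence)
open import Function.Definitions using (Injective)
open import Level using (0ℓ)
open import Relation.Binary.Definitions using (DecidableEquality)
open import Relation.Binary.PropositionalEquality using (_≡_; _≢_; refl; sym; trans; cong; cong₂; subst; isEquivalence; module ≡-Reasoning)
open import Relation.Nullary.Decidable using (Dec; yes; no; does; ¬?; _×-dec_; decidable-stable)
open import Relation.Nullary.Negation using (¬_; contradiction)
open import Relation.Unary using (Pred; Decidable)

-- The weights p^(s - size β) give every block the same mass p^s over its coefficient vectors, so
-- the total mass of φ is #blocks p^s = k + σ, where σ = Σ p^(s - size β). If all blocks have full
-- rank, σ of this mass sits at 0 and the remaining k is to be shared by p^m - 1 nonzero vectors:
-- this is the origin of μ. The constant μ p^(m-s) is what the transform makes of a covering by μ.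
-- The obstacle is that the columns inside one block may be dependent. Then H_β has fewer than
-- p^(size β) vectors, and counting coefficient vectors, which the transform needs, differs from
-- counting vectors, of which (iv) speaks. As the total mass is fixed, a dependence raises φ(0)
-- above σ at the expense of the nonzero vectors; comparing sums therefore leaves room only for
-- equality, and the same one-sided estimate bounds the average weight. Identities stay in ℕ by
-- moving each subtracted term to the other side, and ν, τ and the bound are all compared through
-- one equation, w (p^m - 1) p^s = k p^m.

private module ℕSum = MonoidSum +-0-monoid

-- Iverson brackets, finite sums over lists, and enumerations.

⟦_⟧ : ∀ {P : Set} → Dec P → ℕ
⟦ P? ⟧ = if does P? then 1 else 0

module _ {P : Set} where

  ⟦⟧-yes : (P? : Dec P) → P → ⟦ P? ⟧ ≡ 1
  ⟦⟧-yes (yes _) _ = refl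
  ⟦⟧-yes (no ¬p) p = contradiction p ¬p

  ⟦⟧-no : (P? : Dec P) → ¬ P → ⟦ P? ⟧ ≡ 0
  ⟦⟧-no (yes p) ¬p = contradiction p ¬p
  ⟦⟧-no (no _)  _  = refl

  ⟦⟧≤1 : (P? : Dec P) → ⟦ P? ⟧ ≤ 1
  ⟦⟧≤1 (yes _) = ≤-refl
  ⟦⟧≤1 (no _)  = z≤n

  ⟦⟧-¬ : (P? : Dec P) → ⟦ ¬? P? ⟧ + ⟦ P? ⟧ ≡ 1
  ⟦⟧-¬ (yes _) = refl
  ⟦⟧-¬ (no _)  = refl

  ⟦⟧-≤ : ∀ {c} (P? : Dec P) → (P → 1 ≤ c) → ⟦ P? ⟧ ≤ c
  ⟦⟧-≤ (yes p) 1≤c = 1≤c p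
  ⟦⟧-≤ (no _)  _   = z≤n

  ⟦⟧-≡ : ∀ {c} (P? : Dec P) → (P → c ≡ 1) → (¬ P → c ≡ 0) → ⟦ P? ⟧ ≡ c
  ⟦⟧-≡ (yes p) c≡1 _   = sym (c≡1 p)
  ⟦⟧-≡ (no ¬p) _   c≡0 = sym (c≡0 ¬p)

  ⟦⟧-elim : (P? : Dec P) → ⟦ P? ⟧ ≢ 0 → P
  ⟦⟧-elim (yes p) _  = p
  ⟦⟧-elim (no _)  ≢0 = contradiction refl ≢0

module _ {P Q : Set} where

  ⟦⟧-cong : (P? : Dec P) (Q? : Dec Q) → (P → Q) → (Q → P) → ⟦ P? ⟧ ≡ ⟦ Q? ⟧
  ⟦⟧-cong (yes p) Q? f g = sym (⟦⟧-yes Q? (f p))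
  ⟦⟧-cong (no ¬p) Q? f g = sym (⟦⟧-no Q? (¬p ∘ g))

  ⟦⟧-× : (P? : Dec P) (Q? : Dec Q) → ⟦ P? ×-dec Q? ⟧ ≡ ⟦ P? ⟧ * ⟦ Q? ⟧
  ⟦⟧-× (yes _) (yes _) = refl
  ⟦⟧-× (yes _) (no _)  = refl
  ⟦⟧-× (no _)  _       = refl

∑ : ∀ {a} {A : Set a} → List A → (A → ℕ) → ℕ
∑ xs f = ListAction.sum (List.map f xs)

module _ {a} {A : Set a} where

  ∑-cong : ∀ (xs : List A) {f g : A → ℕ} → (∀ x → f x ≡ g x) → ∑ xs f ≡ ∑ xs g
  ∑-cong xs f≗g = cong ListAction.sum (Listₚ.map-cong f≗g xs)

  ∑-+ : ∀ (xs : List A) (f g : A → ℕ) → ∑ xs (λ x → f x + g x) ≡ ∑ xs f + ∑ xs g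
  ∑-+ []       f g = refl
  ∑-+ (x ∷ xs) f g = trans (cong (f x + g x +_) (∑-+ xs f g)) (interchange (f x) (g x) (∑ xs f) (∑ xs g))
    where
    interchange : ∀ a b c d → a + b + (c + d) ≡ a + c + (b + d)
    interchange = solve-∀

  ∑-*ˡ : ∀ (xs : List A) c (f : A → ℕ) → ∑ xs (λ x → c * f x) ≡ c * ∑ xs f
  ∑-*ˡ []       c f = sym (*-zeroʳ c)
  ∑-*ˡ (x ∷ xs) c f = trans (cong (c * f x +_) (∑-*ˡ xs c f)) (sym (*-distribˡ-+ c (f x) _))

  ∑-*ʳ : ∀ (xs : List A) (f : A → ℕ) c → ∑ xs (λ x → f x * c) ≡ ∑ xs f * c
  ∑-*ʳ xs f c = trans (∑-cong xs λ x → *-comm (f x) c) (trans (∑-*ˡ xs c f) (*-comm c _))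

  ∑-const : ∀ (xs : List A) c → ∑ xs (λ _ → c) ≡ length xs * c
  ∑-const []       c = refl
  ∑-const (x ∷ xs) c = cong (c +_) (∑-const xs c)

  ∑-zero : ∀ (xs : List A) → ∑ xs (λ _ → 0) ≡ 0
  ∑-zero xs = trans (∑-const xs 0) (*-zeroʳ (length xs))

  ∑-mono-≤ : ∀ (xs : List A) {f g : A → ℕ} → (∀ x → f x ≤ g x) → ∑ xs f ≤ ∑ xs g
  ∑-mono-≤ []       f≤g = z≤n
  ∑-mono-≤ (x ∷ xs) f≤g = +-mono-≤ (f≤g x) (∑-mono-≤ xs f≤g)

  ∑-++ : ∀ (xs ys : List A) (f : A → ℕ) → ∑ (xs ++ ys) f ≡ ∑ xs f + ∑ ys f
  ∑-++ xs ys f = trans (cong ListAction.sum (Listₚ.map-++ f xs ys)) (ListActionₚ.sum-++ (List.map f xs) (List.map f ys))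

  ∑-filter : ∀ {P : Pred A 0ℓ} (P? : Decidable P) xs (f : A → ℕ) →
             ∑ (filter P? xs) f ≡ ∑ xs (λ x → ⟦ P? x ⟧ * f x)
  ∑-filter P? []       f = refl
  ∑-filter P? (x ∷ xs) f with does (P? x)
  ... | true  = cong₂ _+_ (sym (*-identityˡ (f x))) (∑-filter P? xs f)
  ... | false = ∑-filter P? xs f

  length-filter-∑ : ∀ {P : Pred A 0ℓ} (P? : Decidable P) xs → length (filter P? xs) ≡ ∑ xs (λ x → ⟦ P? x ⟧)
  length-filter-∑ P? []       = refl
  length-filter-∑ P? (x ∷ xs) with does (P? x)
  ... | true  = cong suc (length-filter-∑ P? xs)
  ... | false = length-filter-∑ P? xs

  ∑-member : ∀ {xs : List A} {x} (f : A → ℕ) → x ∈ xs → f x ≤ ∑ xs f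
  ∑-member f (here refl)               = m≤m+n (f _) _
  ∑-member {y ∷ _} f (there x∈xs) = m≤n⇒m≤o+n (f y) (∑-member f x∈xs)

  -- A strict inequality at one member could not be compensated at the others. This is the tool that
  -- turns every comparison of totals below into a pointwise equality.
  ∑-tight : ∀ {xs : List A} {f g : A → ℕ} → (∀ x → f x ≤ g x) → ∑ xs g ≤ ∑ xs f → ∀ {x} → x ∈ xs → f x ≡ g x
  ∑-tight {y ∷ xs} {f} {g} f≤g ∑g≤∑f (here refl)  = ≤-antisym (f≤g _)
    (+-cancelʳ-≤ (∑ xs f) (g y) (f y) (≤-trans (+-monoʳ-≤ (g y) (∑-mono-≤ xs f≤g)) ∑g≤∑f))
  ∑-tight {y ∷ xs} {f} {g} f≤g ∑g≤∑f (there x∈xs) = ∑-tight f≤g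
    (+-cancelˡ-≤ (f y) (∑ xs g) (∑ xs f) (≤-trans (+-monoˡ-≤ (∑ xs g) (f≤g y)) ∑g≤∑f)) x∈xs

  ∑-nonzero-member : ∀ (xs : List A) (f : A → ℕ) → ∑ xs f ≢ 0 → ∃ λ x → x ∈ xs × f x ≢ 0
  ∑-nonzero-member []       f ≢0 = contradiction refl ≢0
  ∑-nonzero-member (x ∷ xs) f ≢0 with f x ≟ 0
  ... | no fx≢0 = x , here refl , fx≢0
  ... | yes fx≡0 with ∑-nonzero-member xs f (λ ∑≡0 → ≢0 (cong₂ _+_ fx≡0 ∑≡0))
  ...   | y , y∈xs , fy≢0 = y , there y∈xs , fy≢0

module _ {a b} {A : Set a} {B : Set b} where

  ∑-swap : ∀ (xs : List A) (ys : List B) (f : A → B → ℕ) →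
           ∑ xs (λ x → ∑ ys (f x)) ≡ ∑ ys (λ y → ∑ xs (λ x → f x y))
  ∑-swap []       ys f = sym (∑-zero ys)
  ∑-swap (x ∷ xs) ys f = trans (cong (∑ ys (f x) +_) (∑-swap xs ys f)) (sym (∑-+ ys (f x) _))

  ∑-map : ∀ (g : A → B) xs (f : B → ℕ) → ∑ (List.map g xs) f ≡ ∑ xs (f ∘ g)
  ∑-map g xs f = cong ListAction.sum (sym (Listₚ.map-∘ xs))

  ∑-concatMap : ∀ (g : A → List B) xs (f : B → ℕ) → ∑ (concatMap g xs) f ≡ ∑ xs (λ x → ∑ (g x) f)
  ∑-concatMap g []       f = refl
  ∑-concatMap g (x ∷ xs) f = trans (∑-++ (g x) _ f) (cong (∑ (g x) f +_) (∑-concatMap g xs f))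

∑-cartesianProductWith : ∀ {A B C : Set} (g : A → B → C) xs ys (f : C → ℕ) →
                         ∑ (cartesianProductWith g xs ys) f ≡ ∑ xs (λ x → ∑ ys (λ y → f (g x y)))
∑-cartesianProductWith g []       ys f = refl
∑-cartesianProductWith g (x ∷ xs) ys f =
  trans (∑-++ (List.map (g x) ys) _ f) (cong₂ _+_ (∑-map (g x) ys f) (∑-cartesianProductWith g xs ys f))

∑-tabulate : ∀ {A : Set} {n} (g : Fin n → A) (f : A → ℕ) → ∑ (List.tabulate g) f ≡ Σℕ (f ∘ g)
∑-tabulate {n = zero}  g f = refl
∑-tabulate {n = suc n} g f = cong (f (g zero) +_) (∑-tabulate (g ∘ suc) f)

-- Listing each element exactly once is encoded as a counting equation, so that it can be used
-- directly inside sums as a Kronecker delta, with no reasoning about permutations of lists.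
record Enumerates {A : Set} (xs : List A) (_≟_ : DecidableEquality A) : Set where
  field
    once : ∀ a → ∑ xs (λ x → ⟦ x ≟ a ⟧) ≡ 1

  ∑-delta : ∀ a (f : A → ℕ) → ∑ xs (λ x → ⟦ x ≟ a ⟧ * f x) ≡ f a
  ∑-delta a f = begin
    ∑ xs (λ x → ⟦ x ≟ a ⟧ * f x)  ≡⟨ ∑-cong xs at-a ⟩
    ∑ xs (λ x → ⟦ x ≟ a ⟧ * f a)  ≡⟨ ∑-*ʳ xs _ (f a) ⟩
    ∑ xs (λ x → ⟦ x ≟ a ⟧) * f a  ≡⟨ cong (_* f a) (once a) ⟩
    1 * f a                       ≡⟨ *-identityˡ (f a) ⟩
    f a                           ∎
    where
    open ≡-Reasoning
    at-a : ∀ x → ⟦ x ≟ a ⟧ * f x ≡ ⟦ x ≟ a ⟧ * f a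
    at-a x with x ≟ a
    ... | yes refl = refl
    ... | no _     = refl

  member : ∀ a → a ∈ xs
  member a with ∑-nonzero-member xs (λ x → ⟦ x ≟ a ⟧) (λ ≡0 → contradiction (trans (sym (once a)) ≡0) λ ())
  ... | x , x∈xs , ≢0 = subst (_∈ xs) (⟦⟧-elim (x ≟ a) ≢0) x∈xs

  ∑-unique : ∀ {P : Pred A 0ℓ} (P? : Decidable P) a → P a → (∀ x → P x → x ≡ a) → ∑ xs (λ x → ⟦ P? x ⟧) ≡ 1
  ∑-unique P? a Pa only = trans (∑-cong xs λ x → ⟦⟧-cong (P? x) (x ≟ a) (only x) λ { refl → Pa }) (once a)

  ∑-none : ∀ {P : Pred A 0ℓ} (P? : Decidable P) → (∀ x → ¬ P x) → ∑ xs (λ x → ⟦ P? x ⟧) ≡ 0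
  ∑-none P? none = trans (∑-cong xs λ x → ⟦⟧-no (P? x) (none x)) (∑-zero xs)

  ∑≡1⇒unique : ∀ {P : Pred A 0ℓ} (P? : Decidable P) → ∑ xs (λ x → ⟦ P? x ⟧) ≤ 1 → ∀ {a b} → P a → P b → a ≡ b
  ∑≡1⇒unique P? ∑≤1 {a} {b} Pa Pb with a ≟ b
  ... | yes a≡b = a≡b
  ... | no a≢b  = contradiction (≤-trans 2≤∑ ∑≤1) λ { (s≤s ()) }
    where
    both : ∀ x → ⟦ x ≟ a ⟧ + ⟦ x ≟ b ⟧ ≤ ⟦ P? x ⟧
    both x with x ≟ a | x ≟ b
    ... | yes refl | yes refl = contradiction refl a≢b
    ... | yes refl | no _     = ≤-reflexive (sym (⟦⟧-yes (P? x) Pa))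
    ... | no _     | yes refl = ≤-reflexive (sym (⟦⟧-yes (P? x) Pb))
    ... | no _     | no _     = z≤n
    2≤∑ : 2 ≤ ∑ xs (λ x → ⟦ P? x ⟧)
    2≤∑ = ≤-trans (≤-reflexive (sym (trans (∑-+ xs _ _) (cong₂ _+_ (once a) (once b))))) (∑-mono-≤ xs both)

Σℕ-delta : ∀ {n} (i : Fin n) → Σℕ (λ j → ⟦ j Finₚ.≟ i ⟧) ≡ 1
Σℕ-delta {suc n} zero    = cong suc (ℕSum.sum-replicate-zero n)
Σℕ-delta {suc n} (suc i) = Σℕ-delta i

allFin-enumerates : ∀ n → Enumerates (allFin n) Finₚ._≟_
allFin-enumerates n .Enumerates.once i = trans (∑-tabulate {n = n} (λ j → j) (λ j → ⟦ j Finₚ.≟ i ⟧)) (Σℕ-delta i)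

-- Pigeonhole by tightness: no value is hit twice, while the numbers of hits add up to the number of
-- elements, so no value can be missed.
injective-count : ∀ {A : Set} {xs : List A} {_≟_ : DecidableEquality A} → Enumerates xs _≟_ →
                  (g : A → A) → Injective _≡_ _≡_ g → ∀ c → ∑ xs (λ x → ⟦ g x ≟ c ⟧) ≡ 1
injective-count {xs = xs} {_≟_} enum g g-inj c = ∑-tight {xs = xs} {f = hits} {g = λ _ → 1} hits≤1 (≤-reflexive total)
    (member c)
  where
  open Enumerates enum
  hits : _ → ℕ
  hits c = ∑ xs (λ x → ⟦ g x ≟ c ⟧)
  hits≤1 : ∀ c → hits c ≤ 1
  hits≤1 c with hits c ℕₚ.≟ 0
  ... | yes ≡0 = ≤-trans (≤-reflexive ≡0) z≤n
  ... | no ≢0 with ∑-nonzero-member xs (λ x → ⟦ g x ≟ c ⟧) ≢0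
  ...   | a , _ , ga≢0 = ≤-reflexive (∑-unique (λ x → g x ≟ c) a ga≡c λ x gx≡c → g-inj (trans gx≡c (sym ga≡c)))
    where
    ga≡c : g a ≡ c
    ga≡c = ⟦⟧-elim (g a ≟ c) ga≢0
  total : ∑ xs (λ _ → 1) ≡ ∑ xs hits
  total = trans (∑-cong xs λ x → sym (trans (∑-cong xs λ c → ⟦⟧-cong (g x ≟ c) (c ≟ g x) sym sym) (once (g x))))
                (∑-swap xs xs λ x c → ⟦ g x ≟ c ⟧)

-- Arithmetic of the prime field on the representatives 0, ..., p - 1.

module FiniteField (p : ℕ) (p-prime : Prime p) where

  open LinearAlgebra p p-prime

  private instance
    p≢0 : NonZero p
    p≢0 = prime⇒nonZero p-prime

  infix 8 -F_

  [_] : ℕ → F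
  [ a ] = a mod p

  1F : F
  1F = [ 1 ]

  -F_ : F → F
  -F a = [ p ∸ toℕ a ]

  toℕ-[] : ∀ a → toℕ [ a ] ≡ a % p
  toℕ-[] a = Finₚ.toℕ-fromℕ< (m%n<n a p)

  []-cong-% : ∀ {a b} → a % p ≡ b % p → [ a ] ≡ [ b ]
  []-cong-% {a} {b} eq = Finₚ.toℕ-injective (trans (toℕ-[] a) (trans eq (sym (toℕ-[] b))))

  [toℕ] : ∀ a → [ toℕ a ] ≡ a
  [toℕ] a = Finₚ.toℕ-injective (trans (toℕ-[] (toℕ a)) (m<n⇒m%n≡m (Finₚ.toℕ<n a)))

  []-+ : ∀ a b → [ a ] +F [ b ] ≡ [ a + b ]
  []-+ a b = []-cong-% (trans (cong₂ (λ x y → (x + y) % p) (toℕ-[] a) (toℕ-[] b)) (sym (%-distribˡ-+ a b p)))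

  []-* : ∀ a b → [ a ] *F [ b ] ≡ [ a * b ]
  []-* a b = []-cong-% (trans (cong₂ (λ x y → (x * y) % p) (toℕ-[] a) (toℕ-[] b)) (sym (%-distribˡ-* a b p)))

  []-+ˡ : ∀ x c → [ x ] +F c ≡ [ x + toℕ c ]
  []-+ˡ x c = trans (cong ([ x ] +F_) (sym ([toℕ] c))) ([]-+ x (toℕ c))

  []-+ʳ : ∀ a x → a +F [ x ] ≡ [ toℕ a + x ]
  []-+ʳ a x = trans (cong (_+F [ x ]) (sym ([toℕ] a))) ([]-+ (toℕ a) x)

  []-*ˡ : ∀ x c → [ x ] *F c ≡ [ x * toℕ c ]
  []-*ˡ x c = trans (cong ([ x ] *F_) (sym ([toℕ] c))) ([]-* x (toℕ c))

  []-*ʳ : ∀ a x → a *F [ x ] ≡ [ toℕ a * x ]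
  []-*ʳ a x = trans (cong (_*F [ x ]) (sym ([toℕ] a))) ([]-* (toℕ a) x)

  [p]≡0 : [ p ] ≡ 0F
  [p]≡0 = []-cong-% (trans (n%n≡0 p) (sym (m<n⇒m%n≡m (ℕ.>-nonZero⁻¹ p))))

  +F-comm : ∀ a b → a +F b ≡ b +F a
  +F-comm a b = cong [_] (+-comm (toℕ a) (toℕ b))

  *F-comm : ∀ a b → a *F b ≡ b *F a
  *F-comm a b = cong [_] (*-comm (toℕ a) (toℕ b))

  +F-assoc : ∀ a b c → (a +F b) +F c ≡ a +F (b +F c)
  +F-assoc a b c = trans ([]-+ˡ _ c) (trans (cong [_] (+-assoc (toℕ a) _ _)) (sym ([]-+ʳ a _)))

  *F-assoc : ∀ a b c → (a *F b) *F c ≡ a *F (b *F c)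
  *F-assoc a b c = trans ([]-*ˡ _ c) (trans (cong [_] (*-assoc (toℕ a) _ _)) (sym ([]-*ʳ a _)))

  +F-identityˡ : ∀ a → 0F +F a ≡ a
  +F-identityˡ a = trans ([]-+ˡ 0 a) ([toℕ] a)

  *F-identityˡ : ∀ a → 1F *F a ≡ a
  *F-identityˡ a = trans ([]-*ˡ 1 a) (trans (cong [_] (*-identityˡ (toℕ a))) ([toℕ] a))

  *F-zeroˡ : ∀ a → 0F *F a ≡ 0F
  *F-zeroˡ a = []-*ˡ 0 a

  -F-inverseʳ : ∀ a → a +F (-F a) ≡ 0F
  -F-inverseʳ a = trans ([]-+ʳ a _) (trans (cong [_] (m+[n∸m]≡n (<⇒≤ (Finₚ.toℕ<n a)))) [p]≡0)

  *F-distribˡ : ∀ a b c → a *F (b +F c) ≡ a *F b +F a *F c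
  *F-distribˡ a b c = trans ([]-*ʳ a _) (trans (cong [_] (*-distribˡ-+ (toℕ a) _ _)) (sym ([]-+ _ _)))

  +F-identityʳ : ∀ a → a +F 0F ≡ a
  +F-identityʳ a = trans (+F-comm a 0F) (+F-identityˡ a)

  *F-zeroʳ : ∀ a → a *F 0F ≡ 0F
  *F-zeroʳ a = trans (*F-comm a 0F) (*F-zeroˡ a)

  *F-identityʳ : ∀ a → a *F 1F ≡ a
  *F-identityʳ a = trans (*F-comm a 1F) (*F-identityˡ a)

  *F-distribʳ : ∀ a b c → (b +F c) *F a ≡ b *F a +F c *F a
  *F-distribʳ a b c = trans (*F-comm _ a) (trans (*F-distribˡ a b c) (cong₂ _+F_ (*F-comm a b) (*F-comm a c)))

  -F-inverseˡ : ∀ a → (-F a) +F a ≡ 0F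
  -F-inverseˡ a = trans (+F-comm _ a) (-F-inverseʳ a)

  +F-isAbelianGroup : IsAbelianGroup _≡_ _+F_ 0F -F_
  +F-isAbelianGroup = record
    { isGroup = record
      { isMonoid = record
        { isSemigroup = record
          { isMagma = record { isEquivalence = isEquivalence ; ∙-cong = cong₂ _+F_ }
          ; assoc   = +F-assoc
          }
        ; identity = +F-identityˡ , +F-identityʳ
        }
      ; inverse = -F-inverseˡ , -F-inverseʳ
      ; ⁻¹-cong = cong -F_
      }
    ; comm = +F-comm
    }

  F-commutativeRing : CommutativeRing 0ℓ 0ℓ
  F-commutativeRing = record
    { _+_ = _+F_ ; _*_ = _*F_ ; -_ = -F_ ; 0# = 0F ; 1# = 1F
    ; isCommutativeRing = record
      { isRing = record
        { +-isAbelianGroup = +F-isAbelianGroup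
        ; *-cong     = cong₂ _*F_
        ; *-assoc    = *F-assoc
        ; *-identity = *F-identityˡ , *F-identityʳ
        ; distrib    = *F-distribˡ , *F-distribʳ
        }
      ; *-comm = *F-comm
      }
    }

  module F+ = AbelianGroupₚ (CommutativeRing.+-abelianGroup F-commutativeRing)
  module Fₚ = Ringₚ (CommutativeRing.ring F-commutativeRing)

  toℕ≡0⇒≡0F : ∀ a → toℕ a ≡ 0 → a ≡ 0F
  toℕ≡0⇒≡0F a eq = trans (sym ([toℕ] a)) (cong [_] eq)

  *F-integral : ∀ a b → a *F b ≡ 0F → a ≡ 0F ⊎ b ≡ 0F
  *F-integral a b ab≡0 with euclidsLemma (toℕ a) (toℕ b) p-prime (m%n≡0⇒n∣m _ p
      (trans (sym (toℕ-[] _)) (trans (cong toℕ ab≡0) (trans (toℕ-[] 0) (m<n⇒m%n≡m (ℕ.>-nonZero⁻¹ p))))))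
  ... | inj₁ p∣a = inj₁ (toℕ≡0⇒≡0F a (trans (sym (m<n⇒m%n≡m (Finₚ.toℕ<n a))) (n∣m⇒m%n≡0 _ p p∣a)))
  ... | inj₂ p∣b = inj₂ (toℕ≡0⇒≡0F b (trans (sym (m<n⇒m%n≡m (Finₚ.toℕ<n b))) (n∣m⇒m%n≡0 _ p p∣b)))

  1F≢0F : 1F ≢ 0F
  1F≢0F 1≡0 = contradiction (trans (sym 1≡) (trans (cong toℕ 1≡0) 0≡)) λ ()
    where
    1≡ : toℕ 1F ≡ 1
    1≡ = trans (toℕ-[] 1) (m<n⇒m%n≡m (ℕ.nonTrivial⇒n>1 p {{prime⇒nonTrivial p-prime}}))
    0≡ : toℕ 0F ≡ 0
    0≡ = trans (toℕ-[] 0) (m<n⇒m%n≡m (ℕ.>-nonZero⁻¹ p))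

  *F-cancelʳ : ∀ {c} → c ≢ 0F → ∀ {a b} → a *F c ≡ b *F c → a ≡ b
  *F-cancelʳ {c} c≢0 {a} {b} eq with *F-integral (a +F (-F b)) c
      (trans (*F-distribʳ c a (-F b)) (trans (cong₂ _+F_ eq (sym (Fₚ.-‿distribˡ-* b c))) (-F-inverseʳ _)))
  ... | inj₁ a-b≡0 = F+.x∙y⁻¹≈ε⇒x≈y a b a-b≡0
  ... | inj₂ c≡0   = contradiction c≡0 c≢0

  affine-count : ∀ {b} → b ≢ 0F → ∀ e c → ∑ (allFin p) (λ a → ⟦ a *F b +F e Finₚ.≟ c ⟧) ≡ 1
  affine-count {b} b≢0 e = injective-count (allFin-enumerates p) (λ a → a *F b +F e)
    (*F-cancelʳ b≢0 ∘ Fₚ.+-cancelʳ e _ _)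

-- Linear algebra over the prime field by counting.

module VectorSpace (p : ℕ) (p-prime : Prime p) where

  open LinearAlgebra p p-prime
  open FiniteField p p-prime

  private instance
    p≢0 : NonZero p
    p≢0 = prime⇒nonZero p-prime

  infix 8 -V_
  infixr 7 _·_

  -V_ : ∀ {d} → V d → V d
  -V_ = Vec.map -F_

  V-abelianGroup : ℕ → AbelianGroup 0ℓ 0ℓ
  V-abelianGroup d = record
    { Carrier = V d ; _≈_ = _≡_ ; _∙_ = _+V_ ; ε = 0V ; _⁻¹ = -V_
    ; isAbelianGroup = record
      { isGroup = record
        { isMonoid = record
          { isSemigroup = record
            { isMagma = record { isEquivalence = isEquivalence ; ∙-cong = cong₂ _+V_ }
            ; assoc   = Vecₚ.zipWith-assoc +F-assoc
            }
          ; identity = Vecₚ.zipWith-identityˡ +F-identityˡ , Vecₚ.zipWith-identityʳ +F-identityʳ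
          }
        ; inverse = Vecₚ.zipWith-inverseˡ -F-inverseˡ , Vecₚ.zipWith-inverseʳ -F-inverseʳ
        ; ⁻¹-cong = cong -V_
        }
      ; comm = Vecₚ.zipWith-comm +F-comm
      }
    }

  module V+ {d : ℕ} where
    open AbelianGroup (V-abelianGroup d) public using (assoc; comm; identityˡ; identityʳ; inverseˡ; inverseʳ)
    open AbelianGroupₚ (V-abelianGroup d) public

  _·_ : ∀ {e d} → Matrix e d → V d → V e
  A · x = Vec.map (λ row → dot row x) A

  interchange : ∀ a b c d → (a +F b) +F (c +F d) ≡ (a +F c) +F (b +F d)
  interchange a b c d = trans (+F-assoc a b _) (trans (cong (a +F_) (trans (sym (+F-assoc b c d))
    (trans (cong (_+F d) (+F-comm b c)) (+F-assoc c b d)))) (sym (+F-assoc a c _)))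

  dot-comm : ∀ {d} (x y : V d) → dot x y ≡ dot y x
  dot-comm []      []      = refl
  dot-comm (a ∷ x) (b ∷ y) = cong₂ _+F_ (*F-comm a b) (dot-comm x y)

  dot-+ˡ : ∀ {d} (x y z : V d) → dot (x +V y) z ≡ dot x z +F dot y z
  dot-+ˡ []      []      []      = sym (+F-identityˡ 0F)
  dot-+ˡ (a ∷ x) (b ∷ y) (c ∷ z) =
    trans (cong₂ _+F_ (*F-distribʳ c a b) (dot-+ˡ x y z)) (interchange (a *F c) (b *F c) (dot x z) (dot y z))

  dot-*ˡ : ∀ {d} a (x z : V d) → dot (a *V x) z ≡ a *F dot x z
  dot-*ˡ a []      []      = sym (*F-zeroʳ a)
  dot-*ˡ a (b ∷ x) (c ∷ z) = trans (cong₂ _+F_ (*F-assoc a b c) (dot-*ˡ a x z)) (sym (*F-distribˡ a _ _))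

  dot-0ˡ : ∀ {d} (z : V d) → dot 0V z ≡ 0F
  dot-0ˡ []      = refl
  dot-0ˡ (c ∷ z) = trans (cong₂ _+F_ (*F-zeroˡ c) (dot-0ˡ z)) (+F-identityˡ 0F)

  dot-+ʳ : ∀ {d} (z x y : V d) → dot z (x +V y) ≡ dot z x +F dot z y
  dot-+ʳ z x y = trans (dot-comm z _) (trans (dot-+ˡ x y z) (cong₂ _+F_ (dot-comm x z) (dot-comm y z)))

  dot-*ʳ : ∀ {d} a (z x : V d) → dot z (a *V x) ≡ a *F dot z x
  dot-*ʳ a z x = trans (dot-comm z _) (trans (dot-*ˡ a x z) (cong (a *F_) (dot-comm x z)))

  dot-0ʳ : ∀ {d} (z : V d) → dot z 0V ≡ 0F
  dot-0ʳ z = trans (dot-comm z 0V) (dot-0ˡ z)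

  dot-neg : ∀ {d} (z x : V d) → dot z (-V x) ≡ -F dot z x
  dot-neg z x = F+.inverseʳ-unique _ _ (trans (sym (dot-+ʳ z x (-V x))) (trans (cong (dot z) (V+.inverseʳ x)) (dot-0ʳ z)))

  combination-dot : ∀ {e d} (c : V e) (A : Matrix e d) x → dot (combination c A) x ≡ dot c (A · x)
  combination-dot []      []        x = dot-0ˡ x
  combination-dot (a ∷ c) (row ∷ A) x = trans (dot-+ˡ (a *V row) _ x)
    (cong₂ _+F_ (dot-*ˡ a row x) (combination-dot c A x))

  unit : ∀ {d} → Fin d → V d
  unit zero    = 1F ∷ 0V
  unit (suc i) = 0F ∷ unit i

  dot-unit : ∀ {d} (x : V d) i → dot x (unit i) ≡ lookup x i
  dot-unit (a ∷ x) zero    = trans (cong₂ _+F_ (*F-identityʳ a) (dot-0ʳ x)) (+F-identityʳ a)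
  dot-unit (a ∷ x) (suc i) = trans (cong₂ _+F_ (*F-zeroʳ a) (dot-unit x i)) (+F-identityˡ _)

  V-ext : ∀ {d} {x y : V d} → (∀ i → lookup x i ≡ lookup y i) → x ≡ y
  V-ext {x = x} {y} eq = trans (sym (Vecₚ.tabulate∘lookup x)) (trans (Vecₚ.tabulate-cong eq) (Vecₚ.tabulate∘lookup y))

  -- Nondegeneracy of the standard form, tested on unit vectors. Vector identities are proved from
  -- here on by pairing with an arbitrary `z`, where `combination-dot` reduces them to scalar ones.
  V-ext-dot : ∀ {d} {x y : V d} → (∀ z → dot x z ≡ dot y z) → x ≡ y
  V-ext-dot {x = x} {y} eq = V-ext λ i → trans (sym (dot-unit x i)) (trans (eq (unit i)) (dot-unit y i))

  lookup-combination : ∀ {e d} (c : V e) (A : Matrix e d) i → lookup (combination c A) i ≡ dot c (A · unit i)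
  lookup-combination c A i = trans (sym (dot-unit (combination c A) i)) (combination-dot c A (unit i))

  combination-+ : ∀ {e d} (c c′ : V e) (A : Matrix e d) → combination (c +V c′) A ≡ combination c A +V combination c′ A
  combination-+ c c′ A = V-ext-dot λ x → begin
    dot (combination (c +V c′) A) x                      ≡⟨ combination-dot (c +V c′) A x ⟩
    dot (c +V c′) (A · x)                                ≡⟨ dot-+ˡ c c′ (A · x) ⟩
    dot c (A · x) +F dot c′ (A · x)                      ≡⟨ cong₂ _+F_ (combination-dot c A x) (combination-dot c′ A x) ⟨
    dot (combination c A) x +F dot (combination c′ A) x  ≡⟨ dot-+ˡ (combination c A) (combination c′ A) x ⟨
    dot (combination c A +V combination c′ A) x          ∎
    where open ≡-Reasoning

  combination-* : ∀ {e d} a (c : V e) (A : Matrix e d) → combination (a *V c) A ≡ a *V combination c A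
  combination-* a c A = V-ext-dot λ x → trans (combination-dot (a *V c) A x) (trans (dot-*ˡ a c (A · x))
    (trans (cong (a *F_) (sym (combination-dot c A x))) (sym (dot-*ˡ a (combination c A) x))))

  combination-0 : ∀ {e d} (A : Matrix e d) → combination 0V A ≡ 0V
  combination-0 A = V-ext-dot λ x → trans (combination-dot 0V A x) (trans (dot-0ˡ (A · x)) (sym (dot-0ˡ x)))

  combination-neg : ∀ {e d} (c : V e) (A : Matrix e d) → combination (-V c) A ≡ -V combination c A
  combination-neg c A = V+.inverseʳ-unique _ _
    (trans (sym (combination-+ c (-V c) A)) (trans (cong (λ z → combination z A) (V+.inverseʳ c)) (combination-0 A)))

  combination-++ : ∀ {e e′ d} (c : V e) (c′ : V e′) (A : Matrix e d) (A′ : Matrix e′ d) →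
                   combination (c Vec.++ c′) (A Vec.++ A′) ≡ combination c A +V combination c′ A′
  combination-++ []      c′ []        A′ = sym (V+.identityˡ _)
  combination-++ (a ∷ c) c′ (row ∷ A) A′ =
    trans (cong (a *V row +V_) (combination-++ c c′ A A′)) (sym (V+.assoc (a *V row) _ _))

  ·-+ : ∀ {e d} (A : Matrix e d) x y → A · (x +V y) ≡ A · x +V A · y
  ·-+ []        x y = refl
  ·-+ (row ∷ A) x y = cong₂ _∷_ (dot-+ʳ row x y) (·-+ A x y)

  ·-0 : ∀ {e d} (A : Matrix e d) → A · 0V ≡ 0V
  ·-0 []        = refl
  ·-0 (row ∷ A) = cong₂ _∷_ (dot-0ʳ row) (·-0 A)

  lookup-transpose : ∀ {e d} (A : Matrix e d) i → lookup (transpose A) i ≡ A · unit i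
  lookup-transpose []        i = Vecₚ.lookup-replicate i []
  lookup-transpose {d = d} (row ∷ A) i = begin
    lookup (cons ⊛ row ⊛ transpose A) i                   ≡⟨ Vecₚ.lookup-⊛ i (cons ⊛ row) (transpose A) ⟩
    lookup (cons ⊛ row) i (lookup (transpose A) i)        ≡⟨ cong (_$ lookup (transpose A) i) (Vecₚ.lookup-⊛ i cons row) ⟩
    lookup cons i (lookup row i) (lookup (transpose A) i) ≡⟨ cong (λ f → f (lookup row i) (lookup (transpose A) i))
                                                               (Vecₚ.lookup-replicate i Vec._∷_) ⟩
    lookup row i ∷ lookup (transpose A) i                 ≡⟨ cong₂ Vec._∷_ (sym (dot-unit row i)) (lookup-transpose A i) ⟩
    (row ∷ A) · unit i                                    ∎
    where
    open ≡-Reasoning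
    cons : ∀ {e} → Vec (F → V e → V (suc e)) d
    cons = Vec.replicate d Vec._∷_

  allV-enumerates : ∀ d → Enumerates (allV d) _≟V_
  allV-enumerates zero    .Enumerates.once []      = refl
  allV-enumerates (suc d) .Enumerates.once (a ∷ v) = begin
    ∑ (allV (suc d)) (λ x → ⟦ x ≟V (a ∷ v) ⟧)
      ≡⟨ ∑-cartesianProductWith _∷_ (allFin p) (allV d) _ ⟩
    ∑ (allFin p) (λ b → ∑ (allV d) (λ y → ⟦ (b ∷ y) ≟V (a ∷ v) ⟧))
      ≡⟨ ∑-cong (allFin p) (λ b → ∑-cong (allV d) (λ y → trans
           (⟦⟧-cong ((b ∷ y) ≟V (a ∷ v)) ((b Finₚ.≟ a) ×-dec (y ≟V v)) Vecₚ.∷-injective λ { (refl , refl) → refl })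
           (⟦⟧-× (b Finₚ.≟ a) (y ≟V v)))) ⟩
    ∑ (allFin p) (λ b → ∑ (allV d) (λ y → ⟦ b Finₚ.≟ a ⟧ * ⟦ y ≟V v ⟧))
      ≡⟨ ∑-cong (allFin p) (λ b → trans (∑-*ˡ (allV d) ⟦ b Finₚ.≟ a ⟧ _)
           (trans (cong (⟦ b Finₚ.≟ a ⟧ *_) (allV-enumerates d .Enumerates.once v)) (*-identityʳ _))) ⟩
    ∑ (allFin p) (λ b → ⟦ b Finₚ.≟ a ⟧)
      ≡⟨ allFin-enumerates p .Enumerates.once a ⟩
    1 ∎
    where open ≡-Reasoning

  module allV {d : ℕ} = Enumerates (allV-enumerates d)

  ∑V-const : ∀ d c → ∑ (allV d) (λ _ → c) ≡ p ^ d * c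
  ∑V-const zero    c = refl
  ∑V-const (suc d) c = begin
    ∑ (allV (suc d)) (λ _ → c)                ≡⟨ ∑-cartesianProductWith _∷_ (allFin p) (allV d) _ ⟩
    ∑ (allFin p) (λ _ → ∑ (allV d) (λ _ → c)) ≡⟨ ∑-const (allFin p) _ ⟩
    length (allFin p) * ∑ (allV d) (λ _ → c)  ≡⟨ cong₂ _*_ (Listₚ.length-tabulate {n = p} (λ i → i)) (∑V-const d c) ⟩
    p * (p ^ d * c)                           ≡⟨ *-assoc p (p ^ d) c ⟨
    p * p ^ d * c                             ∎
    where open ≡-Reasoning

  -- If the first coordinate of `b` is nonzero, the other coordinates of `y` can be chosen freely
  -- and determine its first one; otherwise the first coordinate of `y` is free and the claim
  -- descends to the tails. The factor p on the left avoids the exponent d - 1.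
  dot-count : ∀ {d} {b : V d} → b ≢ 0V → ∀ c → p * ∑ (allV d) (λ y → ⟦ dot y b Finₚ.≟ c ⟧) ≡ p ^ d
  dot-count {zero}  {[]}    b≢0 c = contradiction refl b≢0
  dot-count {suc d} {b ∷ bs} b≢0 c with b Finₚ.≟ 0F
  ... | no b₀≢0 = cong (p *_) (begin
    ∑ (allV (suc d)) (λ y → ⟦ dot y (b ∷ bs) Finₚ.≟ c ⟧)
      ≡⟨ ∑-cartesianProductWith _∷_ (allFin p) (allV d) _ ⟩
    ∑ (allFin p) (λ a → ∑ (allV d) (λ y → ⟦ a *F b +F dot y bs Finₚ.≟ c ⟧))
      ≡⟨ ∑-swap (allFin p) (allV d) _ ⟩
    ∑ (allV d) (λ y → ∑ (allFin p) (λ a → ⟦ a *F b +F dot y bs Finₚ.≟ c ⟧))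
      ≡⟨ ∑-cong (allV d) (λ y → affine-count b₀≢0 (dot y bs) c) ⟩
    ∑ (allV d) (λ _ → 1)
      ≡⟨ trans (∑V-const d 1) (*-identityʳ (p ^ d)) ⟩
    p ^ d ∎)
    where open ≡-Reasoning
  ... | yes refl = cong (p *_) (begin
    ∑ (allV (suc d)) (λ y → ⟦ dot y (b ∷ bs) Finₚ.≟ c ⟧)
      ≡⟨ ∑-cartesianProductWith _∷_ (allFin p) (allV d) _ ⟩
    ∑ (allFin p) (λ a → ∑ (allV d) (λ y → ⟦ a *F 0F +F dot y bs Finₚ.≟ c ⟧))
      ≡⟨ ∑-cong (allFin p) (λ a → ∑-cong (allV d) (λ y →
           cong (λ z → ⟦ z Finₚ.≟ c ⟧) (trans (cong (_+F dot y bs) (*F-zeroʳ a)) (+F-identityˡ _)))) ⟩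
    ∑ (allFin p) (λ _ → ∑ (allV d) (λ y → ⟦ dot y bs Finₚ.≟ c ⟧))
      ≡⟨ ∑-const (allFin p) _ ⟩
    length (allFin p) * ∑ (allV d) (λ y → ⟦ dot y bs Finₚ.≟ c ⟧)
      ≡⟨ cong (_* ∑ (allV d) (λ y → ⟦ dot y bs Finₚ.≟ c ⟧)) (Listₚ.length-tabulate {n = p} (λ i → i)) ⟩
    p * ∑ (allV d) (λ y → ⟦ dot y bs Finₚ.≟ c ⟧)
      ≡⟨ dot-count (λ bs≡0 → b≢0 (cong (0F ∷_) bs≡0)) c ⟩
    p ^ d ∎)
    where open ≡-Reasoning

  -- The number p - 1 under a name: with p = `suc π` the ring solver can treat identities that would
  -- otherwise contain a truncated subtraction.
  π : ℕ
  π = p ∸ 1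

  p≡1+π : p ≡ suc π
  p≡1+π = sym (m+[n∸m]≡n (ℕ.>-nonZero⁻¹ p))

  π≢0 : NonZero π
  π≢0 = ℕ.≢-nonZero (m>n⇒m∸n≢0 (ℕ.nonTrivial⇒n>1 p {{prime⇒nonTrivial p-prime}}))

  -- This takes the place of the orthogonality of characters: the number of zeros of a functional
  -- detects whether it vanishes, with both cases merged into one formula that can be summed over
  -- `b`.
  hyperplane-count : ∀ {d} (b : V d) →
                     p * ∑ (allV d) (λ y → ⟦ dot y b Finₚ.≟ 0F ⟧) ≡ p ^ d * (1 + π * ⟦ b ≟V 0V ⟧)
  hyperplane-count {d} b with b ≟V 0V
  ... | no b≢0   = trans (dot-count b≢0 0F) (sym (trans (cong (λ z → p ^ d * (1 + z)) (*-zeroʳ π)) (*-identityʳ _)))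
  ... | yes refl = begin
    p * ∑ (allV d) (λ y → ⟦ dot y 0V Finₚ.≟ 0F ⟧)
      ≡⟨ cong (p *_) (∑-cong (allV d) λ y → ⟦⟧-yes (dot y 0V Finₚ.≟ 0F) (dot-0ʳ y)) ⟩
    p * ∑ (allV d) (λ y → 1)  ≡⟨ cong (p *_) (∑V-const d 1) ⟩
    p * (p ^ d * 1)           ≡⟨ cong (_* (p ^ d * 1)) p≡1+π ⟩
    suc π * (p ^ d * 1)       ≡⟨ rearrange π (p ^ d) ⟩
    p ^ d * (1 + π * 1)       ∎
    where
    open ≡-Reasoning
    rearrange : ∀ π q → suc π * (q * 1) ≡ q * (1 + π * 1)
    rearrange = solve-∀

  -- Count the pairs (x, c) with c · L x = c · b in both orders.
  module Adjoint {d e} (L : V d → V e) (L* : V e → V d) (adjoint : ∀ c x → dot c (L x) ≡ dot (L* c) x) where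

    fibre : V e → ℕ
    fibre b = ∑ (allV d) (λ x → ⟦ L x ≟V b ⟧)

    -- The size of the kernel of the adjoint, which over a field equals the size of the cokernel of
    -- `L`.
    cokernel : ℕ
    cokernel = ∑ (allV e) (λ c → ⟦ L* c ≟V 0V ⟧)

    cokernel⊥ : V e → ℕ
    cokernel⊥ b = ∑ (allV e) (λ c → ⟦ L* c ≟V 0V ⟧ * ⟦ dot c b Finₚ.≟ 0F ⟧)

    private
      pairs : V e → ℕ
      pairs b = ∑ (allV d) (λ x → ∑ (allV e) (λ c → ⟦ dot c (L x) Finₚ.≟ dot c b ⟧))

      -- For fixed x the admissible c are the zeros of the functional c ↦ c · (L x - b), which
      -- vanishes identically exactly when x lies in the fibre over b.
      by-x : ∀ b → p * pairs b ≡ p ^ e * (p ^ d + π * fibre b)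
      by-x b = begin
        p * pairs b
          ≡⟨ ∑-*ˡ (allV d) p _ ⟨
        ∑ (allV d) (λ x → p * ∑ (allV e) (λ c → ⟦ dot c (L x) Finₚ.≟ dot c b ⟧))
          ≡⟨ ∑-cong (allV d) one ⟩
        ∑ (allV d) (λ x → p ^ e * (1 + π * ⟦ L x ≟V b ⟧))
          ≡⟨ ∑-*ˡ (allV d) (p ^ e) _ ⟩
        p ^ e * ∑ (allV d) (λ x → 1 + π * ⟦ L x ≟V b ⟧)
          ≡⟨ cong (p ^ e *_) (trans (∑-+ (allV d) _ _) (cong₂ _+_ (trans (∑V-const d 1) (*-identityʳ _))
              (∑-*ˡ (allV d) π _))) ⟩
        p ^ e * (p ^ d + π * fibre b) ∎
        where
        open ≡-Reasoning
        one : ∀ x → p * ∑ (allV e) (λ c → ⟦ dot c (L x) Finₚ.≟ dot c b ⟧) ≡ p ^ e * (1 + π * ⟦ L x ≟V b ⟧)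
        one x = begin
          p * ∑ (allV e) (λ c → ⟦ dot c (L x) Finₚ.≟ dot c b ⟧)
            ≡⟨ cong (p *_) (∑-cong (allV e) λ c → ⟦⟧-cong (dot c (L x) Finₚ.≟ dot c b) (dot c (L x +V (-V b)) Finₚ.≟ 0F)
                 (λ eq → trans (expand c) (trans (cong (_+F (-F dot c b)) eq) (-F-inverseʳ _)))
                 (λ eq → F+.x∙y⁻¹≈ε⇒x≈y _ _ (trans (sym (expand c)) eq))) ⟩
          p * ∑ (allV e) (λ c → ⟦ dot c (L x +V (-V b)) Finₚ.≟ 0F ⟧)
            ≡⟨ hyperplane-count (L x +V (-V b)) ⟩
          p ^ e * (1 + π * ⟦ (L x +V (-V b)) ≟V 0V ⟧)
            ≡⟨ cong (λ z → p ^ e * (1 + π * z)) (⟦⟧-cong ((L x +V (-V b)) ≟V 0V) (L x ≟V b)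
                 (V+.x∙y⁻¹≈ε⇒x≈y _ _) (λ eq → trans (cong (_+V (-V b)) eq) (V+.inverseʳ b))) ⟩
          p ^ e * (1 + π * ⟦ L x ≟V b ⟧) ∎
          where
          expand : ∀ c → dot c (L x +V (-V b)) ≡ dot c (L x) +F (-F dot c b)
          expand c = trans (dot-+ʳ c (L x) (-V b)) (cong (dot c (L x) +F_) (dot-neg c b))

      -- For fixed c the condition on x reads L* c · x = c · b. If L* c is nonzero, a p-th of all x
      -- satisfies it; if L* c = 0, all x do or none does, according to whether c · b = 0. The
      -- second summand on the left brings the kernel of L* to the same shape as the generic c.
      by-c : ∀ b → p * pairs b + p ^ d * cokernel ≡ p ^ d * (p ^ e + p * cokernel⊥ b)
      by-c b = begin
        p * pairs b + p ^ d * cokernel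
          ≡⟨ cong₂ _+_ (trans (cong (p *_) (∑-swap (allV d) (allV e) _)) (sym (∑-*ˡ (allV e) p _)))
              (sym (∑-*ˡ (allV e) (p ^ d) _)) ⟩
        ∑ (allV e) (λ c → p * ∑ (allV d) (λ x → ⟦ dot c (L x) Finₚ.≟ dot c b ⟧)) + ∑ (allV e) (λ c → p ^ d * ⟦ L* c ≟V 0V ⟧)
          ≡⟨ ∑-+ (allV e) _ _ ⟨
        ∑ (allV e) (λ c → p * ∑ (allV d) (λ x → ⟦ dot c (L x) Finₚ.≟ dot c b ⟧) + p ^ d * ⟦ L* c ≟V 0V ⟧)
          ≡⟨ ∑-cong (allV e) one ⟩
        ∑ (allV e) (λ c → p ^ d * (1 + p * (⟦ L* c ≟V 0V ⟧ * ⟦ dot c b Finₚ.≟ 0F ⟧)))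
          ≡⟨ ∑-*ˡ (allV e) (p ^ d) _ ⟩
        p ^ d * ∑ (allV e) (λ c → 1 + p * (⟦ L* c ≟V 0V ⟧ * ⟦ dot c b Finₚ.≟ 0F ⟧))
          ≡⟨ cong (p ^ d *_) (trans (∑-+ (allV e) _ _) (cong₂ _+_ (trans (∑V-const e 1) (*-identityʳ _))
              (∑-*ˡ (allV e) p _))) ⟩
        p ^ d * (p ^ e + p * cokernel⊥ b) ∎
        where
        open ≡-Reasoning
        transposed : ∀ c → ∑ (allV d) (λ x → ⟦ dot c (L x) Finₚ.≟ dot c b ⟧) ≡ ∑ (allV d)
            (λ x → ⟦ dot x (L* c) Finₚ.≟ dot c b ⟧)
        transposed c = ∑-cong (allV d) λ x → cong (λ z → ⟦ z Finₚ.≟ dot c b ⟧) (trans (adjoint c x) (dot-comm (L* c) x))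
        one : ∀ c → p * ∑ (allV d) (λ x → ⟦ dot c (L x) Finₚ.≟ dot c b ⟧) + p ^ d * ⟦ L* c ≟V 0V ⟧
                    ≡ p ^ d * (1 + p * (⟦ L* c ≟V 0V ⟧ * ⟦ dot c b Finₚ.≟ 0F ⟧))
        one c with L* c ≟V 0V
        ... | no L*c≢0 = trans (cong₂ _+_ (trans (cong (p *_) (transposed c)) (dot-count L*c≢0 (dot c b))) (*-zeroʳ (p ^ d)))
                               (rearrange (p ^ d) p)
          where
          rearrange : ∀ q p → q + 0 ≡ q * (1 + p * 0)
          rearrange = solve-∀
        ... | yes L*c≡0 = trans (cong (λ z → p * z + p ^ d * 1) (trans (∑-cong (allV d) λ x →
                                  ⟦⟧-cong (dot c (L x) Finₚ.≟ dot c b) (dot c b Finₚ.≟ 0F)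
                                    (λ eq → trans (sym eq) (vanishes x)) (λ eq → trans (vanishes x) (sym eq)))
                                  (∑V-const d _)))
                                (rearrange p (p ^ d) ⟦ dot c b Finₚ.≟ 0F ⟧)
          where
          vanishes : ∀ x → dot c (L x) ≡ 0F
          vanishes x = trans (adjoint c x) (trans (cong (λ z → dot z x) L*c≡0) (dot-0ˡ x))
          rearrange : ∀ p q z → p * (q * z) + q * 1 ≡ q * (1 + p * (1 * z))
          rearrange = solve-∀

    -- The two counts of `pairs` share the term p^e p^d, which is cancelled. The identity assumes
    -- nothing about the rank of `L`, and this is why it can later be summed over blocks with
    -- dependent columns.
    fibre-identity : ∀ b → p ^ e * (π * fibre b) + p ^ d * cokernel ≡ p ^ d * (p * cokernel⊥ b)
    fibre-identity b = +-cancelˡ-≡ (p ^ e * p ^ d) _ _ (begin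
      p ^ e * p ^ d + (p ^ e * (π * fibre b) + p ^ d * cokernel)  ≡⟨ factor (p ^ e) (p ^ d) (π * fibre b)
          (p ^ d * cokernel) ⟩
      p ^ e * (p ^ d + π * fibre b) + p ^ d * cokernel            ≡⟨ cong (_+ p ^ d * cokernel) (by-x b) ⟨
      p * pairs b + p ^ d * cokernel                              ≡⟨ by-c b ⟩
      p ^ d * (p ^ e + p * cokernel⊥ b)                           ≡⟨ *-distribˡ-+ (p ^ d) (p ^ e) _ ⟩
      p ^ d * p ^ e + p ^ d * (p * cokernel⊥ b)                   ≡⟨ cong (_+ p ^ d * (p * cokernel⊥ b))
          (*-comm (p ^ d) (p ^ e)) ⟩
      p ^ e * p ^ d + p ^ d * (p * cokernel⊥ b)                   ∎)
      where
      open ≡-Reasoning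
      factor : ∀ a b c d → a * b + (a * c + d) ≡ a * (b + c) + d
      factor = solve-∀

    -- The hypothesis says that b is orthogonal to the whole kernel of L*, that is, that b lies in
    -- the image of `L`. The conclusion is then rank-nullity for the fibre over b, in multiplied-out
    -- form.
    fibre-when : ∀ b → cokernel⊥ b ≡ cokernel → p ^ e * fibre b ≡ p ^ d * cokernel
    fibre-when b same = *-cancelˡ-≡ _ _ π {{π≢0}} (+-cancelʳ-≡ (p ^ d * cokernel) _ _ (begin
      π * (p ^ e * fibre b) + p ^ d * cokernel  ≡⟨ cong (_+ p ^ d * cokernel) (x∙yz≈y∙xz π (p ^ e) (fibre b)) ⟩
      p ^ e * (π * fibre b) + p ^ d * cokernel  ≡⟨ fibre-identity b ⟩
      p ^ d * (p * cokernel⊥ b)                 ≡⟨ cong₂ (λ x y → p ^ d * (x * y)) p≡1+π same ⟩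
      p ^ d * (suc π * cokernel)                ≡⟨ split (p ^ d) π cokernel ⟩
      π * (p ^ d * cokernel) + p ^ d * cokernel ∎))
      where
      open ≡-Reasoning
      split : ∀ q π c → q * (suc π * c) ≡ π * (q * c) + q * c
      split = solve-∀

    kernel-count : p ^ e * fibre 0V ≡ p ^ d * cokernel
    kernel-count = fibre-when 0V (∑-cong (allV e) λ c → trans
      (cong (⟦ L* c ≟V 0V ⟧ *_) (⟦⟧-yes (dot c 0V Finₚ.≟ 0F) (dot-0ʳ c))) (*-identityʳ _))

    fibre-count : (∀ c → L* c ≡ 0V → c ≡ 0V) → ∀ b → p ^ e * fibre b ≡ p ^ d
    fibre-count injective b = trans (fibre-when b (∑-cong (allV e) same))
        (trans (cong (p ^ d *_) cokernel≡1) (*-identityʳ _))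
      where
      L*0≡0 : L* 0V ≡ 0V
      L*0≡0 = V-ext-dot λ x → trans (sym (adjoint 0V x)) (trans (dot-0ˡ (L x)) (sym (dot-0ˡ x)))
      cokernel≡1 : cokernel ≡ 1
      cokernel≡1 = allV.∑-unique (λ c → L* c ≟V 0V) 0V L*0≡0 injective
      same : ∀ c → ⟦ L* c ≟V 0V ⟧ * ⟦ dot c b Finₚ.≟ 0F ⟧ ≡ ⟦ L* c ≟V 0V ⟧
      same c with L* c ≟V 0V
      ... | no _    = refl
      ... | yes L*c≡0 = trans (*-identityˡ _) (⟦⟧-yes (dot c b Finₚ.≟ 0F)
          (trans (cong (λ z → dot z b) (injective c L*c≡0)) (dot-0ˡ b)))

    surjective : (∀ c → L* c ≡ 0V → c ≡ 0V) → ∀ b → ∃ λ x → L x ≡ b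
    surjective injective b with ∑-nonzero-member (allV d) (λ x → ⟦ L x ≟V b ⟧)
      (λ ≡0 → ℕ.≢-nonZero⁻¹ (p ^ d) {{m^n≢0 p d}} (trans (sym (fibre-count injective b))
          (trans (cong (p ^ e *_) ≡0) (*-zeroʳ (p ^ e)))))
    ... | x , _ , ≢0 = x , ⟦⟧-elim (L x ≟V b) ≢0

  module Rows {e d} (A : Matrix e d) = Adjoint (A ·_) (λ c → combination c A) (λ c x → sym (combination-dot c A x))

  module Columns {e d} (A : Matrix e d) = Adjoint (λ c → combination c A) (A ·_)
    (λ x c → trans (dot-comm x _) (trans (combination-dot c A x) (dot-comm c _)))

  kernel≡1⇒injective : ∀ {d e} (L : V d → V e) → ∑ (allV d) (λ x → ⟦ L x ≟V 0V ⟧) ≤ 1 → L 0V ≡ 0V → ∀ x → L x ≡ 0V → x ≡ 0V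
  kernel≡1⇒injective L ≤1 L0≡0 x Lx≡0 = allV.∑≡1⇒unique (λ x → L x ≟V 0V) ≤1 Lx≡0 L0≡0

  -- `HasRank` speaks of the column space, while the proof needs independent rows. A relation y
  -- among the rows is orthogonal to all columns, hence to the e independent vectors `vs` spanning
  -- the same space; those vectors, read as a square matrix, have a kernel of size 1.
  fullRank⇒independent : ∀ {e d} (A : Matrix e d) → HasRank A e → LinearlyIndependent A
  fullRank⇒independent {e} A (vs , vs-independent , spans) y yA≡0 =
    kernel≡1⇒injective (vs ·_) (≤-reflexive (*-cancelˡ-≡ _ 1 (p ^ e) {{m^n≢0 p e}}
        (trans (Rows.fibre-count vs vs-independent 0V) (sym (*-identityʳ _)))))
      (·-0 vs) y (V-ext λ i → trans (Vecₚ.lookup-map i _ vs) (trans (orthogonal i) (sym (Vecₚ.lookup-replicate i 0F))))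
    where
    column-orthogonal : ∀ i → dot (lookup (transpose A) i) y ≡ 0F
    column-orthogonal i = begin
      dot (lookup (transpose A) i) y   ≡⟨ cong (λ z → dot z y) (lookup-transpose A i) ⟩
      dot (A · unit i) y               ≡⟨ dot-comm _ y ⟩
      dot y (A · unit i)               ≡⟨ combination-dot y A (unit i) ⟨
      dot (combination y A) (unit i)   ≡⟨ cong (λ z → dot z (unit i)) yA≡0 ⟩
      dot 0V (unit i)                  ≡⟨ dot-0ˡ (unit i) ⟩
      0F                               ∎
      where open ≡-Reasoning
    orthogonal : ∀ i → dot (lookup vs i) y ≡ 0F
    orthogonal i with Equivalence.from (spans (lookup vs i)) (unit i , combination-unit)
      where
      combination-unit : combination (unit i) vs ≡ lookup vs i
      combination-unit = V-ext-dot λ z → trans (combination-dot (unit i) vs z) (trans (dot-comm _ (vs · z))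
        (trans (dot-unit (vs · z) i) (Vecₚ.lookup-map i _ vs)))
    ... | a , aA≡v = begin
      dot (lookup vs i) y                   ≡⟨ cong (λ z → dot z y) aA≡v ⟨
      dot (combination a (transpose A)) y   ≡⟨ combination-dot a (transpose A) y ⟩
      dot a (transpose A · y)               ≡⟨ cong (dot a) (V-ext λ j → trans (Vecₚ.lookup-map j _ (transpose A))
                                                 (trans (column-orthogonal j) (sym (Vecₚ.lookup-replicate j 0F)))) ⟩
      dot a 0V                              ≡⟨ dot-0ʳ a ⟩
      0F                                    ∎
      where open ≡-Reasoning

  Span-isSubspace : ∀ {e d} (A : Matrix e d) → IsSubspace (Span A)
  Span-isSubspace A = record
    { 0-mem    = 0V , combination-0 A
    ; +-closed = λ { (c , refl) (c′ , refl) → c +V c′ , combination-+ c c′ A }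
    ; *-closed = λ { a (c , refl) → a *V c , combination-* a c A }
    }

  ^⊥-isSubspace : ∀ {d} (U : DecSet (V d)) → IsSubspace (Mem (U ^⊥))
  ^⊥-isSubspace U = record
    { 0-mem    = λ x _ → dot-0ʳ x
    ; +-closed = λ {y} {z} y⊥ z⊥ x x∈U → trans (dot-+ʳ x y z) (trans (cong₂ _+F_ (y⊥ x x∈U) (z⊥ x x∈U)) (+F-identityˡ 0F))
    ; *-closed = λ a {y} y⊥ x x∈U → trans (dot-*ʳ a x y) (trans (cong (a *F_) (y⊥ x x∈U)) (*F-zeroʳ a))
    }

-- Block coordinates of a word and the edges of the multigraph.

module _ {A : Set} {xs : List A} {_≟_ : DecidableEquality A} (enum : Enumerates xs _≟_) {Q : Pred A 0ℓ}
    (Q? : Decidable Q) where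

  open Enumerates enum

  filter-singleton : ∀ {a} → Q a → (∀ x → Q x → x ≡ a) → filter Q? xs ≡ a ∷ []
  filter-singleton {a} Qa only = go (filter Q? xs) (trans (length-filter-∑ Q? xs) (∑-unique Q? a Qa only))
    (λ x∈ → only _ (proj₂ (∈-filter⁻ Q? {xs = xs} x∈)))
    where
    go : ∀ ys → length ys ≡ 1 → (∀ {y} → y ∈ ys → y ≡ a) → ys ≡ a ∷ []
    go (y ∷ []) _ eq = cong (_∷ []) (eq (here refl))

  filter-singleton⁻ : ∀ {a} → filter Q? xs ≡ a ∷ [] → Q a × (∀ x → Q x → x ≡ a)
  filter-singleton⁻ {a} eq = proj₂ (∈-filter⁻ Q? {xs = xs} (subst (a ∈_) (sym eq) (here refl))) , only
    where
    only : ∀ x → Q x → x ≡ a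
    only x Qx with subst (x ∈_) eq (∈-filter⁺ Q? (member x) Qx)
    ... | here x≡a = x≡a

position-surjective : ∀ {s} (f : Fin s → ℕ) (x : Fin (Σℕ f)) → ∃ λ i → ∃ λ l → position f i l ≡ x
position-surjective {suc s} f x with splitAt (f zero) x in eq
... | inj₁ l = zero , l , Finₚ.splitAt⁻¹-↑ˡ eq
... | inj₂ x′ with position-surjective (f ∘ suc) x′
...   | i , l , refl = suc i , l , Finₚ.splitAt⁻¹-↑ʳ {f zero} eq

position-injective : ∀ {s} (f : Fin s → ℕ) i l i′ l′ → position f i l ≡ position f i′ l′ → (i , l) ≡ (i′ , l′)
position-injective f zero    l zero     l′ eq = cong (zero ,_) (Finₚ.↑ˡ-injective _ l l′ eq)
position-injective f zero    l (suc i′) l′ eq = contradiction (trans (sym (Finₚ.splitAt-↑ˡ (f zero) l _))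
  (trans (cong (splitAt (f zero)) eq) (Finₚ.splitAt-↑ʳ (f zero) _ _))) λ ()
position-injective f (suc i) l zero     l′ eq = contradiction (trans (sym (Finₚ.splitAt-↑ˡ (f zero) l′ _))
  (trans (cong (splitAt (f zero)) (sym eq)) (Finₚ.splitAt-↑ʳ (f zero) _ _))) λ ()
position-injective f (suc i) l (suc i′) l′ eq
  with position-injective (f ∘ suc) i l i′ l′ (Finₚ.↑ʳ-injective (f zero) _ _ eq)
... | refl = refl

∑-dependentPairs : ∀ {s} (n : Fin s → ℕ) (f : (∃ λ i → Fin (n i)) → ℕ) →
                   ∑ (List.concat (List.tabulate λ i → List.map (i ,_) (allFin (n i)))) f ≡ Σℕ (λ i → Σℕ (λ j → f (i , j)))
∑-dependentPairs {s} n f = begin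
  ∑ (List.concat (List.tabulate g)) f             ≡⟨ cong (λ xs → ∑ (List.concat xs) f) (Listₚ.map-tabulate (λ i → i) g) ⟨
  ∑ (List.concatMap g (allFin s)) f               ≡⟨ ∑-concatMap g (allFin s) f ⟩
  ∑ (allFin s) (λ i → ∑ (g i) f)                  ≡⟨ ∑-tabulate (λ i → i) (λ i → ∑ (g i) f) ⟩
  Σℕ (λ i → ∑ (g i) f)                            ≡⟨ ℕSum.sum-cong-≗ {s}
      (λ i → trans (∑-map (i ,_) (allFin (n i)) f) (∑-tabulate (λ j → j) (λ j → f (i , j)))) ⟩
  Σℕ (λ i → Σℕ (λ j → f (i , j)))                 ∎
  where
  open ≡-Reasoning
  g : Fin s → List (∃ λ i → Fin (n i))
  g i = List.map (i ,_) (allFin (n i))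

module BlockStructure (p : ℕ) (p-prime : Prime p) (r : ℕ) (n : Fin (suc r) → ℕ) where

  open Blocks p p-prime r n
  open FiniteField p p-prime
  open VectorSpace p p-prime

  private instance
    p≢0 : NonZero p
    p≢0 = prime⇒nonZero p-prime

  coordinate-surjective : ∀ x → ∃ λ β → ∃ λ l → coordinate β l ≡ x
  coordinate-surjective x with position-surjective (λ i → n i * sizeOf i) x
  ... | i , jl , refl with Finₚ.combine-surjective {n i} jl
  ...   | j , l , refl = (i , j) , l , refl

  coordinate-injective : ∀ β l β′ l′ → coordinate β l ≡ coordinate β′ l′ → (β , l) ≡ (β′ , l′)
  coordinate-injective (i , j) l (i′ , j′) l′ eq =
    go i′ j′ l′ (position-injective (λ i → n i * sizeOf i) i (combine j l) i′ (combine j′ l′) eq)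
    where
    go : ∀ i′ (j′ : Fin (n i′)) (l′ : Fin (sizeOf i′)) →
         _≡_ {A = ∃ λ i → Fin (n i * sizeOf i)} (i , combine j l) (i′ , combine j′ l′) →
         _≡_ {A = ∃ λ β → Fin (size β)} ((i , j) , l) ((i′ , j′) , l′)
    go i′ j′ l′ same with cong proj₁ same
    ... | refl with Finₚ.combine-injective j l j′ l′ (,-injectiveʳ same)
    ...   | refl , refl = refl

  _≟B_ : DecidableEquality Block
  _≟B_ = Productₚ.≡-dec Finₚ._≟_ Finₚ._≟_

  ∑-blocks : ∀ (f : Block → ℕ) → ∑ blocks f ≡ Σℕ (λ i → Σℕ (λ j → f (i , j)))
  ∑-blocks = ∑-dependentPairs n

  Σℕ-const : ∀ m c → Σℕ {m} (λ _ → c) ≡ m * c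
  Σℕ-const zero    c = refl
  Σℕ-const (suc m) c = cong (c +_) (Σℕ-const m c)

  ∑-blocks-size : ∀ (f : Fin s → ℕ) → ∑ blocks (f ∘ proj₁) ≡ Σℕ (λ i → n i * f i)
  ∑-blocks-size f = trans (∑-blocks (f ∘ proj₁)) (ℕSum.sum-cong-≗ {s} (λ i → Σℕ-const (n i) (f i)))

  ∑-blocks-const : ∀ c → ∑ blocks (λ _ → c) ≡ #blocks * c
  ∑-blocks-const c = trans (∑-const blocks c) (cong (_* c) (begin
    length blocks         ≡⟨ trans (∑-const blocks 1) (*-identityʳ _) ⟨
    ∑ blocks (λ _ → 1)    ≡⟨ ∑-blocks-size (λ _ → 1) ⟩
    Σℕ (λ i → n i * 1)    ≡⟨ ℕSum.sum-cong-≗ {s} (λ i → *-identityʳ (n i)) ⟩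
    #blocks               ∎))
    where open ≡-Reasoning

  blocks-enumerates : Enumerates blocks _≟B_
  blocks-enumerates .Enumerates.once (i₀ , j₀) = trans (∑-blocks _)
      (trans (ℕSum.sum-cong-≗ {s} λ i → inner i (i Finₚ.≟ i₀)) (Σℕ-delta i₀))
    where
    inner : ∀ i (eq? : Dec (i ≡ i₀)) → Σℕ (λ j → ⟦ (i , j) ≟B (i₀ , j₀) ⟧) ≡ ⟦ eq? ⟧
    inner i (yes refl) = trans (ℕSum.sum-cong-≗ {n i} λ j → ⟦⟧-cong ((i , j) ≟B (i₀ , j₀)) (j Finₚ.≟ j₀)
                       (,-injectiveʳ) (cong (i ,_))) (Σℕ-delta j₀)
    inner i (no i≢i₀)  = trans (ℕSum.sum-cong-≗ {n i} λ j → ⟦⟧-no ((i , j) ≟B (i₀ , j₀)) (i≢i₀ ∘ cong proj₁))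
        (ℕSum.sum-replicate-zero (n i))

  module allBlocks = Enumerates blocks-enumerates

  lookup-unit-same : ∀ {d} (i : Fin d) → lookup (unit i) i ≡ 1F
  lookup-unit-same zero    = refl
  lookup-unit-same (suc i) = lookup-unit-same i

  lookup-unit-other : ∀ {d} (i j : Fin d) → i ≢ j → lookup (unit i) j ≡ 0F
  lookup-unit-other zero    zero    i≢j = contradiction refl i≢j
  lookup-unit-other zero    (suc j) i≢j = Vecₚ.lookup-replicate j 0F
  lookup-unit-other (suc i) zero    i≢j = refl
  lookup-unit-other (suc i) (suc j) i≢j = lookup-unit-other i j (i≢j ∘ cong suc)

  unitRows : (β : Block) → Matrix (size β) N
  unitRows β = tabulate (λ l → unit (coordinate β l))

  unitRows-· : ∀ β x → unitRows β · x ≡ block x β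
  unitRows-· β x = trans (sym (Vecₚ.tabulate-∘ (λ row → dot row x) (λ l → unit (coordinate β l))))
    (Vecₚ.tabulate-cong λ l → trans (dot-comm _ x) (dot-unit x (coordinate β l)))

  lookup-block : ∀ x β l → lookup (block x β) l ≡ lookup x (coordinate β l)
  lookup-block x β l = Vecₚ.lookup∘tabulate (λ l → lookup x (coordinate β l)) l

  word-ext : ∀ {x y : Word} → (∀ β → block x β ≡ block y β) → x ≡ y
  word-ext {x} {y} same = V-ext go
    where
    go : ∀ i → lookup x i ≡ lookup y i
    go i with coordinate-surjective i
    ... | β , l , refl = trans (sym (lookup-block x β l)) (trans (cong (λ z → lookup z l) (same β)) (lookup-block y β l))

  block-+ : ∀ x y β → block (x +V y) β ≡ block x β +V block y β
  block-+ x y β = trans (sym (unitRows-· β (x +V y))) (trans (·-+ (unitRows β) x y)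
      (cong₂ _+V_ (unitRows-· β x) (unitRows-· β y)))

  block-0 : ∀ β → block 0V β ≡ 0V
  block-0 β = trans (sym (unitRows-· β 0V)) (·-0 (unitRows β))

  -- The word with `e` in block β and zeros elsewhere. Writing it as a combination of unit words
  -- makes it linear in `e` and adjoint to taking the block.
  insert : (β : Block) → V (size β) → Word
  insert β e = combination e (unitRows β)

  block-insert-same : ∀ β e → block (insert β e) β ≡ e
  block-insert-same β e = V-ext λ l → begin
    lookup (block (insert β e) β) l               ≡⟨ lookup-block (insert β e) β l ⟩
    lookup (insert β e) (coordinate β l)          ≡⟨ lookup-combination e (unitRows β) (coordinate β l) ⟩
    dot e (unitRows β · unit (coordinate β l))    ≡⟨ cong (dot e)
        (trans (unitRows-· β _) (V-ext λ l′ → trans (lookup-block (unit (coordinate β l)) β l′) (kronecker l l′))) ⟩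
    dot e (unit l)                                ≡⟨ dot-unit e l ⟩
    lookup e l                                    ∎
    where
    open ≡-Reasoning
    kronecker : ∀ l l′ → lookup (unit (coordinate β l)) (coordinate β l′) ≡ lookup (unit l) l′
    kronecker l l′ with l Finₚ.≟ l′
    ... | yes refl = trans (lookup-unit-same (coordinate β l)) (sym (lookup-unit-same l))
    ... | no l≢l′  = trans (lookup-unit-other _ _ λ eq → l≢l′ (,-injectiveʳ (coordinate-injective β l β l′ eq)))
                           (sym (lookup-unit-other l l′ l≢l′))

  block-insert-other : ∀ β e β′ → β ≢ β′ → block (insert β e) β′ ≡ 0V
  block-insert-other β e β′ β≢β′ = V-ext λ l → begin
    lookup (block (insert β e) β′) l               ≡⟨ lookup-block (insert β e) β′ l ⟩
    lookup (insert β e) (coordinate β′ l)          ≡⟨ lookup-combination e (unitRows β) (coordinate β′ l) ⟩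
    dot e (unitRows β · unit (coordinate β′ l))    ≡⟨ cong (dot e)
        (trans (unitRows-· β _) (V-ext λ l′ → trans (lookup-block (unit (coordinate β′ l)) β l′)
                                                        (trans (lookup-unit-other _ _ λ eq → β≢β′
                                                            (sym (cong proj₁ (coordinate-injective β′ l β l′ eq))))
                                                          (sym (Vecₚ.lookup-replicate l′ 0F))))) ⟩
    dot e 0V                                       ≡⟨ dot-0ʳ e ⟩
    0F                                             ≡⟨ Vecₚ.lookup-replicate l 0F ⟨
    lookup 0V l                                    ∎
    where open ≡-Reasoning

  ·-insert : ∀ {e} (A : Matrix e N) β c → A · insert β c ≡ combination c (tabulate λ l → A · unit (coordinate β l))
  ·-insert A β c = V-ext-dot λ y → begin
    dot (A · insert β c) y                          ≡⟨ dot-comm _ y ⟩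
    dot y (A · insert β c)                          ≡⟨ combination-dot y A (insert β c) ⟨
    dot (combination y A) (insert β c)              ≡⟨ dot-comm _ (insert β c) ⟩
    dot (insert β c) (combination y A)              ≡⟨ combination-dot c (unitRows β) _ ⟩
    dot c (unitRows β · combination y A)            ≡⟨ cong (dot c)
        (trans (sym (Vecₚ.tabulate-∘ (λ row → dot row (combination y A)) (λ l → unit (coordinate β l))))
        (trans (Vecₚ.tabulate-cong λ l → begin
      dot (unit (coordinate β l)) (combination y A)   ≡⟨ dot-comm _ (combination y A) ⟩
      dot (combination y A) (unit (coordinate β l))   ≡⟨ combination-dot y A _ ⟩
      dot y (A · unit (coordinate β l))               ≡⟨ dot-comm y _ ⟩
      dot (A · unit (coordinate β l)) y               ∎) (Vecₚ.tabulate-∘ (λ row → dot row y)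
          (λ l → A · unit (coordinate β l))))) ⟩
    dot c ((tabulate λ l → A · unit (coordinate β l)) · y) ≡⟨ combination-dot c _ y ⟨
    dot (combination c (tabulate λ l → A · unit (coordinate β l))) y ∎
    where open ≡-Reasoning

  differs? : ∀ x y β → Dec (block x β ≢ block y β)
  differs? x y β = ¬? (block x β ≟V block y β)

  _≟L_ : DecidableEquality (List Block)
  _≟L_ = Listₚ.≡-dec _≟B_

  -- The definition matches on one-element lists; as a sum over the candidates for that element it
  -- can be interchanged with the sum over all words.
  edgeMultiplicity-∑ : ∀ L → edgeMultiplicity L ≡ ∑ blocks (λ β → p ^ (s ∸ size β) * ⟦ L ≟L (β ∷ []) ⟧)
  edgeMultiplicity-∑ (β ∷ []) = sym (trans (∑-cong blocks λ β′ → trans (*-comm (p ^ (s ∸ size β′)) _)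
    (cong (_* p ^ (s ∸ size β′)) (⟦⟧-cong ((β ∷ []) ≟L (β′ ∷ [])) (β′ ≟B β) (λ { refl → refl }) (λ { refl → refl }))))
    (allBlocks.∑-delta β (λ β′ → p ^ (s ∸ size β′))))
  edgeMultiplicity-∑ []          = sym (trans (∑-cong blocks λ β → trans
      (cong (p ^ (s ∸ size β) *_) (⟦⟧-no ([] ≟L (β ∷ [])) λ ())) (*-zeroʳ (p ^ (s ∸ size β)))) (∑-zero blocks))
  edgeMultiplicity-∑ L@(_ ∷ _ ∷ _) = sym (trans (∑-cong blocks λ β → trans
      (cong (p ^ (s ∸ size β) *_) (⟦⟧-no (L ≟L (β ∷ [])) λ ())) (*-zeroʳ (p ^ (s ∸ size β)))) (∑-zero blocks))

  -- The step `e` can only be the difference of the two words in block β, so the sum on the right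
  -- has at most one nonzero term.
  single-difference : ∀ x y β → ⟦ differences x y ≟L (β ∷ []) ⟧ ≡ ∑ (allV (size β))
      (λ e → ⟦ ¬? (e ≟V 0V) ⟧ * ⟦ y ≟V (x +V insert β e) ⟧)
  single-difference x y β = trans step (∑-cong (allV (size β)) λ e → ⟦⟧-× (¬? (e ≟V 0V)) (y ≟V (x +V insert β e)))
    where
    Step : V (size β) → Set
    Step e = e ≢ 0V × y ≡ x +V insert β e
    Step? : Decidable Step
    Step? e = ¬? (e ≟V 0V) ×-dec (y ≟V (x +V insert β e))

    block-step : ∀ {e} → y ≡ x +V insert β e → block y β ≡ block x β +V e
    block-step {e} y≡ = trans (cong (λ z → block z β) y≡) (trans (block-+ x (insert β e) β)
        (cong (block x β +V_) (block-insert-same β e)))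

    step : ⟦ differences x y ≟L (β ∷ []) ⟧ ≡ ∑ (allV (size β)) (λ e → ⟦ Step? e ⟧)
    step with differences x y ≟L (β ∷ [])
    ... | yes eq = sym (allV.∑-unique Step? e₀ (e₀≢0 , y≡) λ e (_ , y≡′) →
                     V+.∙-cancelˡ (block x β) e e₀ (trans (sym (block-step y≡′)) (sym x+e₀)))
      where
      at-β : block x β ≢ block y β
      at-β = proj₁ (filter-singleton⁻ blocks-enumerates (differs? x y) eq)
      elsewhere : ∀ β′ → block x β′ ≢ block y β′ → β′ ≡ β
      elsewhere = proj₂ (filter-singleton⁻ blocks-enumerates (differs? x y) eq)
      e₀ : V (size β)
      e₀ = (-V block x β) +V block y β
      x+e₀ : block x β +V e₀ ≡ block y β
      x+e₀ = trans (sym (V+.assoc (block x β) _ _)) (trans (cong (_+V block y β) (V+.inverseʳ (block x β))) (V+.identityˡ _))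
      e₀≢0 : e₀ ≢ 0V
      e₀≢0 e₀≡0 = at-β (trans (sym (V+.identityʳ _)) (trans (cong (block x β +V_) (sym e₀≡0)) x+e₀))
      y≡ : y ≡ x +V insert β e₀
      y≡ = word-ext λ β′ → trans (at β′) (sym (block-+ x (insert β e₀) β′))
        where
        at : ∀ β′ → block y β′ ≡ block x β′ +V block (insert β e₀) β′
        at β′ with β ≟B β′
        ... | yes refl = sym (trans (cong (block x β +V_) (block-insert-same β e₀)) x+e₀)
        ... | no β≢β′  = sym (trans (cong (block x β′ +V_) (block-insert-other β e₀ β′ β≢β′)) (trans (V+.identityʳ _)
                           (decidable-stable (block x β′ ≟V block y β′) λ ≢ → β≢β′ (sym (elsewhere β′ ≢)))))
    ... | no neq = sym (allV.∑-none Step? λ e (e≢0 , y≡) → neq (filter-singleton blocks-enumerates (differs? x y)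
                     (λ same → e≢0 (V+.identityʳ-unique (block x β) e (trans (sym (block-step y≡)) (sym same))))
                     λ β′ ≢ → decidable-stable (β′ ≟B β) λ β′≢β → ≢ (sym (trans (cong (λ z → block z β′) y≡)
                       (trans (block-+ x (insert β e) β′) (trans
                           (cong (block x β′ +V_) (block-insert-other β e β′ (β′≢β ∘ sym))) (V+.identityʳ _))))))) 

  -- The neighbours of x are listed by the steps (β, e) with e nonzero instead of being searched
  -- among all words. The test function is later the indicator of a set, which gives `edges`, or the
  -- constant 1, which gives `degree`.
  neighbours : ∀ x (f : Word → ℕ) →
    ∑ (allV N) (λ y → f y * edgeMultiplicity (differences x y)) ≡
    ∑ blocks (λ β → p ^ (s ∸ size β) * ∑ (allV (size β)) (λ e → ⟦ ¬? (e ≟V 0V) ⟧ * f (x +V insert β e)))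
  neighbours x f = begin
    ∑ (allV N) (λ y → f y * edgeMultiplicity (differences x y))
      ≡⟨ ∑-cong (allV N) (λ y → trans (cong (f y *_) (expand y)) (sym (∑-*ˡ blocks (f y) _))) ⟩
    ∑ (allV N) (λ y → ∑ blocks (λ β → f y * (p ^ (s ∸ size β) * ∑ (allV (size β))
        (λ e → ⟦ ¬? (e ≟V 0V) ⟧ * ⟦ y ≟V (x +V insert β e) ⟧))))
      ≡⟨ ∑-swap (allV N) blocks _ ⟩
    ∑ blocks (λ β → ∑ (allV N) (λ y → f y * (p ^ (s ∸ size β) * ∑ (allV (size β))
        (λ e → ⟦ ¬? (e ≟V 0V) ⟧ * ⟦ y ≟V (x +V insert β e) ⟧))))
      ≡⟨ ∑-cong blocks (λ β → trans (∑-cong (allV N) (λ y → x∙yz≈y∙xz (f y) (p ^ (s ∸ size β)) _))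
          (trans (∑-*ˡ (allV N) (p ^ (s ∸ size β)) _) (cong (p ^ (s ∸ size β) *_) (per-block β)))) ⟩
    ∑ blocks (λ β → p ^ (s ∸ size β) * ∑ (allV (size β)) (λ e → ⟦ ¬? (e ≟V 0V) ⟧ * f (x +V insert β e))) ∎
    where
    open ≡-Reasoning
    expand : ∀ y → edgeMultiplicity (differences x y) ≡ ∑ blocks
        (λ β → p ^ (s ∸ size β) * ∑ (allV (size β)) (λ e → ⟦ ¬? (e ≟V 0V) ⟧ * ⟦ y ≟V (x +V insert β e) ⟧))
    expand y = trans (edgeMultiplicity-∑ (differences x y)) (∑-cong blocks λ β → cong (p ^ (s ∸ size β) *_)
        (single-difference x y β))
    pull′ : ∀ a b c → a * (b * c) ≡ b * (c * a)
    pull′ = solve-∀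
    per-block : ∀ β → ∑ (allV N) (λ y → f y * ∑ (allV (size β)) (λ e → ⟦ ¬? (e ≟V 0V) ⟧ * ⟦ y ≟V (x +V insert β e) ⟧))
                      ≡ ∑ (allV (size β)) (λ e → ⟦ ¬? (e ≟V 0V) ⟧ * f (x +V insert β e))
    per-block β = begin
      ∑ (allV N) (λ y → f y * ∑ (allV (size β)) (λ e → ⟦ ¬? (e ≟V 0V) ⟧ * ⟦ y ≟V (x +V insert β e) ⟧))
        ≡⟨ ∑-cong (allV N) (λ y → trans (sym (∑-*ˡ (allV (size β)) (f y) _))
            (∑-cong (allV (size β)) λ e → pull′ (f y) ⟦ ¬? (e ≟V 0V) ⟧ _)) ⟩
      ∑ (allV N) (λ y → ∑ (allV (size β)) (λ e → ⟦ ¬? (e ≟V 0V) ⟧ * (⟦ y ≟V (x +V insert β e) ⟧ * f y)))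
        ≡⟨ ∑-swap (allV N) (allV (size β)) _ ⟩
      ∑ (allV (size β)) (λ e → ∑ (allV N) (λ y → ⟦ ¬? (e ≟V 0V) ⟧ * (⟦ y ≟V (x +V insert β e) ⟧ * f y)))
        ≡⟨ ∑-cong (allV (size β)) (λ e → trans (∑-*ˡ (allV N) ⟦ ¬? (e ≟V 0V) ⟧ _)
            (cong (⟦ ¬? (e ≟V 0V) ⟧ *_) (allV.∑-delta (x +V insert β e) f))) ⟩
      ∑ (allV (size β)) (λ e → ⟦ ¬? (e ≟V 0V) ⟧ * f (x +V insert β e)) ∎

  size≤s : ∀ β → size β ≤ s
  size≤s (i , _) = Finₚ.toℕ<n i

  p^[s∸size]*p^size : ∀ β → p ^ (s ∸ size β) * p ^ size β ≡ p ^ s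
  p^[s∸size]*p^size β = trans (sym (^-distribˡ-+-* p (s ∸ size β) (size β))) (cong (p ^_) (m∸n+n≡m (size≤s β)))

  k-∑ : k ≡ ∑ blocks (λ β → p ^ s ∸ p ^ (s ∸ size β))
  k-∑ = sym (∑-blocks-size (λ i → p ^ s ∸ p ^ (s ∸ sizeOf i)))

  -- The multiplicity with which 0 is covered when all blocks have independent columns. It is also
  -- p^s (n₁/q₁ + ⋯ + n_s/q_s), which is how 1/q enters.
  σ : ℕ
  σ = ∑ blocks (λ β → p ^ (s ∸ size β))

  k+σ : k + σ ≡ #blocks * p ^ s
  k+σ = trans (cong (_+ σ) k-∑) (trans (sym (∑-+ blocks _ _))
      (trans (∑-cong blocks λ β → m∸n+n≡m (^-monoʳ-≤ p (m∸n≤m s (size β)))) (∑-blocks-const (p ^ s))))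

  0<k : .{{NonZero (n (fromℕ r))}} → 0 < k
  0<k = <-≤-trans (m<n⇒0<n∸m (^-monoʳ-< p (ℕ.nonTrivial⇒n>1 p {{prime⇒nonTrivial p-prime}})
      (∸-monoʳ-< {s} {size β} (s≤s z≤n) (size≤s β))))
                  (≤-trans (∑-member _ (allBlocks.member β)) (≤-reflexive (sym k-∑)))
    where
    β : Block
    β = fromℕ r , fromℕ< (ℕ.>-nonZero⁻¹ (n (fromℕ r)))

-- The rational parameters with denominators cleared, and the arithmetic relating them.

toℚᵘ-/ : ∀ a d .{{_ : NonZero d}} → toℚᵘ ((ℤ.+ a) / d) ℚᵘ.≃ (ℤ.+ a) ℚᵘ./ d
toℚᵘ-/ a (suc d) = ℚₚ.toℚᵘ-fromℚᵘ (ℚᵘ.mkℚᵘ (ℤ.+ a) d)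

/-*-cancel : ∀ a d .{{_ : NonZero d}} → ((ℤ.+ a) / d) ℚ.* ↑ d ≡ ↑ a
/-*-cancel a d@(suc _) = ℚₚ.toℚᵘ-injective (begin
  toℚᵘ (((ℤ.+ a) / d) ℚ.* ↑ d)          ≈⟨ ℚₚ.toℚᵘ-homo-* ((ℤ.+ a) / d) (↑ d) ⟩
  toℚᵘ ((ℤ.+ a) / d) ℚᵘ.* toℚᵘ (↑ d)    ≈⟨ ℚᵘₚ.*-cong (toℚᵘ-/ a d) (toℚᵘ-/ d 1) ⟩
  ((ℤ.+ a) ℚᵘ./ d) ℚᵘ.* ((ℤ.+ d) ℚᵘ./ 1)  ≈⟨ ℚᵘ.*≡* (rearrange (ℤ.+ a) (ℤ.+ d)) ⟩
  (ℤ.+ a) ℚᵘ./ 1                        ≈⟨ toℚᵘ-/ a 1 ⟨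
  toℚᵘ (↑ a)                          ∎)
  where
  open import Relation.Binary.Reasoning.Setoid ℚᵘₚ.≃-setoid
  rearrange : ∀ x y → (x ℤ.* y) ℤ.* (ℤ.+ 1) ≡ x ℤ.* (y ℤ.* (ℤ.+ 1))
  rearrange = ℤSolver.solve-∀

↑-+ : ∀ a b → ↑ (a + b) ≡ ↑ a ℚ.+ ↑ b
↑-+ a b = ℚₚ.toℚᵘ-injective (begin
  toℚᵘ (↑ (a + b))                    ≈⟨ toℚᵘ-/ (a + b) 1 ⟩
  (ℤ.+ (a + b)) ℚᵘ./ 1                  ≈⟨ ℚᵘ.*≡* (rearrange (ℤ.+ a) (ℤ.+ b)) ⟩
  ((ℤ.+ a) ℚᵘ./ 1) ℚᵘ.+ ((ℤ.+ b) ℚᵘ./ 1)  ≈⟨ ℚᵘₚ.+-cong (toℚᵘ-/ a 1) (toℚᵘ-/ b 1) ⟨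
  toℚᵘ (↑ a) ℚᵘ.+ toℚᵘ (↑ b)          ≈⟨ ℚₚ.toℚᵘ-homo-+ (↑ a) (↑ b) ⟨
  toℚᵘ (↑ a ℚ.+ ↑ b)                  ∎)
  where
  open import Relation.Binary.Reasoning.Setoid ℚᵘₚ.≃-setoid
  rearrange : ∀ x y → (x ℤ.+ y) ℤ.* (ℤ.+ 1) ≡ (x ℤ.* (ℤ.+ 1) ℤ.+ y ℤ.* (ℤ.+ 1)) ℤ.* (ℤ.+ 1)
  rearrange = ℤSolver.solve-∀

↑-* : ∀ a b → ↑ (a * b) ≡ ↑ a ℚ.* ↑ b
↑-* a b = ℚₚ.toℚᵘ-injective (begin
  toℚᵘ (↑ (a * b))                    ≈⟨ toℚᵘ-/ (a * b) 1 ⟩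
  (ℤ.+ (a * b)) ℚᵘ./ 1                  ≈⟨ ℚᵘ.*≡* (cong (ℤ._* (ℤ.+ 1)) (ℤₚ.pos-* a b)) ⟩
  ((ℤ.+ a) ℚᵘ./ 1) ℚᵘ.* ((ℤ.+ b) ℚᵘ./ 1)  ≈⟨ ℚᵘₚ.*-cong (toℚᵘ-/ a 1) (toℚᵘ-/ b 1) ⟨
  toℚᵘ (↑ a) ℚᵘ.* toℚᵘ (↑ b)          ≈⟨ ℚₚ.toℚᵘ-homo-* (↑ a) (↑ b) ⟨
  toℚᵘ (↑ a ℚ.* ↑ b)                  ∎)
  where open import Relation.Binary.Reasoning.Setoid ℚᵘₚ.≃-setoid

↑-injective : ∀ {a b} → ↑ a ≡ ↑ b → a ≡ b
↑-injective {a} {b} eq with ℚₚ./-injective-≃ (ℚᵘ.mkℚᵘ (ℤ.+ a) 0) (ℚᵘ.mkℚᵘ (ℤ.+ b) 0) eq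
... | ℚᵘ.*≡* a≡b = ℤₚ.+-injective (trans (sym (ℤₚ.*-identityʳ (ℤ.+ a))) (trans a≡b (ℤₚ.*-identityʳ (ℤ.+ b))))

*-↑-cancel : ∀ d .{{_ : NonZero d}} {x y} → x ℚ.* ↑ d ≡ y ℚ.* ↑ d → x ≡ y
*-↑-cancel d {x} {y} eq = begin
  x                                   ≡⟨ undo x ⟨
  x ℚ.* ↑ d ℚ.* ((ℤ.+ 1) / d)           ≡⟨ cong (ℚ._* ((ℤ.+ 1) / d)) eq ⟩
  y ℚ.* ↑ d ℚ.* ((ℤ.+ 1) / d)           ≡⟨ undo y ⟩
  y                                   ∎
  where
  open ≡-Reasoning
  undo : ∀ x → x ℚ.* ↑ d ℚ.* ((ℤ.+ 1) / d) ≡ x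
  undo x = trans (ℚₚ.*-assoc x (↑ d) _) (trans (cong (x ℚ.*_) (trans (ℚₚ.*-comm (↑ d) _) (/-*-cancel 1 d)))
      (ℚₚ.*-identityʳ x))

↑≡⇔ : ∀ {x A} D .{{_ : NonZero D}} → x ℚ.* ↑ D ≡ ↑ A → ∀ c → ↑ c ≡ x ⇔ c * D ≡ A
↑≡⇔ {x} {A} D xD≡A c = mk⇔
  (λ eq → ↑-injective (trans (↑-* c D) (trans (cong (ℚ._* ↑ D) eq) xD≡A)))
  (λ eq → *-↑-cancel D (trans (sym (↑-* c D)) (trans (cong ↑_ eq) (sym xD≡A))))

-- Here x stands for (A - E)/D. The term E stays on the left so that the resulting condition is an
-- equation between natural numbers.
↑≡-⇔ : ∀ {x D E A} .{{_ : NonZero D}} → x ℚ.* ↑ D ℚ.+ ↑ E ≡ ↑ A → ∀ c → ↑ c ≡ x ⇔ c * D + E ≡ A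
↑≡-⇔ {x} {D} {E} {A} eq c = mk⇔
  (λ c≡x → ↑-injective (trans (expand c) (trans (cong (λ z → z ℚ.* ↑ D ℚ.+ ↑ E) c≡x) eq)))
  (λ cD+E≡A → *-↑-cancel D (ℚ+.∙-cancelʳ (↑ E) _ _ (trans (sym (expand c)) (trans (cong ↑_ cD+E≡A) (sym eq)))))
  where
  module ℚ+ = AbelianGroupₚ ℚₚ.+-0-abelianGroup
  expand : ∀ c → ↑ (c * D + E) ≡ ↑ c ℚ.* ↑ D ℚ.+ ↑ E
  expand c = trans (↑-+ (c * D) E) (cong (ℚ._+ ↑ E) (↑-* c D))

Σℚ-scale : ∀ {t} (f : Fin t → ℚ) (g : Fin t → ℕ) d → (∀ i → f i ℚ.* ↑ d ≡ ↑ g i) → Σℚ f ℚ.* ↑ d ≡ ↑ Σℕ g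
Σℚ-scale {zero}  f g d eq = ℚₚ.*-zeroˡ (↑ d)
Σℚ-scale {suc t} f g d eq = trans (ℚₚ.*-distribʳ-+ (↑ d) (f zero) _)
  (trans (cong₂ ℚ._+_ (eq zero) (Σℚ-scale (f ∘ suc) (g ∘ suc) d (λ i → eq (suc i)))) (sym (↑-+ (g zero) _)))

Πℕ-^ : ∀ p {t} (f n : Fin t → ℕ) → Πℕ (λ i → (p ^ f i) ^ n i) ≡ p ^ Σℕ (λ i → n i * f i)
Πℕ-^ p {zero}  f n = refl
Πℕ-^ p {suc t} f n = trans (cong₂ _*_ (trans (^-*-assoc p (f zero) (n zero)) (cong (p ^_) (*-comm (f zero) (n zero))))
    (Πℕ-^ p (f ∘ suc) (n ∘ suc)))
  (sym (^-distribˡ-+-* p (n zero * f zero) _))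

module Parameter (p : ℕ) (p-prime : Prime p) (r m : ℕ) .{{_ : NonZero m}}
    (n : Fin (suc r) → ℕ) .{{_ : NonZero (n (fromℕ r))}} where

  open Blocks p p-prime r n
  open Parameters m
  open BlockStructure p p-prime r n

  private instance
    p≢0 : NonZero p
    p≢0 = prime⇒nonZero p-prime
    p^s≢0 : NonZero (p ^ s)
    p^s≢0 = m^n≢0 p s
    p^m-1≢0 : NonZero (p ^ m ∸ 1)
    p^m-1≢0 = p^m∸1≢0

  P : ℕ
  P = p ^ m ∸ 1

  D : ℕ
  D = P * p ^ s

  instance
    D≢0 : NonZero D
    D≢0 = m*n≢0 P (p ^ s)

  p^m≡1+P : p ^ m ≡ suc P
  p^m≡1+P = sym (m+[n∸m]≡n (ℕ.>-nonZero⁻¹ (p ^ m) {{m^n≢0 p m}}))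

  -- The equation w = μ p^(m-s) = k p^m / ((p^m - 1) p^s) without fractions. It makes sense whether
  -- or not the right-hand side is an integer.
  IsWeight : ℕ → Set
  IsWeight w = w * D ≡ k * p ^ m

  μ-scaled : μ ℚ.* ↑ P ≡ ↑ k
  μ-scaled = /-*-cancel k P

  ≡μ⇔ : ∀ c → ↑ c ≡ μ ⇔ c * P ≡ k
  ≡μ⇔ = ↑≡⇔ P μ-scaled

  weight-scaled : μ ℚ.* p^[m-s] ℚ.* ↑ D ≡ ↑ (k * p ^ m)
  weight-scaled = begin
    μ ℚ.* p^[m-s] ℚ.* ↑ D                        ≡⟨ cong (μ ℚ.* p^[m-s] ℚ.*_) (↑-* P (p ^ s)) ⟩
    μ ℚ.* p^[m-s] ℚ.* (↑ P ℚ.* ↑ (p ^ s))        ≡⟨ rearrange μ p^[m-s] (↑ P) (↑ (p ^ s)) ⟩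
    (μ ℚ.* ↑ P) ℚ.* (p^[m-s] ℚ.* ↑ (p ^ s))      ≡⟨ cong₂ ℚ._*_ μ-scaled (/-*-cancel (p ^ m) (p ^ s)) ⟩
    ↑ k ℚ.* ↑ (p ^ m)                            ≡⟨ ↑-* k (p ^ m) ⟨
    ↑ (k * p ^ m)                                ∎
    where
    open ≡-Reasoning
    open +-*-Solver
    rearrange : ∀ a b c d → a ℚ.* b ℚ.* (c ℚ.* d) ≡ (a ℚ.* c) ℚ.* (b ℚ.* d)
    rearrange = solve 4 (λ a b c d → a :* b :* (c :* d) := (a :* c) :* (b :* d)) refl

  ≡weight⇔ : ∀ w → ↑ w ≡ μ ℚ.* p^[m-s] ⇔ IsWeight w
  ≡weight⇔ = ↑≡⇔ D weight-scaled

  -- As ν = #blocks - μ p^(m-s), a count takes the value ν exactly when its complement in #blocks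
  -- takes the value μ p^(m-s).
  ≡ν⇔ : ∀ c w → #blocks ≡ w + c → ↑ c ≡ ν ⇔ IsWeight w
  ≡ν⇔ c w n≡w+c = mk⇔
    (λ eq → sym (+-cancelˡ-≡ (c * D) _ _ (trans (Equivalence.to cleared eq) split)))
    (λ eq → Equivalence.from cleared (trans (cong ((c * D) +_) (sym eq)) (sym split)))
    where
    open ≡-Reasoning
    open +-*-Solver
    rearrange : ∀ n y u d → (n ℚ.- y ℚ.* u) ℚ.* d ℚ.+ u ℚ.* y ℚ.* d ≡ n ℚ.* d
    rearrange = solve 4 (λ n y u d → (n :- y :* u) :* d :+ u :* y :* d := n :* d) refl
    ν-scaled : ν ℚ.* ↑ D ℚ.+ ↑ (k * p ^ m) ≡ ↑ (#blocks * D)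
    ν-scaled = begin
      ν ℚ.* ↑ D ℚ.+ ↑ (k * p ^ m)                   ≡⟨ cong (ν ℚ.* ↑ D ℚ.+_) weight-scaled ⟨
      ν ℚ.* ↑ D ℚ.+ μ ℚ.* p^[m-s] ℚ.* ↑ D           ≡⟨ rearrange (↑ #blocks) p^[m-s] μ (↑ D) ⟩
      ↑ #blocks ℚ.* ↑ D                             ≡⟨ ↑-* #blocks D ⟨
      ↑ (#blocks * D)                               ∎
    cleared : ↑ c ≡ ν ⇔ c * D + k * p ^ m ≡ #blocks * D
    cleared = ↑≡-⇔ ν-scaled c
    split : #blocks * D ≡ c * D + w * D
    split = trans (cong (_* D) (trans n≡w+c (+-comm w c))) (*-distribʳ-+ D c w)

  -- Since k = μ (p^m - 1), the sum μ + k is μ p^m, and so τ + 1 = μ p^(m-s): the strength is one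
  -- less than the weight.
  ≡τ⇔ : ∀ t → ↑ t ≡ τ ⇔ IsWeight (suc t)
  ≡τ⇔ t = mk⇔ (λ eq → trans (+-comm D (t * D)) (Equivalence.to cleared eq))
              (λ eq → Equivalence.from cleared (trans (+-comm (t * D) D) eq))
    where
    open ≡-Reasoning
    open +-*-Solver
    x : ℚ
    x = (ℤ.+ 1) / (p ^ s)
    rearrange : ∀ u k x P S → ((u ℚ.+ k) ℚ.* x ℚ.- 1ℚ) ℚ.* (P ℚ.* S) ℚ.+ P ℚ.* S ≡ (x ℚ.* S) ℚ.* (u ℚ.* P ℚ.+ k ℚ.* P)
    rearrange = solve 5 (λ u k x P S → ((u :+ k) :* x :- con 1ℚ) :* (P :* S) :+ P :* S := (x :* S) :*
        (u :* P :+ k :* P)) refl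
    τ-scaled : τ ℚ.* ↑ D ℚ.+ ↑ D ≡ ↑ (k * p ^ m)
    τ-scaled = begin
      τ ℚ.* ↑ D ℚ.+ ↑ D                                         ≡⟨ cong (λ z → τ ℚ.* z ℚ.+ z) (↑-* P (p ^ s)) ⟩
      τ ℚ.* (↑ P ℚ.* ↑ (p ^ s)) ℚ.+ ↑ P ℚ.* ↑ (p ^ s)           ≡⟨ rearrange μ (↑ k) x (↑ P) (↑ (p ^ s)) ⟩
      (x ℚ.* ↑ (p ^ s)) ℚ.* (μ ℚ.* ↑ P ℚ.+ ↑ k ℚ.* ↑ P)         ≡⟨ cong₂ (λ a b → a ℚ.* (b ℚ.+ ↑ k ℚ.* ↑ P))
          (/-*-cancel 1 (p ^ s)) μ-scaled ⟩
      1ℚ ℚ.* (↑ k ℚ.+ ↑ k ℚ.* ↑ P)                              ≡⟨ ℚₚ.*-identityˡ _ ⟩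
      ↑ k ℚ.+ ↑ k ℚ.* ↑ P                                       ≡⟨ cong (↑ k ℚ.+_) (↑-* k P) ⟨
      ↑ k ℚ.+ ↑ (k * P)                                         ≡⟨ ↑-+ k (k * P) ⟨
      ↑ (k + k * P)                                             ≡⟨ cong ↑_ (sym (trans (cong (k *_) p^m≡1+P) (*-suc k P))) ⟩
      ↑ (k * p ^ m)                                             ∎
    cleared : ↑ t ≡ τ ⇔ t * D + D ≡ k * p ^ m
    cleared = ↑≡-⇔ τ-scaled t

  #blocks≢0 : NonZero #blocks
  #blocks≢0 = ℕ.≢-nonZero λ #blocks≡0 → <⇒≢ 0<k (sym (m+n≡0⇒m≡0 k (trans k+σ (cong (_* p ^ s) #blocks≡0))))

  1/q-scaled : 1/q ℚ.* ↑ #blocks ℚ.* ↑ (p ^ s) ≡ ↑ σ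
  1/q-scaled = begin
    1/q ℚ.* ↑ #blocks ℚ.* ↑ (p ^ s)                     ≡⟨ rearrange ((ℤ.+ 1 / #blocks) {{#blocks≢0}}) sum (↑ #blocks)
        (↑ (p ^ s)) ⟩
    ((ℤ.+ 1 / #blocks) {{#blocks≢0}} ℚ.* ↑ #blocks) ℚ.* (sum ℚ.* ↑ (p ^ s)) ≡⟨ cong₂ ℚ._*_
        (/-*-cancel 1 #blocks {{#blocks≢0}}) sum-scaled ⟩
    1ℚ ℚ.* ↑ σ                                          ≡⟨ ℚₚ.*-identityˡ (↑ σ) ⟩
    ↑ σ                                                 ∎
    where
    open ≡-Reasoning
    open +-*-Solver
    rearrange : ∀ a b c d → a ℚ.* b ℚ.* c ℚ.* d ≡ (a ℚ.* c) ℚ.* (b ℚ.* d)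
    rearrange = solve 4 (λ a b c d → a :* b :* c :* d := (a :* c) :* (b :* d)) refl
    summand : Fin s → ℚ
    summand i = (ℤ.+ n i / q i) {{m^n≢0 p (sizeOf i)}}
    sum : ℚ
    sum = Σℚ summand
    term : ∀ i → summand i ℚ.* ↑ (p ^ s) ≡ ↑ (n i * p ^ (s ∸ sizeOf i))
    term i = begin
      summand i ℚ.* ↑ (p ^ s)
        ≡⟨ cong (λ e → summand i ℚ.* ↑ (p ^ e)) (m+[n∸m]≡n (Finₚ.toℕ<n i)) ⟨
      summand i ℚ.* ↑ (p ^ (sizeOf i + (s ∸ sizeOf i)))
        ≡⟨ cong (λ z → summand i ℚ.* z) (trans (cong ↑_ (^-distribˡ-+-* p (sizeOf i) (s ∸ sizeOf i)))
            (↑-* (q i) (p ^ (s ∸ sizeOf i)))) ⟩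
      summand i ℚ.* (↑ q i ℚ.* ↑ (p ^ (s ∸ sizeOf i)))
        ≡⟨ ℚₚ.*-assoc (summand i) (↑ q i) (↑ (p ^ (s ∸ sizeOf i))) ⟨
      summand i ℚ.* ↑ q i ℚ.* ↑ (p ^ (s ∸ sizeOf i))
        ≡⟨ cong (ℚ._* ↑ (p ^ (s ∸ sizeOf i))) (/-*-cancel (n i) (q i) {{m^n≢0 p (sizeOf i)}}) ⟩
      ↑ n i ℚ.* ↑ (p ^ (s ∸ sizeOf i))
        ≡⟨ ↑-* (n i) (p ^ (s ∸ sizeOf i)) ⟨
      ↑ (n i * p ^ (s ∸ sizeOf i)) ∎
    sum-scaled : sum ℚ.* ↑ (p ^ s) ≡ ↑ σ
    sum-scaled = trans (Σℚ-scale summand (λ i → n i * p ^ (s ∸ sizeOf i)) (p ^ s) term)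
      (cong ↑_ (sym (∑-blocks-size (λ i → p ^ (s ∸ sizeOf i)))))

  -- With |C| p^m = p^N, clearing denominators in the bound leaves (t + 1)(p^m - 1) p^s = k p^m.
  ≡bierbrauerFriedman⇔ : ∀ c → p ^ m * c ≡ p ^ N → ∀ t → ↑ c ≡ bierbrauerFriedman t ⇔ IsWeight (suc t)
  ≡bierbrauerFriedman⇔ c p^m*c≡p^N t = mk⇔ (λ eq → to (Equivalence.to cleared eq))
      (λ eq → Equivalence.from cleared (from eq))
    where
    open ≡-Reasoning
    Π S z : ℚ
    Π = ↑ Πℕ (λ i → q i ^ n i)
    S = ↑ (p ^ s)
    z = (ℤ.+ #blocks) / suc t
    T : ℚ
    T = ↑ suc t

    Π≡p^N : Πℕ (λ i → q i ^ n i) ≡ p ^ N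
    Π≡p^N = Πℕ-^ p sizeOf n

    open +-*-Solver
    step₁ : ∀ Π u z T S k → Π ℚ.* (1ℚ ℚ.- (1ℚ ℚ.- u) ℚ.* z) ℚ.* (T ℚ.* S) ℚ.+ Π ℚ.* k
                            ≡ Π ℚ.* (T ℚ.* S ℚ.- (z ℚ.* T) ℚ.* S ℚ.+ u ℚ.* (z ℚ.* T) ℚ.* S ℚ.+ k)
    step₁ = solve 6 (λ Π u z T S k → Π :* (con 1ℚ :- (con 1ℚ :- u) :* z) :* (T :* S) :+ Π :* k
                            := Π :* (T :* S :- (z :* T) :* S :+ u :* (z :* T) :* S :+ k)) refl
    step₂ : ∀ Π TS k σ → Π ℚ.* (TS ℚ.- (k ℚ.+ σ) ℚ.+ σ ℚ.+ k) ≡ Π ℚ.* TS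
    step₂ = solve 4 (λ Π TS k σ → Π :* (TS :- (k :+ σ) :+ σ :+ k) := Π :* TS) refl

    -- By `1/q-scaled` and `k+σ`, n (1 - 1/q) = k / p^s, so the bound equals p^N (1 - k / (p^s (t +
    -- 1))). It is multiplied by (t + 1) p^s here.
    scaled : bierbrauerFriedman t ℚ.* ↑ (suc t * p ^ s) ℚ.+ ↑ (p ^ N * k) ≡ ↑ (p ^ N * (suc t * p ^ s))
    scaled = begin
      bierbrauerFriedman t ℚ.* ↑ (suc t * p ^ s) ℚ.+ ↑ (p ^ N * k)
        ≡⟨ cong₂ (λ a b → bierbrauerFriedman t ℚ.* a ℚ.+ b) (↑-* (suc t) (p ^ s))
             (trans (↑-* (p ^ N) k) (cong (λ e → ↑ e ℚ.* ↑ k) (sym Π≡p^N))) ⟩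
      Π ℚ.* (1ℚ ℚ.- (1ℚ ℚ.- 1/q) ℚ.* z) ℚ.* (T ℚ.* S) ℚ.+ Π ℚ.* ↑ k
        ≡⟨ step₁ Π 1/q z T S (↑ k) ⟩
      Π ℚ.* (T ℚ.* S ℚ.- (z ℚ.* T) ℚ.* S ℚ.+ 1/q ℚ.* (z ℚ.* T) ℚ.* S ℚ.+ ↑ k)
        ≡⟨ cong (λ e → Π ℚ.* (T ℚ.* S ℚ.- e ℚ.* S ℚ.+ 1/q ℚ.* e ℚ.* S ℚ.+ ↑ k)) (/-*-cancel #blocks (suc t)) ⟩
      Π ℚ.* (T ℚ.* S ℚ.- ↑ #blocks ℚ.* S ℚ.+ 1/q ℚ.* ↑ #blocks ℚ.* S ℚ.+ ↑ k)
        ≡⟨ cong₂ (λ a b → Π ℚ.* (T ℚ.* S ℚ.- a ℚ.+ b ℚ.+ ↑ k))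
             (trans (sym (↑-* #blocks (p ^ s))) (trans (cong ↑_ (sym k+σ)) (↑-+ k σ))) 1/q-scaled ⟩
      Π ℚ.* (T ℚ.* S ℚ.- (↑ k ℚ.+ ↑ σ) ℚ.+ ↑ σ ℚ.+ ↑ k)
        ≡⟨ step₂ Π (T ℚ.* S) (↑ k) (↑ σ) ⟩
      Π ℚ.* (T ℚ.* S)
        ≡⟨ trans (↑-* (p ^ N) (suc t * p ^ s)) (cong₂ (λ e f → ↑ e ℚ.* f) (sym Π≡p^N) (↑-* (suc t) (p ^ s))) ⟨
      ↑ (p ^ N * (suc t * p ^ s)) ∎

    cleared : ↑ c ≡ bierbrauerFriedman t ⇔ c * (suc t * p ^ s) + p ^ N * k ≡ p ^ N * (suc t * p ^ s)
    cleared = ↑≡-⇔ {{m*n≢0 (suc t) (p ^ s)}} scaled c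

    c≢0 : NonZero c
    c≢0 = ℕ.≢-nonZero λ c≡0 → ℕ.≢-nonZero⁻¹ (p ^ N) {{m^n≢0 p N}}
        (trans (sym p^m*c≡p^N) (trans (cong (p ^ m *_) c≡0) (*-zeroʳ (p ^ m))))

    lhs rhs : ℕ
    lhs = suc t * D
    rhs = k * p ^ m

    -- Replacing p^N by p^m c makes c a common factor of the cleared equation. The summand c (t + 1)
    -- p^s present on both sides is the 1 in p^m = 1 + P.
    lhs-eq : c * (suc t * p ^ s) + c * rhs ≡ c * (suc t * p ^ s) + p ^ N * k
    lhs-eq = cong ((c * (suc t * p ^ s)) +_) (trans (shuffle c k (p ^ m)) (cong (_* k) p^m*c≡p^N))
      where
      shuffle : ∀ c k Q → c * (k * Q) ≡ Q * c * k
      shuffle = solve-∀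
    rhs-eq : c * (suc t * p ^ s) + c * lhs ≡ p ^ N * (suc t * p ^ s)
    rhs-eq = trans (shuffle c (suc t) (p ^ s) P) (cong (_* (suc t * p ^ s)) (trans (cong (_* c) (sym p^m≡1+P)) p^m*c≡p^N))
      where
      shuffle : ∀ c t S P → c * (t * S) + c * (t * (P * S)) ≡ suc P * c * (t * S)
      shuffle = solve-∀
    to : c * (suc t * p ^ s) + p ^ N * k ≡ p ^ N * (suc t * p ^ s) → lhs ≡ rhs
    to eq = *-cancelˡ-≡ lhs rhs c {{c≢0}} (+-cancelˡ-≡ (c * (suc t * p ^ s)) _ _
        (trans rhs-eq (trans (sym eq) (sym lhs-eq))))
    from : lhs ≡ rhs → c * (suc t * p ^ s) + p ^ N * k ≡ p ^ N * (suc t * p ^ s)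
    from eq = trans (sym lhs-eq) (trans (cong (λ e → c * (suc t * p ^ s) + c * e) (sym eq)) rhs-eq)

-- Pure arithmetic for the passage from φ to weights. The letters mean Q = p^m, S = p^s, w and g the
-- numbers of nonzero and zero blocks of the word of y, h the size of the hyperplane orthogonal to
-- y, and X the mass of φ on it. In signed form, π S w = p (n S - X) and X P = σ P + (h - 1) k; the
-- term added to both sides below absorbs the minus signs.
weight-from-covering : ∀ {p π Q P S n k σ g w X h} → p ≡ suc π → Q ≡ suc P → n ≡ w + g → k + σ ≡ n * S →
  p * X ≡ S * (n + π * g) → X * P + k ≡ σ * P + h * k → p * h ≡ Q → π * (w * (P * S)) ≡ π * (k * Q)
weight-from-covering {π = π} {P = P} {S} {k = k} {σ} {g} {w} {X} {h} refl refl refl kσ pX XP ph =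
  +-cancelˡ-≡ (suc π * (σ * P) + suc P * k) _ _ (begin
    suc π * (σ * P) + suc P * k + π * (w * (P * S))            ≡⟨ cong
        (λ z → suc π * (σ * P) + z * k + π * (w * (P * S))) ph ⟨
    suc π * (σ * P) + suc π * h * k + π * (w * (P * S))        ≡⟨ step₁ π σ P h k (π * (w * (P * S))) ⟩
    suc π * (σ * P + h * k) + π * (w * (P * S))                ≡⟨ cong (λ z → suc π * z + π * (w * (P * S))) XP ⟨
    suc π * (X * P + k) + π * (w * (P * S))                    ≡⟨ step₂ π X P k (π * (w * (P * S))) ⟩
    suc π * X * P + suc π * k + π * (w * (P * S))              ≡⟨ cong (λ z → z * P + suc π * k + π * (w * (P * S))) pX ⟩
    S * (w + g + π * g) * P + suc π * k + π * (w * (P * S))    ≡⟨ step₃ π S w g P k ⟩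
    suc π * (((w + g) * S) * P + k)                            ≡⟨ cong (λ z → suc π * (z * P + k)) kσ ⟨
    suc π * ((k + σ) * P + k)                                  ≡⟨ step₄ π k σ P ⟩
    suc π * (σ * P) + suc P * k + π * (k * suc P)              ∎)
  where
  open ≡-Reasoning
  step₁ : ∀ π σ P h k z → suc π * (σ * P) + suc π * h * k + z ≡ suc π * (σ * P + h * k) + z
  step₁ = solve-∀
  step₂ : ∀ π X P k z → suc π * (X * P + k) + z ≡ suc π * X * P + suc π * k + z
  step₂ = solve-∀
  step₃ : ∀ π S w g P k → S * (w + g + π * g) * P + suc π * k + π * (w * (P * S)) ≡ suc π * (((w + g) * S) * P + k)
  step₃ = solve-∀
  step₄ : ∀ π k σ P → suc π * ((k + σ) * P + k) ≡ suc π * (σ * P) + suc P * k + π * (k * suc P)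
  step₄ = solve-∀

-- The arithmetic of the way back. G and G⊥ are the sums of `zeros` over the whole space and over
-- the hyperplane orthogonal to v. In signed form G = n + (Q - 1) g and G⊥ = n + (h - 1) g, whence p
-- G⊥ - G = π (n - g) = π w.
covering-from-weight : ∀ {p π Q S n g w φ G G⊥ h} → p ≡ suc π → n ≡ w + g → Q * (π * φ) + S * G ≡ S * (p * G⊥) →
  G + g ≡ n + Q * g → G⊥ + g ≡ n + h * g → p * h ≡ Q → π * (Q * φ) ≡ π * (S * w)
covering-from-weight {π = π} {Q} {S} {g = g} {w} {φ} {G} {G⊥} {h} refl refl T Gg G⊥g ph =
  +-cancelˡ-≡ (S * (w + g + Q * g) + S * (suc π * g)) _ _ (begin
    S * (w + g + Q * g) + S * (suc π * g) + π * (Q * φ)   ≡⟨ cong (λ z → S * z + S * (suc π * g) + π * (Q * φ)) Gg ⟨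
    S * (G + g) + S * (suc π * g) + π * (Q * φ)           ≡⟨ step₁ S G g π Q φ ⟩
    Q * (π * φ) + S * G + S * g + S * (suc π * g)         ≡⟨ cong (λ z → z + S * g + S * (suc π * g)) T ⟩
    S * (suc π * G⊥) + S * g + S * (suc π * g)            ≡⟨ step₂ S G⊥ g π ⟩
    S * (suc π * (G⊥ + g)) + S * g                        ≡⟨ cong (λ z → S * (suc π * z) + S * g) G⊥g ⟩
    S * (suc π * (w + g + h * g)) + S * g                 ≡⟨ step₃ S π w g h ⟩
    S * (suc π * (w + g) + suc π * h * g) + S * g         ≡⟨ cong (λ z → S * (suc π * (w + g) + z * g) + S * g) ph ⟩
    S * (suc π * (w + g) + Q * g) + S * g                 ≡⟨ step₄ S π w g Q ⟩
    S * (w + g + Q * g) + S * (suc π * g) + π * (S * w)   ∎)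
  where
  open ≡-Reasoning
  step₁ : ∀ S G g π Q φ → S * (G + g) + S * (suc π * g) + π * (Q * φ) ≡ Q * (π * φ) + S * G + S * g + S * (suc π * g)
  step₁ = solve-∀
  step₂ : ∀ S G g π → S * (suc π * G) + S * g + S * (suc π * g) ≡ S * (suc π * (G + g)) + S * g
  step₂ = solve-∀
  step₃ : ∀ S π w g h → S * (suc π * (w + g + h * g)) + S * g ≡ S * (suc π * (w + g) + suc π * h * g) + S * g
  step₃ = solve-∀
  step₄ : ∀ S π w g Q → S * (suc π * (w + g) + Q * g) + S * g ≡ S * (w + g + Q * g) + S * (suc π * g) + π * (S * w)
  step₄ = solve-∀

-- Covering multiplicities and codeword weights as transforms of each other.

module CodeCounting (p : ℕ) (p-prime : Prime p) (r m : ℕ) .{{_ : NonZero m}}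
    (n : Fin (suc r) → ℕ) .{{_ : NonZero (n (fromℕ r))}}
    (H : LinearAlgebra.Matrix p p-prime m (Blocks.N p p-prime r n)) where

  open Blocks p p-prime r n
  open Parameters m
  open FiniteField p p-prime
  open VectorSpace p p-prime
  open BlockStructure p p-prime r n
  open Parameter p p-prime r m n

  private instance
    p≢0 : NonZero p
    p≢0 = prime⇒nonZero p-prime

  columns : (β : Block) → Matrix (size β) m
  columns β = tabulate λ l → lookup (transpose H) (coordinate β l)

  columns-unit : ∀ β → columns β ≡ tabulate (λ l → H · unit (coordinate β l))
  columns-unit β = Vecₚ.tabulate-cong λ l → lookup-transpose H (coordinate β l)

  ·-insert-columns : ∀ β e → H · insert β e ≡ combination e (columns β)
  ·-insert-columns β e = trans (·-insert H β e) (cong (combination e) (sym (columns-unit β)))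

  block-codeword : ∀ y β → block (combination y H) β ≡ columns β · y
  block-codeword y β = trans (Vecₚ.tabulate-cong λ l → begin
    lookup (combination y H) (coordinate β l)    ≡⟨ lookup-combination y H (coordinate β l) ⟩
    dot y (H · unit (coordinate β l))            ≡⟨ cong (dot y) (lookup-transpose H (coordinate β l)) ⟨
    dot y (lookup (transpose H) (coordinate β l)) ≡⟨ dot-comm y _ ⟩
    dot (lookup (transpose H) (coordinate β l)) y ∎) (Vecₚ.tabulate-∘ (λ row → dot row y)
        (λ l → lookup (transpose H) (coordinate β l)))
    where open ≡-Reasoning

  fibre : Block → V m → ℕ
  fibre β v = ∑ (allV (size β)) (λ a → ⟦ combination a (columns β) ≟V v ⟧)

  -- How often v is covered by the H_{i,j}, when each is listed as the family of all combinations of its generators.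
  φ : V m → ℕ
  φ v = ∑ blocks (λ β → p ^ (s ∸ size β) * fibre β v)

  -- This is at once the number of members of M⊥ containing y and the number of zero blocks of the
  -- codeword of y, which ties (v) to the weights.
  zeros : V m → ℕ
  zeros y = ∑ blocks (λ β → ⟦ (columns β · y) ≟V 0V ⟧)

  wt : V m → ℕ
  wt y = weight (combination y H)

  #blocks≡wt+zeros : ∀ y → #blocks ≡ wt y + zeros y
  #blocks≡wt+zeros y = sym (begin
    wt y + zeros y   ≡⟨ cong (_+ zeros y) (length-filter-∑ (differs? (combination y H) 0V) blocks) ⟩
    ∑ blocks (λ β → ⟦ differs? (combination y H) 0V β ⟧) + zeros y ≡⟨ ∑-+ blocks _ _ ⟨
    ∑ blocks (λ β → ⟦ differs? (combination y H) 0V β ⟧ + ⟦ (columns β · y) ≟V 0V ⟧)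
      ≡⟨ ∑-cong blocks (λ β → trans (cong (⟦ differs? (combination y H) 0V β ⟧ +_)
           (⟦⟧-cong ((columns β · y) ≟V 0V) (block (combination y H) β ≟V block 0V β)
             (λ eq → trans (block-codeword y β) (trans eq (sym (block-0 β))))
             (λ eq → trans (sym (block-codeword y β)) (trans eq (block-0 β)))))
           (⟦⟧-¬ (block (combination y H) β ≟V block 0V β))) ⟩
    ∑ blocks (λ _ → 1) ≡⟨ trans (∑-blocks-const 1) (*-identityʳ _) ⟩
    #blocks ∎)
    where open ≡-Reasoning

  zeros-0 : zeros 0V ≡ #blocks
  zeros-0 = trans (∑-cong blocks λ β → ⟦⟧-yes ((columns β · 0V) ≟V 0V) (·-0 (columns β)))
      (trans (∑-blocks-const 1) (*-identityʳ _))

  ∑-fibre : ∀ β (f : V m → ℕ) → ∑ (allV m) (λ v → f v * fibre β v) ≡ ∑ (allV (size β)) (λ a → f (combination a (columns β)))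
  ∑-fibre β f = begin
    ∑ (allV m) (λ v → f v * fibre β v)
      ≡⟨ ∑-cong (allV m) (λ v → sym (∑-*ˡ (allV (size β)) (f v) _)) ⟩
    ∑ (allV m) (λ v → ∑ (allV (size β)) (λ a → f v * ⟦ combination a (columns β) ≟V v ⟧))
      ≡⟨ ∑-swap (allV m) (allV (size β)) _ ⟩
    ∑ (allV (size β)) (λ a → ∑ (allV m) (λ v → f v * ⟦ combination a (columns β) ≟V v ⟧))
      ≡⟨ ∑-cong (allV (size β)) (λ a → trans (∑-cong (allV m) λ v → trans (*-comm (f v) _)
           (cong (_* f v) (⟦⟧-cong (combination a (columns β) ≟V v) (v ≟V combination a (columns β)) sym sym)))
           (allV.∑-delta (combination a (columns β)) f)) ⟩
    ∑ (allV (size β)) (λ a → f (combination a (columns β))) ∎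
    where open ≡-Reasoning

  ∑-φ : ∀ (f : V m → ℕ) → ∑ (allV m) (λ v → f v * φ v)
        ≡ ∑ blocks (λ β → p ^ (s ∸ size β) * ∑ (allV (size β)) (λ a → f (combination a (columns β))))
  ∑-φ f = begin
    ∑ (allV m) (λ v → f v * φ v)
      ≡⟨ ∑-cong (allV m) (λ v → trans (sym (∑-*ˡ blocks (f v) _))
          (∑-cong blocks λ β → x∙yz≈y∙xz (f v) (p ^ (s ∸ size β)) (fibre β v))) ⟩
    ∑ (allV m) (λ v → ∑ blocks (λ β → p ^ (s ∸ size β) * (f v * fibre β v)))
      ≡⟨ ∑-swap (allV m) blocks _ ⟩
    ∑ blocks (λ β → ∑ (allV m) (λ v → p ^ (s ∸ size β) * (f v * fibre β v)))
      ≡⟨ ∑-cong blocks (λ β → trans (∑-*ˡ (allV m) (p ^ (s ∸ size β)) _) (cong (p ^ (s ∸ size β) *_) (∑-fibre β f))) ⟩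
    ∑ blocks (λ β → p ^ (s ∸ size β) * ∑ (allV (size β)) (λ a → f (combination a (columns β)))) ∎
    where
    open ≡-Reasoning

  φ-total : ∑ (allV m) φ ≡ k + σ
  φ-total = begin
    ∑ (allV m) φ                       ≡⟨ ∑-cong (allV m) (λ v → *-identityˡ (φ v)) ⟨
    ∑ (allV m) (λ v → 1 * φ v)         ≡⟨ ∑-φ (λ _ → 1) ⟩
    ∑ blocks (λ β → p ^ (s ∸ size β) * ∑ (allV (size β)) (λ _ → 1))
      ≡⟨ ∑-cong blocks (λ β → trans (cong (p ^ (s ∸ size β) *_) (trans (∑V-const (size β) 1) (*-identityʳ _)))
          (p^[s∸size]*p^size β)) ⟩
    ∑ blocks (λ _ → p ^ s)             ≡⟨ ∑-blocks-const (p ^ s) ⟩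
    #blocks * p ^ s                    ≡⟨ k+σ ⟨
    k + σ                              ∎
    where open ≡-Reasoning

  -- A block contributes all of its mass p^s to the hyperplane if its columns are orthogonal to y,
  -- and a p-th of it otherwise. The factors p^(s - size β) make this the same for blocks of all
  -- sizes.
  φ-hyperplane : ∀ y → p * ∑ (allV m) (λ v → ⟦ dot v y Finₚ.≟ 0F ⟧ * φ v) ≡ p ^ s * (#blocks + π * zeros y)
  φ-hyperplane y = begin
    p * ∑ (allV m) (λ v → ⟦ dot v y Finₚ.≟ 0F ⟧ * φ v)
      ≡⟨ cong (p *_) (∑-φ (λ v → ⟦ dot v y Finₚ.≟ 0F ⟧)) ⟩
    p * ∑ blocks (λ β → p ^ (s ∸ size β) * ∑ (allV (size β)) (λ a → ⟦ dot (combination a (columns β)) y Finₚ.≟ 0F ⟧))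
      ≡⟨ ∑-*ˡ blocks p _ ⟨
    ∑ blocks (λ β → p * (p ^ (s ∸ size β) * ∑ (allV (size β)) (λ a → ⟦ dot (combination a (columns β)) y Finₚ.≟ 0F ⟧)))
      ≡⟨ ∑-cong blocks per-block ⟩
    ∑ blocks (λ β → p ^ s * (1 + π * ⟦ (columns β · y) ≟V 0V ⟧))
      ≡⟨ ∑-*ˡ blocks (p ^ s) _ ⟩
    p ^ s * ∑ blocks (λ β → 1 + π * ⟦ (columns β · y) ≟V 0V ⟧)
      ≡⟨ cong (p ^ s *_) (trans (∑-+ blocks _ _) (cong₂ _+_ (trans (∑-blocks-const 1) (*-identityʳ _)) (∑-*ˡ blocks π _))) ⟩
    p ^ s * (#blocks + π * zeros y) ∎
    where
    open ≡-Reasoning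
    per-block : ∀ β → p * (p ^ (s ∸ size β) * ∑ (allV (size β)) (λ a → ⟦ dot (combination a (columns β)) y Finₚ.≟ 0F ⟧))
                      ≡ p ^ s * (1 + π * ⟦ (columns β · y) ≟V 0V ⟧)
    per-block β = begin
      p * (p ^ (s ∸ size β) * ∑ (allV (size β)) (λ a → ⟦ dot (combination a (columns β)) y Finₚ.≟ 0F ⟧))
        ≡⟨ x∙yz≈y∙xz p (p ^ (s ∸ size β)) _ ⟩
      p ^ (s ∸ size β) * (p * ∑ (allV (size β)) (λ a → ⟦ dot (combination a (columns β)) y Finₚ.≟ 0F ⟧))
        ≡⟨ cong (λ z → p ^ (s ∸ size β) * (p * z)) (∑-cong (allV (size β)) λ a → cong (λ z → ⟦ z Finₚ.≟ 0F ⟧)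
            (combination-dot a (columns β) y)) ⟩
      p ^ (s ∸ size β) * (p * ∑ (allV (size β)) (λ a → ⟦ dot a (columns β · y) Finₚ.≟ 0F ⟧))
        ≡⟨ cong (p ^ (s ∸ size β) *_) (hyperplane-count (columns β · y)) ⟩
      p ^ (s ∸ size β) * (p ^ size β * (1 + π * ⟦ (columns β · y) ≟V 0V ⟧))
        ≡⟨ *-assoc (p ^ (s ∸ size β)) (p ^ size β) _ ⟨
      p ^ (s ∸ size β) * p ^ size β * (1 + π * ⟦ (columns β · y) ≟V 0V ⟧)
        ≡⟨ cong (_* (1 + π * ⟦ (columns β · y) ≟V 0V ⟧)) (p^[s∸size]*p^size β) ⟩
      p ^ s * (1 + π * ⟦ (columns β · y) ≟V 0V ⟧) ∎

  ∑-zeros : ∀ (f : V m → ℕ) → p ^ s * ∑ (allV m) (λ y → f y * zeros y)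
    ≡ ∑ blocks (λ β → p ^ (s ∸ size β) * (p ^ size β * ∑ (allV m) (λ y → ⟦ (columns β · y) ≟V 0V ⟧ * f y)))
  ∑-zeros f = begin
    p ^ s * ∑ (allV m) (λ y → f y * zeros y)
      ≡⟨ cong (p ^ s *_) (∑-cong (allV m) λ y → trans (sym (∑-*ˡ blocks (f y) _)) (∑-cong blocks λ β → *-comm (f y) _)) ⟩
    p ^ s * ∑ (allV m) (λ y → ∑ blocks (λ β → ⟦ (columns β · y) ≟V 0V ⟧ * f y))
      ≡⟨ cong (p ^ s *_) (∑-swap (allV m) blocks _) ⟩
    p ^ s * ∑ blocks (λ β → ∑ (allV m) (λ y → ⟦ (columns β · y) ≟V 0V ⟧ * f y))
      ≡⟨ ∑-*ˡ blocks (p ^ s) _ ⟨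
    ∑ blocks (λ β → p ^ s * ∑ (allV m) (λ y → ⟦ (columns β · y) ≟V 0V ⟧ * f y))
      ≡⟨ ∑-cong blocks (λ β → trans (cong (_* ∑ (allV m) (λ y → ⟦ (columns β · y) ≟V 0V ⟧ * f y))
          (sym (p^[s∸size]*p^size β))) (*-assoc (p ^ (s ∸ size β)) _ _)) ⟩
    ∑ blocks (λ β → p ^ (s ∸ size β) * (p ^ size β * ∑ (allV m) (λ y → ⟦ (columns β · y) ≟V 0V ⟧ * f y))) ∎
    where open ≡-Reasoning

  ∑-zeros-total : p ^ s * ∑ (allV m) zeros
    ≡ ∑ blocks (λ β → p ^ (s ∸ size β) * (p ^ size β * ∑ (allV m) (λ y → ⟦ (columns β · y) ≟V 0V ⟧)))
  ∑-zeros-total = trans (cong (p ^ s *_) (∑-cong (allV m) λ y → sym (*-identityˡ (zeros y)))) (trans (∑-zeros (λ _ → 1))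
    (∑-cong blocks λ β → cong (λ z → p ^ (s ∸ size β) * (p ^ size β * z)) (∑-cong (allV m) λ y → *-identityʳ _)))

  -- Rank-nullity summed over the blocks: a rank defect of H_β enlarges the fibre over 0 and the
  -- orthogonal space of H_β by the same factor.
  φ-0 : p ^ m * φ 0V ≡ p ^ s * ∑ (allV m) zeros
  φ-0 = begin
    p ^ m * φ 0V
      ≡⟨ ∑-*ˡ blocks (p ^ m) _ ⟨
    ∑ blocks (λ β → p ^ m * (p ^ (s ∸ size β) * fibre β 0V))
      ≡⟨ ∑-cong blocks (λ β → trans (x∙yz≈y∙xz (p ^ m) (p ^ (s ∸ size β)) (fibre β 0V))
          (cong (p ^ (s ∸ size β) *_) (Columns.kernel-count (columns β)))) ⟩
    ∑ blocks (λ β → p ^ (s ∸ size β) * (p ^ size β * ∑ (allV m) (λ y → ⟦ (columns β · y) ≟V 0V ⟧)))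
      ≡⟨ ∑-zeros-total ⟨
    p ^ s * ∑ (allV m) zeros ∎
    where
    open ≡-Reasoning

  -- The transform in the other direction, obtained as the weighted sum over all blocks of
  -- `fibre-identity` for the maps a ↦ H_β a.
  φ-inversion : ∀ v → p ^ m * (π * φ v) + p ^ s * ∑ (allV m) zeros ≡ p ^ s *
      (p * ∑ (allV m) (λ y → ⟦ dot y v Finₚ.≟ 0F ⟧ * zeros y))
  φ-inversion v = begin
    p ^ m * (π * φ v) + p ^ s * ∑ (allV m) zeros
      ≡⟨ cong₂ _+_ (trans (cong (p ^ m *_) (sym (∑-*ˡ blocks π _))) (sym (∑-*ˡ blocks (p ^ m) _))) ∑-zeros-total ⟩
    ∑ blocks (λ β → p ^ m * (π * (p ^ (s ∸ size β) * fibre β v))) + ∑ blocks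
        (λ β → p ^ (s ∸ size β) * (p ^ size β * cokernel β))
      ≡⟨ ∑-+ blocks _ _ ⟨
    ∑ blocks (λ β → p ^ m * (π * (p ^ (s ∸ size β) * fibre β v)) + p ^ (s ∸ size β) * (p ^ size β * cokernel β))
      ≡⟨ ∑-cong blocks (λ β → trans (factor (p ^ m) π (p ^ (s ∸ size β)) (fibre β v) (p ^ size β * cokernel β))
           (trans (cong (p ^ (s ∸ size β) *_) (Columns.fibre-identity (columns β) v))
               (pull (p ^ (s ∸ size β)) (p ^ size β) p _))) ⟩
    ∑ blocks (λ β → p * (p ^ (s ∸ size β) * (p ^ size β * ∑ (allV m)
        (λ y → ⟦ (columns β · y) ≟V 0V ⟧ * ⟦ dot y v Finₚ.≟ 0F ⟧))))
      ≡⟨ trans (∑-*ˡ blocks p _) (cong (p *_) (sym (∑-zeros (λ y → ⟦ dot y v Finₚ.≟ 0F ⟧)))) ⟩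
    p * (p ^ s * ∑ (allV m) (λ y → ⟦ dot y v Finₚ.≟ 0F ⟧ * zeros y))
      ≡⟨ x∙yz≈y∙xz p (p ^ s) _ ⟩
    p ^ s * (p * ∑ (allV m) (λ y → ⟦ dot y v Finₚ.≟ 0F ⟧ * zeros y)) ∎
    where
    open ≡-Reasoning
    cokernel : Block → ℕ
    cokernel β = ∑ (allV m) (λ y → ⟦ (columns β · y) ≟V 0V ⟧)
    factor : ∀ a b c d e → a * (b * (c * d)) + c * e ≡ c * (a * (b * d) + e)
    factor = solve-∀
    pull : ∀ a b c d → a * (b * (c * d)) ≡ c * (a * (b * d))
    pull = solve-∀

  fibre-0≥1 : ∀ β → 1 ≤ fibre β 0V
  fibre-0≥1 β = ≤-trans (≤-reflexive (sym (⟦⟧-yes (combination 0V (columns β) ≟V 0V) (combination-0 (columns β)))))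
                        (∑-member (λ a → ⟦ combination a (columns β) ≟V 0V ⟧) (allV.member 0V))

  σ≤φ-0 : σ ≤ φ 0V
  σ≤φ-0 = ∑-mono-≤ blocks λ β → ≤-trans (≤-reflexive (sym (*-identityʳ _))) (*-monoʳ-≤ (p ^ (s ∸ size β)) (fibre-0≥1 β))

  -- In the applications `u` is constantly 1 or the indicator of a hyperplane. The value `c` would
  -- be attained (∑ u - 1) times off 0; adding it once on the left avoids the subtraction.
  ∑-off-0 : ∀ {d} (u f : V d → ℕ) c → u 0V ≡ 1 → (∀ v → v ≢ 0V → f v ≡ c) →
            ∑ (allV d) (λ v → u v * f v) + c ≡ f 0V + ∑ (allV d) u * c
  ∑-off-0 {d} u f c u0≡1 const = begin
    ∑ (allV d) (λ v → u v * f v) + c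
      ≡⟨ cong (∑ (allV d) (λ v → u v * f v) +_) (allV.∑-delta {d} 0V (λ _ → c)) ⟨
    ∑ (allV d) (λ v → u v * f v) + ∑ (allV d) (λ v → ⟦ v ≟V 0V ⟧ * c)
      ≡⟨ ∑-+ (allV d) _ _ ⟨
    ∑ (allV d) (λ v → u v * f v + ⟦ v ≟V 0V ⟧ * c)
      ≡⟨ ∑-cong (allV d) pointwise ⟩
    ∑ (allV d) (λ v → ⟦ v ≟V 0V ⟧ * f v + u v * c)
      ≡⟨ ∑-+ (allV d) _ _ ⟩
    ∑ (allV d) (λ v → ⟦ v ≟V 0V ⟧ * f v) + ∑ (allV d) (λ v → u v * c)
      ≡⟨ cong₂ _+_ (allV.∑-delta 0V f) (∑-*ʳ (allV d) u c) ⟩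
    f 0V + ∑ (allV d) u * c ∎
    where
    open ≡-Reasoning
    pointwise : ∀ v → u v * f v + ⟦ v ≟V 0V ⟧ * c ≡ ⟦ v ≟V 0V ⟧ * f v + u v * c
    pointwise v with v ≟V 0V
    ... | yes refl = trans (cong₂ _+_ (trans (cong (_* f 0V) u0≡1) (*-identityˡ _)) (*-identityˡ c))
                           (cong₂ _+_ (sym (*-identityˡ (f 0V))) (sym (trans (cong (_* c) u0≡1) (*-identityˡ c))))
    ... | no v≢0   = trans (+-identityʳ _) (cong (u v *_) (const v v≢0))

  ∑-off-0′ : ∀ {d} (f : V d → ℕ) c → (∀ v → v ≢ 0V → f v ≡ c) → ∑ (allV d) f + c ≡ f 0V + p ^ d * c
  ∑-off-0′ {d} f c const = trans (cong (_+ c) (∑-cong (allV d) λ v → sym (*-identityˡ (f v))))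
    (trans (∑-off-0 (λ _ → 1) f c refl const) (cong (λ z → f 0V + z * c) (trans (∑V-const d 1) (*-identityʳ (p ^ d)))))

  ConstantWeight : Set
  ConstantWeight = ∀ y → y ≢ 0V → IsWeight (wt y)

  UniformCovering : Set
  UniformCovering = ∀ v → v ≢ 0V → φ v * P ≡ k

  private instance
    P≢0 : NonZero P
    P≢0 = p^m∸1≢0

  -- Uniformity accounts for exactly k of the total mass k + σ off 0, and what remains must sit at
  -- 0.
  φ-0≡σ : UniformCovering → φ 0V ≡ σ
  φ-0≡σ uniform = *-cancelʳ-≡ (φ 0V) σ P (+-cancelʳ-≡ (suc P * k) _ _ (begin
    φ 0V * P + suc P * k        ≡⟨ cong (λ z → φ 0V * P + z * k) p^m≡1+P ⟨
    φ 0V * P + p ^ m * k        ≡⟨ ∑-off-0′ (λ v → φ v * P) k uniform ⟨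
    ∑ (allV m) (λ v → φ v * P) + k ≡⟨ cong (_+ k) (trans (∑-*ʳ (allV m) φ P) (cong (_* P) φ-total)) ⟩
    (k + σ) * P + k             ≡⟨ rearrange k σ P ⟩
    σ * P + suc P * k           ∎))
    where
    open ≡-Reasoning
    rearrange : ∀ k σ P → (k + σ) * P + k ≡ σ * P + suc P * k
    rearrange = solve-∀

  hyperplane-size : ∀ {y : V m} → y ≢ 0V → p * ∑ (allV m) (λ v → ⟦ dot v y Finₚ.≟ 0F ⟧) ≡ p ^ m
  hyperplane-size y≢0 = dot-count y≢0 0F

  -- The mass of φ on the hyperplane orthogonal to y is evaluated twice: by uniformity together with
  -- φ(0) = σ, and by `φ-hyperplane`, which involves the zero blocks of the word of y.
  uniform⇒constantWeight : UniformCovering → ConstantWeight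
  uniform⇒constantWeight uniform y y≢0 = *-cancelˡ-≡ _ _ π {{π≢0}}
    (weight-from-covering {S = p ^ s} {#blocks} {k} {σ} {zeros y} {wt y} {X} {∑ (allV m) u} p≡1+π p^m≡1+P
        (#blocks≡wt+zeros y) k+σ (φ-hyperplane y) X-identity (hyperplane-size y≢0))
    where
    open ≡-Reasoning
    u : V m → ℕ
    u v = ⟦ dot v y Finₚ.≟ 0F ⟧
    X : ℕ
    X = ∑ (allV m) (λ v → u v * φ v)
    X-identity : X * P + k ≡ σ * P + ∑ (allV m) u * k
    X-identity = begin
      X * P + k ≡⟨ cong (_+ k) (trans (sym (∑-*ʳ (allV m) _ P)) (∑-cong (allV m) λ v → *-assoc (u v) (φ v) P)) ⟩
      ∑ (allV m) (λ v → u v * (φ v * P)) + k ≡⟨ ∑-off-0 u (λ v → φ v * P) k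
          (⟦⟧-yes (dot 0V y Finₚ.≟ 0F) (dot-0ˡ y)) uniform ⟩
      φ 0V * P + ∑ (allV m) u * k ≡⟨ cong (λ z → z * P + ∑ (allV m) u * k) (φ-0≡σ uniform) ⟩
      σ * P + ∑ (allV m) u * k ∎

  -- With equal weights `zeros` is constant off 0 and equals #blocks at 0, so both sums in
  -- `φ-inversion` have explicit values; they leave p^m φ(v) = p^s wt v.
  constantWeight⇒uniform : ConstantWeight → UniformCovering
  constantWeight⇒uniform constant v v≢0 = *-cancelʳ-≡ (φ v * P) k (p ^ m) {{m^n≢0 p m}} (begin
    φ v * P * p ^ m        ≡⟨ step₁ (φ v) P (p ^ m) ⟩
    P * (p ^ m * φ v)      ≡⟨ cong (P *_) p^m*φ ⟩
    P * (p ^ s * wt v)     ≡⟨ step₂ P (p ^ s) (wt v) ⟩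
    wt v * (P * p ^ s)     ≡⟨ constant v v≢0 ⟩
    k * p ^ m              ∎)
    where
    open ≡-Reasoning
    step₁ : ∀ a b c → a * b * c ≡ b * (c * a)
    step₁ = solve-∀
    step₂ : ∀ a b c → a * (b * c) ≡ c * (a * b)
    step₂ = solve-∀
    u : V m → ℕ
    u y = ⟦ dot y v Finₚ.≟ 0F ⟧
    same-zeros : ∀ y → y ≢ 0V → zeros y ≡ zeros v
    same-zeros y y≢0 = +-cancelˡ-≡ (wt v) _ _ (begin
      wt v + zeros y ≡⟨ cong (_+ zeros y) (*-cancelʳ-≡ (wt v) (wt y)
          (P * p ^ s) {{m*n≢0 P (p ^ s) {{p^m∸1≢0}} {{m^n≢0 p s}}}} (trans (constant v v≢0) (sym (constant y y≢0)))) ⟩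
      wt y + zeros y ≡⟨ #blocks≡wt+zeros y ⟨
      #blocks        ≡⟨ #blocks≡wt+zeros v ⟩
      wt v + zeros v ∎)
    p^m*φ : p ^ m * φ v ≡ p ^ s * wt v
    p^m*φ = *-cancelˡ-≡ _ _ π {{π≢0}}
        (covering-from-weight {Q = p ^ m} {p ^ s} {#blocks} {zeros v} {wt v} {φ v} {h = ∑ (allV m) u} p≡1+π
        (#blocks≡wt+zeros v) (φ-inversion v)
      (trans (∑-off-0′ zeros (zeros v) same-zeros) (cong (_+ p ^ m * zeros v) zeros-0))
      (trans (∑-off-0 u zeros (zeros v) (⟦⟧-yes (dot 0V v Finₚ.≟ 0F) (dot-0ˡ v)) same-zeros)
          (cong (_+ ∑ (allV m) u * zeros v) zeros-0))
      (hyperplane-size v≢0))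

  ∑-nonzero : ∑ (allV m) (λ y → ⟦ ¬? (y ≟V 0V) ⟧) ≡ P
  ∑-nonzero = suc-injective (begin
    suc (∑ (allV m) (λ y → ⟦ ¬? (y ≟V 0V) ⟧))   ≡⟨ +-comm 1 _ ⟩
    ∑ (allV m) (λ y → ⟦ ¬? (y ≟V 0V) ⟧) + 1     ≡⟨ cong (∑ (allV m) (λ y → ⟦ ¬? (y ≟V 0V) ⟧) +_) (allV.once {m} 0V) ⟨
    ∑ (allV m) (λ y → ⟦ ¬? (y ≟V 0V) ⟧) + ∑ (allV m) (λ y → ⟦ y ≟V 0V ⟧) ≡⟨ ∑-+ (allV m) _ _ ⟨
    ∑ (allV m) (λ y → ⟦ ¬? (y ≟V 0V) ⟧ + ⟦ y ≟V 0V ⟧) ≡⟨ ∑-cong (allV m) (λ y → ⟦⟧-¬ (y ≟V 0V)) ⟩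
    ∑ (allV m) (λ _ → 1)                        ≡⟨ trans (∑V-const m 1) (*-identityʳ _) ⟩
    p ^ m                                       ≡⟨ p^m≡1+P ⟩
    suc P                                       ∎)
    where open ≡-Reasoning

  ⟦¬0⟧-≤ : ∀ {c d} (y : V m) → (y ≢ 0V → c ≤ d) → ⟦ ¬? (y ≟V 0V) ⟧ * c ≤ d
  ⟦¬0⟧-≤ {c} y c≤d with y ≟V 0V
  ... | yes _  = z≤n
  ... | no y≢0 = ≤-trans (≤-reflexive (*-identityˡ c)) (c≤d y≢0)

  -- The average weight of the nonzero words of C⊥ is at most w.
  minimumWeight⇒constantWeight : ∀ w → IsWeight w → (∀ y → y ≢ 0V → w ≤ wt y) → ConstantWeight
  minimumWeight⇒constantWeight w w≡ w≤wt y y≢0 = trans (cong (_* (P * p ^ s)) (sym w≡wt)) w≡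
    where
    open ≤-Reasoning
    f : V m → ℕ
    f y = ⟦ ¬? (y ≟V 0V) ⟧ * w
    rearrange : ∀ a b c → a * b * c ≡ b * (a * c)
    rearrange = solve-∀
    -- Since φ(0) ≥ σ, `φ-0` bounds the sum of `zeros` from below, hence the sum of the weights from
    -- above by p^m k / p^s. By `IsWeight` this is P w, the sum obtained if all P nonzero y had
    -- weight w.
    ∑wt≤ : p ^ s * ∑ (allV m) wt ≤ p ^ s * ∑ (allV m) f
    ∑wt≤ = +-cancelʳ-≤ (p ^ m * σ) _ _ (begin
      p ^ s * ∑ (allV m) wt + p ^ m * σ                     ≤⟨ +-monoʳ-≤ (p ^ s * ∑ (allV m) wt) (*-monoʳ-≤ (p ^ m) σ≤φ-0) ⟩
      p ^ s * ∑ (allV m) wt + p ^ m * φ 0V                  ≡⟨ cong (p ^ s * ∑ (allV m) wt +_) φ-0 ⟩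
      p ^ s * ∑ (allV m) wt + p ^ s * ∑ (allV m) zeros      ≡⟨ *-distribˡ-+ (p ^ s) _ _ ⟨
      p ^ s * (∑ (allV m) wt + ∑ (allV m) zeros)            ≡⟨ cong (p ^ s *_)
          (trans (sym (∑-+ (allV m) wt zeros)) (trans (∑-cong (allV m) λ y → sym (#blocks≡wt+zeros y))
          (∑V-const m #blocks))) ⟩
      p ^ s * (p ^ m * #blocks)                             ≡⟨ rearrange′ (p ^ s) (p ^ m) #blocks ⟩
      p ^ m * (#blocks * p ^ s)                             ≡⟨ cong (p ^ m *_) k+σ ⟨
      p ^ m * (k + σ)                                       ≡⟨ *-distribˡ-+ (p ^ m) k σ ⟩
      p ^ m * k + p ^ m * σ                                 ≡⟨ cong (_+ p ^ m * σ)
          (trans (*-comm (p ^ m) k) (trans (sym w≡) (rearrange″ w P (p ^ s)))) ⟩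
      p ^ s * (P * w) + p ^ m * σ                           ≡⟨ cong (λ z → p ^ s * (z * w) + p ^ m * σ) ∑-nonzero ⟨
      p ^ s * (∑ (allV m) (λ y → ⟦ ¬? (y ≟V 0V) ⟧) * w) + p ^ m * σ ≡⟨ cong (λ z → p ^ s * z + p ^ m * σ)
          (∑-*ʳ (allV m) _ w) ⟨
      p ^ s * ∑ (allV m) f + p ^ m * σ ∎)
      where
      rearrange′ : ∀ a b c → a * (b * c) ≡ b * (c * a)
      rearrange′ = solve-∀
      rearrange″ : ∀ a b c → a * (b * c) ≡ c * (b * a)
      rearrange″ = solve-∀
    w≡wt : w ≡ wt y
    w≡wt = trans (sym (trans (cong (_* w) (⟦⟧-yes (¬? (y ≟V 0V)) y≢0)) (*-identityˡ w)))
      (∑-tight {xs = allV m} {f = f} {g = wt} (λ y → ⟦¬0⟧-≤ y (w≤wt y)) (*-cancelˡ-≤ (p ^ s) {{m^n≢0 p s}} ∑wt≤)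
          (allV.member y))

  -- Each fibre over 0 contains the zero combination, so φ(0) ≥ σ holds block by block; equality of
  -- the totals forces every such fibre to be trivial.
  uniform⇒injective : UniformCovering → ∀ β → LinearlyIndependent (columns β)
  uniform⇒injective uniform β = kernel≡1⇒injective (λ a → combination a (columns β)) (≤-reflexive fibre≡1)
      (combination-0 (columns β))
    where
    fibre≡1 : fibre β 0V ≡ 1
    fibre≡1 = sym (*-cancelˡ-≡ 1 (fibre β 0V) (p ^ (s ∸ size β)) {{m^n≢0 p (s ∸ size β)}} (trans (*-identityʳ _)
      (∑-tight {xs = blocks} {f = λ β → p ^ (s ∸ size β)} {g = λ β → p ^ (s ∸ size β) * fibre β 0V}
        (λ β → ≤-trans (≤-reflexive (sym (*-identityʳ _))) (*-monoʳ-≤ (p ^ (s ∸ size β)) (fibre-0≥1 β)))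
        (≤-reflexive (φ-0≡σ uniform)) (allBlocks.member β))))

-- Projections of words onto t chosen blocks.

prefix-index : ∀ {A : Set} {x : A} (xs ys : List A) → x ∈ xs →
               ∃ λ j → toℕ j < length xs × List.lookup (xs List.++ ys) j ≡ x
prefix-index (_ ∷ xs) ys (here refl)  = zero , s≤s z≤n , refl
prefix-index (_ ∷ xs) ys (there x∈xs) with prefix-index xs ys x∈xs
... | j , j< , eq = suc j , s≤s j< , eq

module _ {A : Set} {xs : List A} {_≟_ : DecidableEquality A} (enum : Enumerates xs _≟_) where

  lookup-injective : Injective _≡_ _≡_ (List.lookup xs)
  lookup-injective {i} {j} eq = Enumerates.∑≡1⇒unique (allFin-enumerates (length xs))
      (λ l → List.lookup xs l ≟ List.lookup xs j)
    (≤-reflexive (begin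
      ∑ (allFin (length xs)) (λ l → ⟦ List.lookup xs l ≟ List.lookup xs j ⟧)
        ≡⟨ ∑-tabulate {n = length xs} (λ l → l) (λ l → ⟦ List.lookup xs l ≟ List.lookup xs j ⟧) ⟩
      Σℕ (λ l → ⟦ List.lookup xs l ≟ List.lookup xs j ⟧)
        ≡⟨ ∑-tabulate (List.lookup xs) (λ x → ⟦ x ≟ List.lookup xs j ⟧) ⟨
      ∑ (List.tabulate (List.lookup xs)) (λ x → ⟦ x ≟ List.lookup xs j ⟧)
        ≡⟨ cong (λ ys → ∑ ys (λ x → ⟦ x ≟ List.lookup xs j ⟧)) (Listₚ.tabulate-lookup xs) ⟩
      ∑ xs (λ x → ⟦ x ≟ List.lookup xs j ⟧)
        ≡⟨ Enumerates.once enum (List.lookup xs j) ⟩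
      1 ∎)) eq refl
    where open ≡-Reasoning

module _ {A : Set} {xs : List A} {_≟_ : DecidableEquality A} (enum : Enumerates xs _≟_) {Q : Pred A 0ℓ}
    (Q? : Decidable Q) where

  private
    sorted : List A
    sorted = filter Q? xs List.++ filter (¬? ∘ Q?) xs

    ∑-sorted : ∀ f → ∑ sorted f ≡ ∑ xs f
    ∑-sorted f = trans (∑-++ (filter Q? xs) _ f) (trans (cong₂ _+_ (∑-filter Q? xs f) (∑-filter (¬? ∘ Q?) xs f))
      (trans (sym (∑-+ xs _ _)) (∑-cong xs λ x → trans (sym (*-distribʳ-+ (f x) ⟦ Q? x ⟧ _))
        (trans (cong (_* f x) (trans (+-comm ⟦ Q? x ⟧ _) (⟦⟧-¬ (Q? x)))) (*-identityˡ (f x))))))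

    sorted-enumerates : Enumerates sorted _≟_
    sorted-enumerates .Enumerates.once a = trans (∑-sorted _) (Enumerates.once enum a)

    length-sorted : length sorted ≡ length xs
    length-sorted = trans (sym (trans (∑-const sorted 1) (*-identityʳ _)))
        (trans (∑-sorted (λ _ → 1)) (trans (∑-const xs 1) (*-identityʳ _)))

  -- In `sorted` the elements satisfying `Q` come first, so its first t entries are distinct and
  -- include all of them; the rest is padding up to exactly t.
  choose-containing : ∀ {t} → length (filter Q? xs) ≤ t → t ≤ length xs →
                      ∃ λ (T : Fin t → A) → Injective _≡_ _≡_ T × (∀ a → Q a → ∃ λ j → T j ≡ a)
  choose-containing {t} few t≤ = (λ j → List.lookup sorted (inject≤ j t≤′))
    , (λ eq → Finₚ.inject≤-injective t≤′ t≤′ _ _ (lookup-injective sorted-enumerates eq))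
    , covers
    where
    t≤′ : t ≤ length sorted
    t≤′ = ≤-trans t≤ (≤-reflexive (sym length-sorted))
    covers : ∀ a → Q a → ∃ λ j → List.lookup sorted (inject≤ j t≤′) ≡ a
    covers a Qa with prefix-index (filter Q? xs) (filter (¬? ∘ Q?) xs) (∈-filter⁺ Q? (Enumerates.member enum a) Qa)
    ... | j , j< , eq = j′ , trans (cong (List.lookup sorted)
        (Finₚ.toℕ-injective (trans (Finₚ.toℕ-inject≤ j′ t≤′) (Finₚ.toℕ-fromℕ< j<t)))) eq
      where
      j<t : toℕ j < t
      j<t = ≤-trans j< few
      j′ : Fin t
      j′ = fromℕ< j<t

module Projections (p : ℕ) (p-prime : Prime p) (r : ℕ) (n : Fin (suc r) → ℕ) where

  open Blocks p p-prime r n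
  open FiniteField p p-prime
  open VectorSpace p p-prime
  open BlockStructure p p-prime r n

  dim : ∀ {t} → (Fin t → Block) → ℕ
  dim {zero}  T = 0
  dim {suc t} T = size (T zero) + dim (T ∘ suc)

  -- The projection onto the blocks of T as a matrix, so that it can be stacked under H and the
  -- general fibre counts apply.
  rows : ∀ {t} (T : Fin t → Block) → Matrix (dim T) N
  rows {zero}  T = []
  rows {suc t} T = unitRows (T zero) Vec.++ rows (T ∘ suc)

  target : ∀ {t} (T : Fin t → Block) → (∀ j → V (size (T j))) → V (dim T)
  target {zero}  T a = []
  target {suc t} T a = a zero Vec.++ target (T ∘ suc) (λ j → a (suc j))

  rows-· : ∀ {t} (T : Fin t → Block) x → rows T · x ≡ target T (λ j → block x (T j))
  rows-· {zero}  T x = refl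
  rows-· {suc t} T x = trans (Vecₚ.map-++ _ (unitRows (T zero)) (rows (T ∘ suc)))
      (cong₂ Vec._++_ (unitRows-· (T zero) x) (rows-· (T ∘ suc) x))

  target-injective : ∀ {t} (T : Fin t → Block) {a b} → target T a ≡ target T b → ∀ j → a j ≡ b j
  target-injective {suc t} T {a} {b} eq zero    = Vecₚ.++-injectiveˡ (a zero) (b zero) eq
  target-injective {suc t} T {a} {b} eq (suc j) = target-injective (T ∘ suc) (Vecₚ.++-injectiveʳ (a zero) (b zero) eq) j

  target-cong : ∀ {t} (T : Fin t → Block) {a b} → (∀ j → a j ≡ b j) → target T a ≡ target T b
  target-cong {zero}  T eq = refl
  target-cong {suc t} T eq = cong₂ Vec._++_ (eq zero) (target-cong (T ∘ suc) (λ j → eq (suc j)))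

  target-surjective : ∀ {t} (T : Fin t → Block) z → ∃ λ a → target T a ≡ z
  target-surjective {zero}  T [] = (λ ()) , refl
  target-surjective {suc t} T z with Vec.splitAt (size (T zero)) z
  ... | z₁ , z₂ , refl with target-surjective (T ∘ suc) z₂
  ...   | a , refl = (λ { zero → z₁ ; (suc j) → a j }) , refl

  0V-++ : ∀ d e → 0V {d} Vec.++ 0V {e} ≡ 0V
  0V-++ zero    e = refl
  0V-++ (suc d) e = cong (0F ∷_) (0V-++ d e)

  target-0 : ∀ {t} (T : Fin t → Block) → target T (λ _ → 0V) ≡ 0V
  target-0 {zero}  T = refl
  target-0 {suc t} T = trans (cong (0V Vec.++_) (target-0 (T ∘ suc))) (0V-++ (size (T zero)) (dim (T ∘ suc)))

  -- The adjoint of the projection: for injective T, the word with the prescribed blocks on T and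
  -- zeros elsewhere.
  placed : ∀ {t} (T : Fin t → Block) → (∀ j → V (size (T j))) → Word
  placed T a = combination (target T a) (rows T)

  block-placed-suc : ∀ {t} (T : Fin (suc t) → Block) a β →
    block (placed T a) β ≡ block (insert (T zero) (a zero)) β +V block (placed (T ∘ suc) (λ j → a (suc j))) β
  block-placed-suc T a β = trans (cong (λ z → block z β) (combination-++ (a zero) _ (unitRows (T zero)) _))
      (block-+ (insert (T zero) (a zero)) _ β)

  block-placed-outside : ∀ {t} (T : Fin t → Block) a β → (∀ j → T j ≢ β) → block (placed T a) β ≡ 0V
  block-placed-outside {zero}  T a β out = block-0 β
  block-placed-outside {suc t} T a β out = trans (block-placed-suc T a β) (trans
    (cong₂ _+V_ (block-insert-other (T zero) (a zero) β (out zero))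
        (block-placed-outside (T ∘ suc) (λ j → a (suc j)) β (λ j → out (suc j))))
    (V+.identityˡ 0V))

  block-placed-inside : ∀ {t} (T : Fin t → Block) → Injective _≡_ _≡_ T → ∀ a j → block (placed T a) (T j) ≡ a j
  block-placed-inside T inj a zero = trans (block-placed-suc T a (T zero)) (trans
    (cong₂ _+V_ (block-insert-same (T zero) (a zero)) (block-placed-outside (T ∘ suc) (λ j → a (suc j))
        (T zero) λ j eq → contradiction (inj eq) λ ()))
    (V+.identityʳ _))
  block-placed-inside T inj a (suc j) = trans (block-placed-suc T a (T (suc j))) (trans
    (cong₂ _+V_ (block-insert-other (T zero) (a zero) (T (suc j)) λ eq → contradiction (inj eq) λ ())
                (block-placed-inside (T ∘ suc) (λ eq → Finₚ.suc-injective (inj eq)) (λ j → a (suc j)) j))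
    (V+.identityˡ _))

  p^dim : ∀ {t} (T : Fin t → Block) → p ^ dim T ≡ alphabetProduct T
  p^dim {zero}  T = refl
  p^dim {suc t} T = trans (^-distribˡ-+-* p (size (T zero)) (dim (T ∘ suc))) (cong (p ^ size (T zero) *_) (p^dim (T ∘ suc)))

  VanishesOutside : ∀ {t} → (Fin t → Block) → Word → Set
  VanishesOutside T x = ∀ β → (∀ j → T j ≢ β) → block x β ≡ 0V

  placed-blocks : ∀ {t} (T : Fin t → Block) → Injective _≡_ _≡_ T → ∀ x → VanishesOutside T x → placed T
      (λ j → block x (T j)) ≡ x
  placed-blocks T inj x vanishes = word-ext at
    where
    at : ∀ β → block (placed T (λ j → block x (T j))) β ≡ block x β
    at β with Finₚ.any? (λ j → T j ≟B β)
    ... | yes (j , refl) = block-placed-inside T inj _ j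
    ... | no none        = trans (block-placed-outside T _ β λ j eq → none (j , eq))
        (sym (vanishes β λ j eq → none (j , eq)))

  weight-≤ : ∀ {t} (T : Fin t → Block) x → VanishesOutside T x → weight x ≤ t
  weight-≤ {t} T x vanishes = begin
    weight x                                                   ≡⟨ length-filter-∑ (differs? x 0V) blocks ⟩
    ∑ blocks (λ β → ⟦ differs? x 0V β ⟧)                       ≤⟨ ∑-mono-≤ blocks pointwise ⟩
    ∑ blocks (λ β → ∑ (allFin t) (λ j → ⟦ β ≟B T j ⟧))         ≡⟨ ∑-swap blocks (allFin t) _ ⟩
    ∑ (allFin t) (λ j → ∑ blocks (λ β → ⟦ β ≟B T j ⟧))         ≡⟨ ∑-cong (allFin t) (λ j → allBlocks.once (T j)) ⟩
    ∑ (allFin t) (λ _ → 1)                                     ≡⟨ trans (∑-const (allFin t) 1) (*-identityʳ _) ⟩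
    length (allFin t)                                          ≡⟨ Listₚ.length-tabulate {n = t} (λ j → j) ⟩
    t                                                          ∎
    where
    open ≤-Reasoning
    pointwise : ∀ β → ⟦ differs? x 0V β ⟧ ≤ ∑ (allFin t) (λ j → ⟦ β ≟B T j ⟧)
    pointwise β with Finₚ.any? (λ j → T j ≟B β)
    ... | yes (j , refl) = ≤-trans (⟦⟧≤1 (differs? x 0V β)) (≤-trans (≤-reflexive (sym (⟦⟧-yes (β ≟B T j) refl)))
                             (∑-member (λ j → ⟦ β ≟B T j ⟧) (Enumerates.member (allFin-enumerates t) j)))
    ... | no none        = ≤-trans (≤-reflexive (⟦⟧-no (differs? x 0V β) λ ≢ → ≢
        (trans (vanishes β λ j eq → none (j , eq)) (sym (block-0 β))))) z≤n

  length-blocks : length blocks ≡ #blocks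
  length-blocks = trans (sym (trans (∑-const blocks 1) (*-identityʳ _))) (trans (∑-blocks-const 1) (*-identityʳ _))

  -- A converse to `weight-≤`. Strength t is a statement about exactly t coordinates, so a smaller
  -- support has to be padded, for which t ≤ #blocks is required.
  choose-support : ∀ {t} x → weight x ≤ t → t ≤ #blocks → ∃ λ (T : Fin t → Block) → Injective _≡_ _≡_ T × VanishesOutside T x
  choose-support {t} x few t≤ = proj₁ chosen , proj₁ (proj₂ chosen) , vanishes
    where
    Differs : Pred Block 0ℓ
    Differs β = block x β ≢ block 0V β
    chosen : ∃ λ (T : Fin t → Block) → Injective _≡_ _≡_ T × (∀ β → Differs β → ∃ λ j → T j ≡ β)
    chosen = choose-containing blocks-enumerates {Q = Differs} (differs? x 0V) few (subst (t ≤_) (sym length-blocks) t≤)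
    vanishes : VanishesOutside (proj₁ chosen) x
    vanishes β out = trans (decidable-stable (block x β ≟V block 0V β) differ) (block-0 β)
      where
      differ : ¬ Differs β
      differ ≢ = out (proj₁ (proj₂ (proj₂ chosen) β ≢)) (proj₂ (proj₂ (proj₂ chosen) β ≢))

-- The conditions reduced to constant weight or to uniform covering.

∑-replicate : ∀ {a} {A : Set a} c (x : A) (f : A → ℕ) → ∑ (List.replicate c x) f ≡ c * f x
∑-replicate zero    x f = refl
∑-replicate (suc c) x f = cong (f x +_) (∑-replicate c x f)

module Equivalences (p : ℕ) (p-prime : Prime p) (r m : ℕ) .{{_ : NonZero m}}
    (n : Fin (suc r) → ℕ) .{{_ : NonZero (n (fromℕ r))}}
    (H : LinearAlgebra.Matrix p p-prime m (Blocks.N p p-prime r n))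
        (independent : LinearAlgebra.LinearlyIndependent p p-prime H) where

  open Blocks p p-prime r n
  open Parameters m
  open FiniteField p p-prime
  open VectorSpace p p-prime
  open BlockStructure p p-prime r n
  open Projections p p-prime r n
  open Parameter p p-prime r m n
  open CodeCounting p p-prime r m n H

  private instance
    p≢0 : NonZero p
    p≢0 = prime⇒nonZero p-prime

  C : DecSet Word
  C = nullSpace H

  |C| : ℕ
  |C| = length (elements C)

  p^m*|C| : p ^ m * |C| ≡ p ^ N
  p^m*|C| = trans (cong (p ^ m *_) (length-filter-∑ (mem? C) (allV N))) (Rows.fibre-count H independent 0V)

  codeword≢0 : ∀ {y} → y ≢ 0V → combination y H ≢ 0V
  codeword≢0 {y} y≢0 = y≢0 ∘ independent y

  module _ {t} (T : Fin t → Block) where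

    -- The words of C with prescribed blocks on T are the solutions of one linear system with this
    -- matrix. Uniform counts on T amount to the independence of its rows, and a dependence among
    -- them is a word of C⊥ supported on T.
    stacked : Matrix (m + dim T) N
    stacked = H Vec.++ rows T

    stacked-· : ∀ x → stacked · x ≡ (H · x) Vec.++ target T (λ j → block x (T j))
    stacked-· x = trans (Vecₚ.map-++ (λ row → dot row x) H (rows T)) (cong ((H · x) Vec.++_) (rows-· T x))

    matching : (∀ j → V (size (T j))) → ℕ
    matching a = length (filter (λ x → Finₚ.all? λ j → block x (T j) ≟V a j) (elements C))

    matching-fibre : ∀ a → matching a ≡ Rows.fibre stacked (0V Vec.++ target T a)
    matching-fibre a = begin
      matching a
        ≡⟨ length-filter-∑ matches? (elements C) ⟩
      ∑ (elements C) (λ x → ⟦ matches? x ⟧)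
        ≡⟨ ∑-filter (mem? C) (allV N) _ ⟩
      ∑ (allV N) (λ x → ⟦ mem? C x ⟧ * ⟦ matches? x ⟧)
        ≡⟨ ∑-cong (allV N) (λ x → trans (sym (⟦⟧-× (mem? C x) (matches? x)))
             (⟦⟧-cong (mem? C x ×-dec matches? x) ((stacked · x) ≟V (0V Vec.++ target T a)) (solves x) (solved x))) ⟩
      Rows.fibre stacked (0V Vec.++ target T a) ∎
      where
      open ≡-Reasoning
      matches? : Decidable (λ x → ∀ j → block x (T j) ≡ a j)
      matches? x = Finₚ.all? λ j → block x (T j) ≟V a j
      solves : ∀ x → H · x ≡ 0V × (∀ j → block x (T j) ≡ a j) → stacked · x ≡ 0V Vec.++ target T a
      solves x (Hx≡0 , match) = trans (stacked-· x) (cong₂ Vec._++_ Hx≡0 (target-cong T match))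
      solved : ∀ x → stacked · x ≡ 0V Vec.++ target T a → H · x ≡ 0V × (∀ j → block x (T j) ≡ a j)
      solved x eq with Vecₚ.++-injective (H · x) 0V (trans (sym (stacked-· x)) eq)
      ... | Hx≡0 , match = Hx≡0 , target-injective T match

    ≡uniform⇔ : ∀ a → ↑ matching a ≡
        (_/_ (ℤ.+ |C|) (alphabetProduct T) {{alphabetProduct≢0 T}}) ⇔ matching a * alphabetProduct T ≡ |C|
    ≡uniform⇔ a = ↑≡⇔ (alphabetProduct T) {{alphabetProduct≢0 T}}
        (/-*-cancel |C| (alphabetProduct T) {{alphabetProduct≢0 T}}) (matching a)

    p^[m+dim] : p ^ (m + dim T) ≡ p ^ m * alphabetProduct T
    p^[m+dim] = trans (^-distribˡ-+-* p m (dim T)) (cong (p ^ m *_) (p^dim T))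

    stacked-codeword : ∀ y z → combination (y Vec.++ z) stacked ≡ combination y H +V combination z (rows T)
    stacked-codeword y z = combination-++ y z H (rows T)

    -- The count for the all-zero symbols is the size of the kernel of `stacked`. Its prescribed
    -- value is p^N divided by p to the number of rows, which by `kernel-count` leaves only the
    -- trivial relation among the rows.
    uniform⇒stacked-independent : matching (λ _ → 0V) * alphabetProduct T ≡ |C| → LinearlyIndependent stacked
    uniform⇒stacked-independent uniform = kernel≡1⇒injective (λ c → combination c stacked) (≤-reflexive cokernel≡1)
        (combination-0 stacked)
      where
      open ≡-Reasoning
      rearrange : ∀ a b c → a * b * c ≡ a * (c * b)
      rearrange = solve-∀
      0-target : 0V Vec.++ target T (λ _ → 0V) ≡ 0V
      0-target = trans (cong (0V Vec.++_) (target-0 T)) (0V-++ m (dim T))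
      cokernel≡1 : Rows.cokernel stacked ≡ 1
      cokernel≡1 = *-cancelˡ-≡ (Rows.cokernel stacked) 1 (p ^ N) {{m^n≢0 p N}} (begin
        p ^ N * Rows.cokernel stacked                     ≡⟨ Rows.kernel-count stacked ⟨
        p ^ (m + dim T) * Rows.fibre stacked 0V           ≡⟨ cong₂ _*_ p^[m+dim]
            (trans (cong (Rows.fibre stacked) (sym 0-target)) (sym (matching-fibre (λ _ → 0V)))) ⟩
        p ^ m * alphabetProduct T * matching (λ _ → 0V)   ≡⟨ rearrange (p ^ m) (alphabetProduct T) (matching (λ _ → 0V)) ⟩
        p ^ m * (matching (λ _ → 0V) * alphabetProduct T) ≡⟨ cong (p ^ m *_) uniform ⟩
        p ^ m * |C|                                       ≡⟨ p^m*|C| ⟩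
        p ^ N                                             ≡⟨ *-identityʳ (p ^ N) ⟨
        p ^ N * 1                                         ∎)

    stacked-independent⇒uniform : LinearlyIndependent stacked → ∀ a → matching a * alphabetProduct T ≡ |C|
    stacked-independent⇒uniform stacked-independent a = *-cancelˡ-≡ _ _ (p ^ m) {{m^n≢0 p m}} (begin
      p ^ m * (matching a * alphabetProduct T)                       ≡⟨ rearrange (p ^ m) (matching a) (alphabetProduct T) ⟩
      p ^ m * alphabetProduct T * matching a                         ≡⟨ cong₂ _*_ (sym p^[m+dim]) (matching-fibre a) ⟩
      p ^ (m + dim T) * Rows.fibre stacked (0V Vec.++ target T a)    ≡⟨ Rows.fibre-count stacked stacked-independent _ ⟩
      p ^ N                                                          ≡⟨ p^m*|C| ⟨
      p ^ m * |C|                                                    ∎)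
      where
      open ≡-Reasoning
      rearrange : ∀ a b c → a * (b * c) ≡ a * c * b
      rearrange = solve-∀

  -- A word of C⊥ with at most t nonzero blocks is also a combination of the unit rows of some T;
  -- the difference of its two expressions is a relation among the rows of `stacked T`.
  orthogonalArray⇒minimumWeight : ∀ {t} → IsOrthogonalArray (elements C) t → ∀ y → y ≢ 0V → t < wt y
  orthogonalArray⇒minimumWeight {t} oa y y≢0 = ≰⇒> λ light → y≢0 (vanish (choose-support (combination y H) light t≤n))
    where
    open IsOrthogonalArray oa
    vanish : (∃ λ (T : Fin t → Block) → Injective _≡_ _≡_ T × VanishesOutside T (combination y H)) → y ≡ 0V
    vanish (T , T-injective , vanishes) = trans (sym (V+.⁻¹-involutive y)) (trans (cong -V_ -y≡0) V+.ε⁻¹≈ε)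
      where
      z : V (dim T)
      z = target T (λ j → block (combination y H) (T j))
      cancels : combination ((-V y) Vec.++ z) (stacked T) ≡ 0V
      cancels = trans (stacked-codeword T (-V y) z)
        (trans (cong₂ _+V_ (combination-neg y H) (placed-blocks T T-injective (combination y H) vanishes)) (V+.inverseˡ _))
      -y≡0 : -V y ≡ 0V
      -y≡0 = Vecₚ.++-injectiveˡ (-V y) 0V (trans (uniform⇒stacked-independent T
        (Equivalence.to (≡uniform⇔ T (λ _ → 0V)) (uniform T T-injective (λ _ → 0V))) ((-V y) Vec.++ z) cancels)
            (sym (0V-++ m (dim T))))

  -- In a relation among the rows of `stacked T` the part from H is a word of C⊥ vanishing outside
  -- T. Its weight is at most t, so its coefficient vector is zero, and then the part from the unit
  -- rows vanishes block by block.
  minimumWeight⇒orthogonalArray : ∀ {t} → t ≤ #blocks → (∀ y → y ≢ 0V → t < wt y) → IsOrthogonalArray (elements C) t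
  minimumWeight⇒orthogonalArray {t} t≤#blocks t<wt = record
    { nonempty = λ C≡[] → ℕ.≢-nonZero⁻¹ (p ^ N) {{m^n≢0 p N}} (trans (sym p^m*|C|)
        (trans (cong (λ xs → p ^ m * length xs) C≡[]) (*-zeroʳ (p ^ m))))
    ; t≤n      = t≤#blocks
    ; uniform  = λ T T-injective a → Equivalence.from (≡uniform⇔ T a)
        (stacked-independent⇒uniform T (stacked-independent T T-injective) a)
    }
    where
    module _ (T : Fin t → Block) (T-injective : Injective _≡_ _≡_ T) where
      independent′ : ∀ y a → combination y H +V placed T a ≡ 0V → y Vec.++ target T a ≡ 0V
      independent′ y a sum≡0 = trans (cong₂ Vec._++_ y≡0 (trans (target-cong T a≡0) (target-0 T))) (0V-++ m (dim T))
        where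
        vanishes : VanishesOutside T (combination y H)
        vanishes β out = begin
          block (combination y H) β                          ≡⟨ V+.identityʳ _ ⟨
          block (combination y H) β +V 0V                    ≡⟨ cong (block (combination y H) β +V_)
              (block-placed-outside T a β out) ⟨
          block (combination y H) β +V block (placed T a) β  ≡⟨ block-+ (combination y H) (placed T a) β ⟨
          block (combination y H +V placed T a) β            ≡⟨ cong (λ x → block x β) sum≡0 ⟩
          block 0V β                                         ≡⟨ block-0 β ⟩
          0V                                                 ∎
          where open ≡-Reasoning
        y≡0 : y ≡ 0V
        y≡0 = decidable-stable (y ≟V 0V) λ y≢0 → <⇒≱ (t<wt y y≢0) (weight-≤ T (combination y H) vanishes)
        placed≡0 : placed T a ≡ 0V
        placed≡0 = trans (sym (V+.identityˡ (placed T a)))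
          (trans (cong (_+V placed T a) (sym (trans (cong (λ y → combination y H) y≡0) (combination-0 H)))) sum≡0)
        a≡0 : ∀ j → a j ≡ 0V
        a≡0 j = trans (sym (block-placed-inside T T-injective a j))
            (trans (cong (λ x → block x (T j)) placed≡0) (block-0 (T j)))

      stacked-independent : LinearlyIndependent (stacked T)
      stacked-independent c combination≡0 = split (Vec.splitAt m c) combination≡0
        where
        split : ∀ {c} → (∃ λ y → ∃ λ z → c ≡ y Vec.++ z) → combination c (stacked T) ≡ 0V → c ≡ 0V
        split (y , z , refl) eq with target-surjective T z
        ... | a , refl = independent′ y a (trans (sym (stacked-codeword T y (target T a))) eq)

  nonzeroVector : ∃ λ (y : V m) → y ≢ 0V
  nonzeroVector = Vec.replicate m 1F , λ ≡0 → 1F≢0F (trans (sym (Vecₚ.lookup-replicate i 1F))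
      (trans (cong (λ y → lookup y i) ≡0) (Vecₚ.lookup-replicate i 0F)))
    where
    i : Fin m
    i = fromℕ< (ℕ.>-nonZero⁻¹ m)

  IsExtremalArray : ℕ → Set
  IsExtremalArray t = IsWeight (suc t) × IsOrthogonalArray (elements C) t

  extremalArray⇒constantWeight : ∀ {t} → IsExtremalArray t → ConstantWeight
  extremalArray⇒constantWeight {t} (isWeight , oa) = minimumWeight⇒constantWeight (suc t) isWeight
      (orthogonalArray⇒minimumWeight oa)

  constantWeight⇒extremalArray : ConstantWeight → ∃ IsExtremalArray
  constantWeight⇒extremalArray constant = from (wt y₀) refl
    where
    y₀ : V m
    y₀ = proj₁ nonzeroVector
    y₀≢0 : y₀ ≢ 0V
    y₀≢0 = proj₂ nonzeroVector
    from : ∀ w → wt y₀ ≡ w → ∃ IsExtremalArray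
    -- Weight 0 would give k p^m = 0, contrary to k > 0. Hence the weight has the form t + 1, and t
    -- is the strength sought.
    from zero    wt≡0 = contradiction (trans (cong (_* D) (sym wt≡0)) (constant y₀ y₀≢0))
      (<⇒≢ (*-mono-< 0<k (ℕ.>-nonZero⁻¹ (p ^ m) {{m^n≢0 p m}})))
    from (suc t) wt≡  = t , trans (cong (_* D) (sym wt≡))
        (constant y₀ y₀≢0) , minimumWeight⇒orthogonalArray t≤#blocks λ y y≢0 →
      ≤-reflexive (*-cancelʳ-≡ (suc t) (wt y) D (trans (trans (cong (_* D) (sym wt≡)) (constant y₀ y₀≢0))
          (sym (constant y y≢0))))
      where
      t≤#blocks : t ≤ #blocks
      t≤#blocks = ≤-trans (n≤1+n t) (≤-trans (≤-reflexive (sym wt≡))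
          (≤-trans (m≤m+n (wt y₀) (zeros y₀)) (≤-reflexive (sym (#blocks≡wt+zeros y₀)))))

  i⇔i′ : (∃ λ t → IsOrthogonalArray (elements C) t × ↑ |C| ≡ bierbrauerFriedman t) ⇔
      (∃ λ t → ↑ t ≡ τ × IsOrthogonalArray (elements C) t)
  i⇔i′ = mk⇔ (λ (t , oa , bound) → t , Equivalence.from (≡τ⇔ t)
      (Equivalence.to (≡bierbrauerFriedman⇔ |C| p^m*|C| t) bound) , oa)
             (λ (t , t≡τ , oa) → t , oa , Equivalence.from (≡bierbrauerFriedman⇔ |C| p^m*|C| t) (Equivalence.to (≡τ⇔ t) t≡τ))

  i′⇔constantWeight : (∃ λ t → ↑ t ≡ τ × IsOrthogonalArray (elements C) t) ⇔ ConstantWeight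
  i′⇔constantWeight = mk⇔ (λ (t , t≡τ , oa) → extremalArray⇒constantWeight (Equivalence.to (≡τ⇔ t) t≡τ , oa))
    (λ constant → restate (constantWeight⇒extremalArray constant))
    where
    restate : ∃ IsExtremalArray → ∃ λ t → ↑ t ≡ τ × IsOrthogonalArray (elements C) t
    restate (t , isWeight , oa) = t , Equivalence.from (≡τ⇔ t) isWeight , oa

  uniform⇔constantWeight : UniformCovering ⇔ ConstantWeight
  uniform⇔constantWeight = mk⇔ uniform⇒constantWeight constantWeight⇒uniform

  iii⇔constantWeight : (AlphabetEffective (Span H) × IsOneWeight (Span H) (μ ℚ.* p^[m-s])) ⇔ ConstantWeight
  iii⇔constantWeight = mk⇔
    (λ (_ , oneWeight) y y≢0 → Equivalence.to (≡weight⇔ (wt y))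
        (IsOneWeight.weights oneWeight (combination y H) (y , refl) (codeword≢0 y≢0)))
    (λ constant → effective constant , record
      { additive = Span-isSubspace H
      ; weights  = λ { _ (y , refl) x≢0 → Equivalence.from (≡weight⇔ (wt y))
                       (constant y λ y≡0 → x≢0 (trans (cong (λ y → combination y H) y≡0) (combination-0 H))) }
      })
    where
    -- Constant weight forces independent columns in each block through the uniform covering. The
    -- symbols of block β run over the image of y ↦ `columns β · y`, the adjoint of an injective
    -- map, and so over the whole alphabet.
    effective : ConstantWeight → AlphabetEffective (Span H)
    effective constant β a = combination (proj₁ preimage) H , (proj₁ preimage , refl) , trans
        (block-codeword (proj₁ preimage) β) (proj₂ preimage)
      where
      preimage : ∃ λ y → columns β · y ≡ a
      preimage = Rows.surjective (columns β) (uniform⇒injective (constantWeight⇒uniform constant) β) a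

  cover : V m → ℕ
  cover v = ∑ blocks (λ β → p ^ (s ∸ size β) * ⟦ mem? (blockSpace H β) v ⟧)

  count-multisetM : ∀ v → count v (multisetM H) ≡ cover v
  count-multisetM v = trans (length-filter-∑ (λ U → mem? U v) (multisetM H))
    (trans (∑-concatMap (λ β → List.replicate (p ^ (s ∸ size β)) (blockSpace H β)) blocks (λ U → ⟦ mem? U v ⟧))
      (∑-cong blocks λ β → ∑-replicate (p ^ (s ∸ size β)) (blockSpace H β) (λ U → ⟦ mem? U v ⟧)))

  member≤fibre : ∀ β v → ⟦ mem? (blockSpace H β) v ⟧ ≤ fibre β v
  member≤fibre β v = ⟦⟧-≤ (mem? (blockSpace H β) v) λ (a , eq) →
    ≤-trans (≤-reflexive (sym (⟦⟧-yes (combination a (columns β) ≟V v) eq)))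
            (∑-member (λ a → ⟦ combination a (columns β) ≟V v ⟧) (allV.member a))

  member≡fibre : ∀ β → LinearlyIndependent (columns β) → ∀ v → ⟦ mem? (blockSpace H β) v ⟧ ≡ fibre β v
  member≡fibre β columns-independent v = ⟦⟧-≡ (mem? (blockSpace H β) v)
    (λ (a , eq) → allV.∑-unique (λ a → combination a (columns β) ≟V v) a eq λ b eq′ → V+.x∙y⁻¹≈ε⇒x≈y b a
      (columns-independent _ (trans (combination-+ b (-V a) (columns β))
        (trans (cong₂ _+V_ (trans eq′ (sym eq)) (combination-neg a (columns β))) (V+.inverseʳ _)))))
    (λ none → allV.∑-none (λ a → combination a (columns β) ≟V v) λ a eq → none (a , eq))

  cover≤φ : ∀ v → cover v ≤ φ v
  cover≤φ v = ∑-mono-≤ blocks λ β → *-monoʳ-≤ (p ^ (s ∸ size β)) (member≤fibre β v)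

  -- Here multiplicities count vectors of H_β, while φ counts coefficient vectors and may be larger.
  -- Off 0, however, `cover` already sums to k, and φ to at most k because φ(0) ≥ σ and the total is
  -- k + σ. Hence the two agree at every nonzero vector.
  uniformCover⇒uniform : (∀ v → v ≢ 0V → cover v * P ≡ k) → UniformCovering
  uniformCover⇒uniform uniform v v≢0 = trans (cong (_* P) (sym cover≡φ)) (uniform v v≢0)
    where
    open ≤-Reasoning
    off-0 : (V m → ℕ) → V m → ℕ
    off-0 f v = ⟦ ¬? (v ≟V 0V) ⟧ * f v
    at-v : ∀ f → off-0 f v ≡ f v
    at-v f = trans (cong (_* f v) (⟦⟧-yes (¬? (v ≟V 0V)) v≢0)) (*-identityˡ (f v))
    scaled : ∀ v → off-0 cover v * P ≡ ⟦ ¬? (v ≟V 0V) ⟧ * k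
    scaled v with v ≟V 0V
    ... | yes _  = refl
    ... | no v≢0 = trans (cong (_* P) (*-identityˡ (cover v))) (trans (uniform v v≢0) (sym (*-identityˡ k)))
    ∑-cover : ∑ (allV m) (off-0 cover) ≡ k
    ∑-cover = *-cancelʳ-≡ _ k P {{p^m∸1≢0}} (trans (sym (∑-*ʳ (allV m) (off-0 cover) P))
      (trans (∑-cong (allV m) scaled) (trans (∑-*ʳ (allV m) _ k) (trans (cong (_* k) ∑-nonzero) (*-comm P k)))))
    split : ∀ v → off-0 φ v + ⟦ v ≟V 0V ⟧ * φ v ≡ φ v
    split v = trans (sym (*-distribʳ-+ (φ v) ⟦ ¬? (v ≟V 0V) ⟧ _))
        (trans (cong (_* φ v) (⟦⟧-¬ (v ≟V 0V))) (*-identityˡ (φ v)))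
    ∑-φ≤ : ∑ (allV m) (off-0 φ) ≤ ∑ (allV m) (off-0 cover)
    ∑-φ≤ = +-cancelʳ-≤ σ _ _ (begin
      ∑ (allV m) (off-0 φ) + σ                                          ≤⟨ +-monoʳ-≤ (∑ (allV m) (off-0 φ)) σ≤φ-0 ⟩
      ∑ (allV m) (off-0 φ) + φ 0V                                       ≡⟨ cong (∑ (allV m) (off-0 φ) +_)
          (allV.∑-delta 0V φ) ⟨
      ∑ (allV m) (off-0 φ) + ∑ (allV m) (λ v → ⟦ v ≟V 0V ⟧ * φ v)       ≡⟨ ∑-+ (allV m) (off-0 φ) _ ⟨
      ∑ (allV m) (λ v → off-0 φ v + ⟦ v ≟V 0V ⟧ * φ v)                  ≡⟨ ∑-cong (allV m) split ⟩
      ∑ (allV m) φ                                                      ≡⟨ φ-total ⟩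
      k + σ                                                             ≡⟨ cong (_+ σ) ∑-cover ⟨
      ∑ (allV m) (off-0 cover) + σ                                      ∎)
    cover≡φ : cover v ≡ φ v
    cover≡φ = trans (sym (at-v cover)) (trans (∑-tight {xs = allV m} {f = off-0 cover} {g = off-0 φ}
      (λ v → *-monoʳ-≤ ⟦ ¬? (v ≟V 0V) ⟧ (cover≤φ v)) ∑-φ≤ (allV.member v)) (at-v φ))

  uniform⇒cover≡φ : UniformCovering → ∀ v → cover v ≡ φ v
  uniform⇒cover≡φ uniform v = ∑-cong blocks λ β → cong (p ^ (s ∸ size β) *_) (member≡fibre β (uniform⇒injective uniform β) v)

  iv⇔uniform : IsFoldPartition μ (multisetM H) ⇔ UniformCovering
  iv⇔uniform = mk⇔
    (λ partition → uniformCover⇒uniform λ v v≢0 → trans (cong (_* P) (sym (count-multisetM v)))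
      (Equivalence.to (≡μ⇔ (count v (multisetM H))) (IsFoldPartition.exactly partition v v≢0)))
    (λ uniform → record
      { subspaces = Allₚ.concat⁺ (Allₚ.map⁺ (All.universal (λ β → Allₚ.replicate⁺ (p ^ (s ∸ size β))
          (Span-isSubspace (columns β))) blocks))
      ; exactly   = λ v v≢0 → Equivalence.from (≡μ⇔ (count v (multisetM H)))
          (trans (cong (_* P) (trans (count-multisetM v) (uniform⇒cover≡φ uniform v))) (uniform v v≢0))
      })

  ⊥-columns : ∀ β y → Mem (blockSpace H β ^⊥) y ⇔ columns β · y ≡ 0V
  ⊥-columns β y = mk⇔
    (λ y⊥ → V-ext-dot λ c → trans (dot-comm _ c) (trans (trans (sym (combination-dot c (columns β) y))
        (y⊥ _ (c , refl))) (sym (dot-0ˡ c))))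
    (λ { ·y≡0 _ (c , refl) → trans (combination-dot c (columns β) y) (trans (cong (dot c) ·y≡0) (dot-0ʳ c)) })

  count-multisetM⊥ : ∀ y → count y (multisetM⊥ H) ≡ zeros y
  count-multisetM⊥ y = trans (length-filter-∑ (λ U → mem? U y) (multisetM⊥ H))
    (trans (∑-map (λ β → blockSpace H β ^⊥) blocks (λ U → ⟦ mem? U y ⟧))
      (∑-cong blocks λ β → ⟦⟧-cong (mem? (blockSpace H β ^⊥) y) ((columns β · y) ≟V 0V)
        (Equivalence.to (⊥-columns β y)) (Equivalence.from (⊥-columns β y))))

  v⇔constantWeight : IsFoldPartition ν (multisetM⊥ H) ⇔ ConstantWeight
  v⇔constantWeight = mk⇔
    (λ partition y y≢0 → Equivalence.to (≡ν y) (IsFoldPartition.exactly partition y y≢0))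
    (λ constant → record
      { subspaces = Allₚ.map⁺ (All.universal (λ β → ^⊥-isSubspace (blockSpace H β)) blocks)
      ; exactly   = λ y y≢0 → Equivalence.from (≡ν y) (constant y y≢0)
      })
    where
    ≡ν : ∀ y → ↑ count y (multisetM⊥ H) ≡ ν ⇔ IsWeight (wt y)
    ≡ν y = ≡ν⇔ (count y (multisetM⊥ H)) (wt y) (trans (#blocks≡wt+zeros y) (cong (wt y +_) (sym (count-multisetM⊥ y))))

  open Multigraph graph using (edges; degree)

  edges-∑ : ∀ x S → edges x S ≡ ∑ blocks (λ β → p ^ (s ∸ size β) * ∑ (allV (size β))
      (λ e → ⟦ ¬? (e ≟V 0V) ⟧ * ⟦ mem? S (x +V insert β e) ⟧))
  edges-∑ x S = trans (∑-filter (mem? S) (allV N) (λ y → edgeMultiplicity (differences x y)))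
      (neighbours x (λ y → ⟦ mem? S y ⟧))

  ∑-steps : ∑ blocks (λ β → p ^ (s ∸ size β) * ∑ (allV (size β)) (λ e → ⟦ ¬? (e ≟V 0V) ⟧)) ≡ k
  ∑-steps = +-cancelʳ-≡ σ _ _ (begin
    ∑ blocks (λ β → p ^ (s ∸ size β) * steps β) + σ                           ≡⟨ ∑-+ blocks _ _ ⟨
    ∑ blocks (λ β → p ^ (s ∸ size β) * steps β + p ^ (s ∸ size β))            ≡⟨ ∑-cong blocks per-block ⟩
    ∑ blocks (λ _ → p ^ s)                                                    ≡⟨ ∑-blocks-const (p ^ s) ⟩
    #blocks * p ^ s                                                           ≡⟨ k+σ ⟨
    k + σ                                                                     ∎)
    where
    open ≡-Reasoning
    steps : Block → ℕ
    steps β = ∑ (allV (size β)) (λ e → ⟦ ¬? (e ≟V 0V) ⟧)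
    1+steps : ∀ β → 1 + steps β ≡ p ^ size β
    1+steps β = begin
      1 + steps β                                                             ≡⟨ +-comm 1 (steps β) ⟩
      steps β + 1                                                             ≡⟨ cong (steps β +_) (allV.once {size β} 0V) ⟨
      steps β + ∑ (allV (size β)) (λ e → ⟦ e ≟V 0V ⟧)                         ≡⟨ ∑-+ (allV (size β)) _ _ ⟨
      ∑ (allV (size β)) (λ e → ⟦ ¬? (e ≟V 0V) ⟧ + ⟦ e ≟V 0V ⟧)                ≡⟨ ∑-cong (allV (size β))
          (λ e → ⟦⟧-¬ (e ≟V 0V)) ⟩
      ∑ (allV (size β)) (λ _ → 1)                                             ≡⟨ trans (∑V-const (size β) 1)
          (*-identityʳ _) ⟩
      p ^ size β                                                              ∎
    per-block : ∀ β → p ^ (s ∸ size β) * steps β + p ^ (s ∸ size β) ≡ p ^ s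
    per-block β = trans (+-comm _ (p ^ (s ∸ size β))) (trans (sym (*-suc (p ^ (s ∸ size β)) (steps β)))
      (trans (cong (p ^ (s ∸ size β) *_) (1+steps β)) (p^[s∸size]*p^size β)))

  degree≡k : ∀ x → degree x ≡ k
  degree≡k x = begin
    degree x                                                                  ≡⟨ ∑-cong (allV N)
        (λ y → *-identityˡ (edgeMultiplicity (differences x y))) ⟨
    ∑ (allV N) (λ y → 1 * edgeMultiplicity (differences x y))                 ≡⟨ neighbours x (λ _ → 1) ⟩
    ∑ blocks (λ β → p ^ (s ∸ size β) * ∑ (allV (size β)) (λ e → ⟦ ¬? (e ≟V 0V) ⟧ * 1))
      ≡⟨ ∑-cong blocks (λ β → cong (p ^ (s ∸ size β) *_) (∑-cong (allV (size β)) λ e → *-identityʳ _)) ⟩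
    ∑ blocks (λ β → p ^ (s ∸ size β) * ∑ (allV (size β)) (λ e → ⟦ ¬? (e ≟V 0V) ⟧)) ≡⟨ ∑-steps ⟩
    k ∎
    where open ≡-Reasoning

  syndrome-step : ∀ x β e → H · (x +V insert β e) ≡ H · x +V combination e (columns β)
  syndrome-step x β e = trans (·-+ H x (insert β e)) (cong (H · x +V_) (·-insert-columns β e))

  -- From a codeword, a nonzero step e in block β has syndrome H_β e, which is nonzero by
  -- independence of the columns. So all k edges leave C.
  edges-inside : UniformCovering → ∀ x → Mem C x → edges x (∁ C) ≡ k
  edges-inside uniform x x∈C = trans (edges-∑ x (∁ C))
    (trans (∑-cong blocks λ β → cong (p ^ (s ∸ size β) *_) (∑-cong (allV (size β)) (leaves β))) ∑-steps)
    where
    leaves : ∀ β e → ⟦ ¬? (e ≟V 0V) ⟧ * ⟦ mem? (∁ C) (x +V insert β e) ⟧ ≡ ⟦ ¬? (e ≟V 0V) ⟧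
    leaves β e with e ≟V 0V
    ... | yes _  = refl
    ... | no e≢0 = trans (*-identityˡ _) (⟦⟧-yes (mem? (∁ C) (x +V insert β e)) λ x+e∈C → e≢0 (uniform⇒injective uniform β e
          (trans (sym (V+.identityˡ _)) (trans (cong (_+V combination e (columns β)) (sym x∈C))
              (trans (sym (syndrome-step x β e)) x+e∈C)))))

  -- A step e in block β enters C exactly when H_β e cancels the syndrome of x. The excluded step e
  -- = 0 does not disturb the count, because that syndrome is nonzero.
  edges-outside : ∀ x → ¬ Mem C x → edges x C ≡ φ (-V (H · x))
  edges-outside x x∉C = trans (edges-∑ x C) (∑-cong blocks λ β → cong (p ^ (s ∸ size β) *_)
      (∑-cong (allV (size β)) (enters β)))
    where
    returns : ∀ β e → Mem C (x +V insert β e) → combination e (columns β) ≡ -V (H · x)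
    returns β e x+e∈C = V+.inverseʳ-unique (H · x) _ (trans (sym (syndrome-step x β e)) x+e∈C)
    enters : ∀ β e → ⟦ ¬? (e ≟V 0V) ⟧ * ⟦ mem? C (x +V insert β e) ⟧ ≡ ⟦ combination e (columns β) ≟V (-V (H · x)) ⟧
    enters β e with e ≟V 0V
    ... | no _     = trans (*-identityˡ _) (⟦⟧-cong (mem? C (x +V insert β e))
        (combination e (columns β) ≟V (-V (H · x))) (returns β e)
                       λ eq → trans (syndrome-step x β e) (trans (cong (H · x +V_) eq) (V+.inverseʳ (H · x))))
    ... | yes refl = sym (⟦⟧-no (combination 0V (columns β) ≟V (-V (H · x))) λ eq → x∉C
                       (V+.⁻¹-injective (trans (sym eq) (trans (combination-0 (columns β)) (sym V+.ε⁻¹≈ε)))))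

  ii⇔uniform : IsCRCode graph C (↑ k) μ ⇔ UniformCovering
  ii⇔uniform = mk⇔ to from
    where
    -- Independence of the rows makes every vector a syndrome, so each nonzero v is minus the
    -- syndrome of some word outside C, and `edges-outside` reads φ(v) off its edges.
    to : IsCRCode graph C (↑ k) μ → UniformCovering
    to cr v v≢0 = at (Rows.surjective H independent (-V v))
      where
      at : (∃ λ x → H · x ≡ -V v) → φ v * P ≡ k
      at (x , Hx≡-v) = trans (cong (_* P) (sym (trans (edges-outside x x∉C)
          (cong φ (trans (cong -V_ Hx≡-v) (V+.⁻¹-involutive v))))))
        (Equivalence.to (≡μ⇔ (edges x C)) (IsCRCode.outside cr x x∉C))
        where
        x∉C : ¬ Mem C x
        x∉C Hx≡0 = v≢0 (V+.⁻¹-injective (trans (sym Hx≡-v) (trans Hx≡0 (sym V+.ε⁻¹≈ε))))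
    from : UniformCovering → IsCRCode graph C (↑ k) μ
    from uniform = record
      { regular = k , degree≡k
      ; b>0     = ℚₚ.positive⁻¹ (↑ k) {{ℚₚ.normalize-pos k 1 {{_}} {{ℕ.>-nonZero 0<k}}}}
      ; c>0     = ℚₚ.positive⁻¹ μ {{ℚₚ.normalize-pos k (p ^ m ∸ 1) {{p^m∸1≢0}} {{ℕ.>-nonZero 0<k}}}}
      ; inside  = λ x x∈C → cong ↑_ (edges-inside uniform x x∈C)
      ; outside = λ x x∉C → Equivalence.from (≡μ⇔ (edges x C)) (trans (cong (_* P) (edges-outside x x∉C))
          (uniform (-V (H · x)) λ -Hx≡0 → x∉C (V+.⁻¹-injective (trans -Hx≡0 (sym V+.ε⁻¹≈ε)))))
      }

theorem14 :
    (p : ℕ) (p-prime : Prime p) (r m : ℕ) .{{_ : NonZero m}}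
    (n : Fin (suc r) → ℕ) .{{_ : NonZero (n (fromℕ r))}} →
    let open Blocks p p-prime r n
        open Parameters m
    in (H : Matrix m N) → HasRank H m →
    let C    = nullSpace H
        C⊥   = Span H
        |C|  = length (elements C)
        i    = ∃ λ t → IsOrthogonalArray (elements C) t × ↑ |C| ≡ bierbrauerFriedman t
        i′   = ∃ λ t → ↑ t ≡ τ × IsOrthogonalArray (elements C) t
        ii   = IsCRCode graph C (↑ k) μ
        iii  = AlphabetEffective C⊥ × IsOneWeight C⊥ (μ ℚ.* p^[m-s])
        iv   = IsFoldPartition μ (multisetM H)
        v    = IsFoldPartition ν (multisetM⊥ H)
    in (i ⇔ i′) × (i′ ⇔ ii) × (ii ⇔ iii) × (iii ⇔ iv) × (iv ⇔ v)
theorem14 p p-prime r m n H rank =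
  i⇔i′ ,
  ⇔.trans i′⇔constantWeight (⇔.sym ii⇔constantWeight) ,
  ⇔.trans ii⇔constantWeight (⇔.sym iii⇔constantWeight) ,
  ⇔.trans iii⇔constantWeight (⇔.sym iv⇔constantWeight) ,
  ⇔.trans iv⇔constantWeight (⇔.sym v⇔constantWeight)
  where
  open Equivalences p p-prime r m n H (VectorSpace.fullRank⇒independent p p-prime H rank)
  ii⇔constantWeight = ⇔.trans ii⇔uniform uniform⇔constantWeight
  iv⇔constantWeight = ⇔.trans iv⇔uniform uniform⇔constantWeight
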